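{- There exists an absolute constant $c>0$ such that the following holds. Let $n,m\ge 1$ be integers and let $M$ be an $n\times n$ random integer matrix whose entries are chosen independently and uniformly from $\{ -m,\ldots,m\}$. Then $$\Pr[M \text{ is singular}] \le m^{ -cn}.$$ -}

module Defs where

open import Data.Nat as ℕ using (ℕ; zero; suc)
open import Data.Integer as ℤ using (ℤ; +_)
open import Data.Fin using (Fin; zero; suc; punchIn; toℕ)
open import Data.List using (List; []; _∷_; map; concatMap; length; filter; upTo; allFin; foldr)
open import Data.Vec using (Vec; []; _∷_; lookup)

Matrix : ℕ → Set
Matrix n = Fin n → Fin n → ℤ

minor : ∀ {n} → Matrix (suc n) → Fin (suc n) → Matrix n
minor A j r c = A (suc r) (punchIn j c)

det : ∀ {n} → Matrix n → ℤ
det {zero} A = + 1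
det {suc n} A =
  foldr ℤ._+_ (+ 0)
    (map (λ j → ((ℤ.- + 1) ℤ.^ toℕ j) ℤ.* (A zero j ℤ.* det (minor A j))) (allFin (suc n)))

range : ℕ → List ℤ
range m = map (λ k → + k ℤ.- + m) (upTo (suc (2 ℕ.* m)))

allVecs : ∀ {A : Set} → List A → (k : ℕ) → List (Vec A k)
allVecs xs zero = [] ∷ []
allVecs xs (suc k) = concatMap (λ x → map (x ∷_) (allVecs xs k)) xs

toMatrix : ∀ {n} → Vec (Vec ℤ n) n → Matrix n
toMatrix M i j = lookup (lookup M i) j

-- all n×n matrices with entries in {-m,…,m} (each exactly once; (2m+1)^(n²) of them)
allMatrices : (n : ℕ) → ℕ → List (Vec (Vec ℤ n) n)
allMatrices n m = allVecs (allVecs (range m) n) n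

singularCount : ℕ → ℕ → ℕ
singularCount n m = length (filter (λ M → det (toMatrix M) ℤ.≟ + 0) (allMatrices n m))

{-# OPTIONS --safe #-}

-- The rows are handled by the Kahn–Komlós–Szemerédi exchange argument. Suppose that the first i rows
-- X₁,…,Xᵢ are independent and that the next row lies in their span V. If Pr[X ∈ V] is small there is
-- nothing to do. Otherwise V is compared with a second row law Y: a uniform entry X is, up to a small
-- blocked part, an offset plus a sum of many independent uniform pieces Z, and Y is the masked
-- difference Z - Z′ of two pieces. Since ℤⁿ/V is an ordered group, each doubling of the number of
-- pieces decreases the collision probability in ℤⁿ/V by a constant factor, so
-- Pr[X ∈ V] ≤ m^(-c) Pr[Y ∈ V]. Replacing most of the rows X₁,…,Xᵢ by rows Y in V and summing over the
-- (few) ways to complete these to a spanning set of V gains this factor for almost every row.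
module Submission where

open import Defs
open import Algebra.Properties.AbelianGroup using (∙-cancelˡ; ∙-cancelʳ)
open import Algebra.Properties.CommutativeSemigroup using (interchange)
open import Algebra.Structures using (IsAbelianGroup)
open import Data.Bool using (Bool; true; false)
open import Data.Empty using (⊥; ⊥-elim)
open import Data.Fin using (Fin; zero; suc; punchIn; toℕ)
open import Data.Fin.Properties using (any?)
open import Data.Integer as ℤ using (ℤ; 0ℤ; 1ℤ; -1ℤ)
import Data.Integer.Properties as ℤₚ
import Data.Integer.Tactic.RingSolver as ℤ-Solver
open import Data.List as List using (List; []; _∷_; _++_; map; concatMap; length; filter; foldr; allFin; upTo; applyUpTo)
open import Data.List.Properties using (length-map; map-tabulate; length-upTo)
open import Data.List.Relation.Unary.All as All using (All; []; _∷_)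
open import Data.List.Relation.Unary.All.Properties using (++⁺; ++⁻ˡ; ++⁻ʳ; map⁺; applyUpTo⁺₁)
open import Data.List.Relation.Unary.Any as Any using (Any; here; there)
open import Data.Nat as ℕ using (ℕ; zero; suc; _+_; _*_; _^_; _∸_; _≤_; _<_; z≤n; s≤s; _≤?_; _<?_)
open import Data.Nat.DivMod using (_/_; _%_; m≡m%n+[m/n]*n; m%n<n)
open import Data.Nat.Properties hiding (_≟_)
open import Data.Nat.Tactic.RingSolver using (solve-∀)
open import Data.Product using (Σ; ∃; _×_; _,_; proj₁; proj₂)
open import Data.Sum using (_⊎_; inj₁; inj₂)
open import Data.Vec as Vec using (Vec; []; _∷_; lookup; zipWith; replicate; insertAt)
open import Data.Vec.Functional as Vector using (Vector)
open import Data.Vec.Functional.Properties as Vector using (insertAt-punchIn)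
open import Data.Vec.Properties using (≡-dec; ∷-injective; map-insertAt; insertAt-lookup; lookup-zip; zipWith-assoc; zipWith-comm; zipWith-identityˡ; zipWith-identityʳ; zipWith-inverseˡ; zipWith-inverseʳ)
open import Function using (_∘_; id)
open import Relation.Binary.Definitions using (DecidableEquality; tri<; tri≈; tri>)
open import Relation.Binary.PropositionalEquality
open import Relation.Nullary using (¬_; Dec; yes; no; ¬?; _×-dec_; _⊎-dec_)
open import Relation.Nullary.Decidable using (decidable-stable; from-yes)

-- The number of subspaces V that rows can span is out of control, so a union bound over V is
-- hopeless. Weighting each V by a negative power of its `count` makes the sum over V collapse: what
-- remains is the choice of the rows that complete the rows Y to a spanning set, at a price of about
-- 1 + 1/u per row. The requirement b/a ≥ (1 + 1/u)² on the gain pays this price with something left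
-- over. The rows Y must be independent inside V. This is why 3t rows stay unexchanged: a subspace
-- of codimension 3t is negligible next to a V with Pr[X ∈ V] > (a/b)^t. The gain per doubling needs
-- no Fourier analysis. If nearly all differences of two samples were near-periods of the law,
-- adding the greatest near-period would produce many differences that are not. The argument starts
-- only if the law is not concentrated on one coset of V, which requires a free slot at a coordinate
-- whose unit vector lies outside V. Rows blocked there are charged to rows with Z = Z′ at that
-- coordinate, which is why the blocked part must be small. Probabilities appear as counts over
-- lists with multiplicity, and every bound a/b is cleared of denominators.

private variable
  A₁ A₂ A₃ : Set
  n : ℕ

-- Finite sums

cancel-≤ : ∀ c {x y} → 0 < c → c * x ≤ c * y → x ≤ y
cancel-≤ (suc c) _ = *-cancelˡ-≤ (suc c)

0<^ : ∀ {m} k → 0 < m → 0 < m ^ k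
0<^ zero    _  = s≤s z≤n
0<^ (suc k) lt = *-mono-< lt (0<^ k lt)

^-distribʳ-* : ∀ k m n → (m * n) ^ k ≡ m ^ k * n ^ k
^-distribʳ-* zero    m n = refl
^-distribʳ-* (suc k) m n = trans (cong (m * n *_) (^-distribʳ-* k m n)) (shuffle m n (m ^ k) (n ^ k))
  where
  shuffle : ∀ m n p q → m * n * (p * q) ≡ m * p * (n * q)
  shuffle = solve-∀

∑ : List A₁ → (A₁ → ℕ) → ℕ
∑ []       f = 0
∑ (x ∷ xs) f = f x + ∑ xs f

∑-cong : (xs : List A₁) {f g : A₁ → ℕ} → (∀ x → f x ≡ g x) → ∑ xs f ≡ ∑ xs g
∑-cong []       e = refl
∑-cong (x ∷ xs) e = cong₂ _+_ (e x) (∑-cong xs e)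

∑-cong-All : {P : A₁ → Set} {xs : List A₁} {f g : A₁ → ℕ} → All P xs → (∀ x → P x → f x ≡ g x) → ∑ xs f ≡ ∑ xs g
∑-cong-All []       e = refl
∑-cong-All (p ∷ ps) e = cong₂ _+_ (e _ p) (∑-cong-All ps e)

∑-mono : (xs : List A₁) {f g : A₁ → ℕ} → (∀ x → f x ≤ g x) → ∑ xs f ≤ ∑ xs g
∑-mono []       e = z≤n
∑-mono (x ∷ xs) e = +-mono-≤ (e x) (∑-mono xs e)

∑-mono-All : {P : A₁ → Set} {xs : List A₁} {f g : A₁ → ℕ} → All P xs → (∀ x → P x → f x ≤ g x) → ∑ xs f ≤ ∑ xs g
∑-mono-All []       le = z≤n
∑-mono-All (p ∷ ps) le = +-mono-≤ (le _ p) (∑-mono-All ps le)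

∑-++ : (xs ys : List A₁) (f : A₁ → ℕ) → ∑ (xs ++ ys) f ≡ ∑ xs f + ∑ ys f
∑-++ []       ys f = refl
∑-++ (x ∷ xs) ys f = trans (cong (f x +_) (∑-++ xs ys f)) (sym (+-assoc (f x) _ _))

∑-map : (h : A₁ → A₂) (xs : List A₁) (f : A₂ → ℕ) → ∑ (map h xs) f ≡ ∑ xs (f ∘ h)
∑-map h []       f = refl
∑-map h (x ∷ xs) f = cong (f (h x) +_) (∑-map h xs f)

∑-concatMap : (h : A₁ → List A₂) (xs : List A₁) (f : A₂ → ℕ) → ∑ (concatMap h xs) f ≡ ∑ xs (λ x → ∑ (h x) f)
∑-concatMap h []       f = refl
∑-concatMap h (x ∷ xs) f = trans (∑-++ (h x) (concatMap h xs) f) (cong (∑ (h x) f +_) (∑-concatMap h xs f))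

∑-const : (xs : List A₁) (c : ℕ) → ∑ xs (λ _ → c) ≡ length xs * c
∑-const []       c = refl
∑-const (x ∷ xs) c = cong (c +_) (∑-const xs c)

∑-zero : (xs : List A₁) → ∑ xs (λ _ → 0) ≡ 0
∑-zero xs = trans (∑-const xs 0) (*-zeroʳ (length xs))

∑-distrib-+ : (xs : List A₁) (f g : A₁ → ℕ) → ∑ xs (λ x → f x + g x) ≡ ∑ xs f + ∑ xs g
∑-distrib-+ []       f g = refl
∑-distrib-+ (x ∷ xs) f g = trans (cong (f x + g x +_) (∑-distrib-+ xs f g)) (interchange +-commutativeSemigroup (f x) (g x) _ _)

∑-*ˡ : (c : ℕ) (xs : List A₁) (f : A₁ → ℕ) → ∑ xs (λ x → c * f x) ≡ c * ∑ xs f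
∑-*ˡ c []       f = sym (*-zeroʳ c)
∑-*ˡ c (x ∷ xs) f = trans (cong (c * f x +_) (∑-*ˡ c xs f)) (sym (*-distribˡ-+ c (f x) _))

∑-*ʳ : (xs : List A₁) (f : A₁ → ℕ) (c : ℕ) → ∑ xs (λ x → f x * c) ≡ ∑ xs f * c
∑-*ʳ xs f c = trans (∑-cong xs (λ x → *-comm (f x) c)) (trans (∑-*ˡ c xs f) (*-comm c _))

∑-swap : (xs : List A₁) (ys : List A₂) (f : A₁ → A₂ → ℕ) →
  ∑ xs (λ x → ∑ ys (f x)) ≡ ∑ ys (λ y → ∑ xs (λ x → f x y))
∑-swap []       ys f = sym (∑-zero ys)
∑-swap (x ∷ xs) ys f = trans (cong (∑ ys (f x) +_) (∑-swap xs ys f)) (sym (∑-distrib-+ ys (f x) _))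

∑-≤-length : (xs : List A₁) (f : A₁ → ℕ) {c : ℕ} → (∀ x → f x ≤ c) → ∑ xs f ≤ length xs * c
∑-≤-length xs f le = ≤-trans (∑-mono xs le) (≤-reflexive (∑-const xs _))

𝟙 : {P : Set} → Dec P → ℕ
𝟙 (yes _) = 1
𝟙 (no _)  = 0

𝟙≤1 : {P : Set} (d : Dec P) → 𝟙 d ≤ 1
𝟙≤1 (yes _) = ≤-refl
𝟙≤1 (no _)  = z≤n

𝟙-yes : {P : Set} (d : Dec P) → P → 𝟙 d ≡ 1
𝟙-yes (yes _) p = refl
𝟙-yes (no ¬p) p = ⊥-elim (¬p p)

𝟙-no : {P : Set} (d : Dec P) → ¬ P → 𝟙 d ≡ 0
𝟙-no (yes p) ¬p = ⊥-elim (¬p p)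
𝟙-no (no _)  ¬p = refl

𝟙-mono : {P Q : Set} (d : Dec P) (e : Dec Q) → (P → Q) → 𝟙 d ≤ 𝟙 e
𝟙-mono (no _)  e f = z≤n
𝟙-mono (yes p) e f = ≤-reflexive (sym (𝟙-yes e (f p)))

𝟙-cong : {P Q : Set} (d : Dec P) (e : Dec Q) → (P → Q) → (Q → P) → 𝟙 d ≡ 𝟙 e
𝟙-cong d e f g = ≤-antisym (𝟙-mono d e f) (𝟙-mono e d g)

length-filter-∑ : {P : A₁ → Set} (P? : ∀ x → Dec (P x)) (xs : List A₁) →
  length (filter P? xs) ≡ ∑ xs (λ x → 𝟙 (P? x))
length-filter-∑ P? [] = refl
length-filter-∑ P? (x ∷ xs) with P? x
... | yes _ = cong suc (length-filter-∑ P? xs)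
... | no _  = length-filter-∑ P? xs

length-∑ : (xs : List A₁) → length xs ≡ ∑ xs (λ _ → 1)
length-∑ xs = sym (trans (∑-const xs 1) (*-identityʳ _))

∑-allVecs : (E : List A₁) (n : ℕ) (F : Vec A₁ (suc n) → ℕ) →
  ∑ (allVecs E (suc n)) F ≡ ∑ E (λ x → ∑ (allVecs E n) (λ v → F (x ∷ v)))
∑-allVecs E n F = trans (∑-concatMap _ E F) (∑-cong E (λ x → ∑-map (x ∷_) (allVecs E n) F))

length-allVecs : (E : List A₁) (n : ℕ) → length (allVecs E n) ≡ length E ^ n
length-allVecs E zero = refl
length-allVecs E (suc n) = begin
  length (allVecs E (suc n))                          ≡⟨ length-∑ (allVecs E (suc n)) ⟩
  ∑ (allVecs E (suc n)) (λ _ → 1)                      ≡⟨ ∑-allVecs E n (λ _ → 1) ⟩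
  ∑ E (λ _ → ∑ (allVecs E n) (λ _ → 1))                ≡⟨ ∑-const E _ ⟩
  length E * ∑ (allVecs E n) (λ _ → 1)                 ≡⟨ cong (length E *_) (sym (length-∑ (allVecs E n))) ⟩
  length E * length (allVecs E n)                      ≡⟨ cong (length E *_) (length-allVecs E n) ⟩
  length E * length E ^ n                              ∎
  where open ≡-Reasoning

infixr 5 _⊗_
_⊗_ : List A₁ → List A₂ → List (A₁ × A₂)
xs ⊗ ys = concatMap (λ x → map (x ,_) ys) xs

∑-⊗ : (xs : List A₁) (ys : List A₂) (F : A₁ × A₂ → ℕ) → ∑ (xs ⊗ ys) F ≡ ∑ xs (λ x → ∑ ys (λ y → F (x , y)))
∑-⊗ xs ys F = trans (∑-concatMap _ xs F) (∑-cong xs (λ x → ∑-map (x ,_) ys F))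

length-⊗ : (xs : List A₁) (ys : List A₂) → length (xs ⊗ ys) ≡ length xs * length ys
length-⊗ xs ys = trans (length-∑ (xs ⊗ ys)) (trans (∑-⊗ xs ys _) (trans (∑-const xs _) (cong (length xs *_) (sym (length-∑ ys)))))

∑-allVecs-map : (f : A₁ → A₂) (E : List A₁) (n : ℕ) (F : Vec A₂ n → ℕ) →
  ∑ (allVecs (map f E) n) F ≡ ∑ (allVecs E n) (F ∘ Vec.map f)
∑-allVecs-map f E zero    F = refl
∑-allVecs-map f E (suc n) F = begin
  ∑ (allVecs (map f E) (suc n)) F                              ≡⟨ ∑-allVecs (map f E) n F ⟩
  ∑ (map f E) (λ x → ∑ (allVecs (map f E) n) (λ v → F (x ∷ v)))  ≡⟨ ∑-map f E _ ⟩
  ∑ E (λ x → ∑ (allVecs (map f E) n) (λ v → F (f x ∷ v)))        ≡⟨ ∑-cong E (λ x → ∑-allVecs-map f E n _) ⟩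
  ∑ E (λ x → ∑ (allVecs E n) (λ v → F (f x ∷ Vec.map f v)))      ≡⟨ ∑-allVecs E n _ ⟨
  ∑ (allVecs E (suc n)) (F ∘ Vec.map f)                         ∎
  where open ≡-Reasoning

∑-allVecs-⊗ : (E : List A₁) (E′ : List A₂) (n : ℕ) (F : Vec (A₁ × A₂) n → ℕ) →
  ∑ (allVecs (E ⊗ E′) n) F ≡ ∑ (allVecs E n) (λ v → ∑ (allVecs E′ n) (λ w → F (Vec.zip v w)))
∑-allVecs-⊗ E E′ zero    F = sym (+-identityʳ _)
∑-allVecs-⊗ E E′ (suc n) F = begin
  ∑ (allVecs (E ⊗ E′) (suc n)) F
    ≡⟨ ∑-allVecs (E ⊗ E′) n F ⟩
  ∑ (E ⊗ E′) (λ p → ∑ (allVecs (E ⊗ E′) n) (λ v → F (p ∷ v)))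
    ≡⟨ ∑-⊗ E E′ _ ⟩
  ∑ E (λ x → ∑ E′ (λ y → ∑ (allVecs (E ⊗ E′) n) (λ v → F ((x , y) ∷ v))))
    ≡⟨ ∑-cong E (λ x → ∑-cong E′ (λ y → ∑-allVecs-⊗ E E′ n _)) ⟩
  ∑ E (λ x → ∑ E′ (λ y → ∑ (allVecs E n) (λ v → ∑ (allVecs E′ n) (λ w → F ((x , y) ∷ Vec.zip v w)))))
    ≡⟨ ∑-cong E (λ x → ∑-swap E′ (allVecs E n) _) ⟩
  ∑ E (λ x → ∑ (allVecs E n) (λ v → ∑ E′ (λ y → ∑ (allVecs E′ n) (λ w → F ((x , y) ∷ Vec.zip v w)))))
    ≡⟨ ∑-cong E (λ x → ∑-cong (allVecs E n) (λ v → ∑-allVecs E′ n _)) ⟨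
  ∑ E (λ x → ∑ (allVecs E n) (λ v → ∑ (allVecs E′ (suc n)) (λ w → F (Vec.zip (x ∷ v) w))))
    ≡⟨ ∑-allVecs E n _ ⟨
  ∑ (allVecs E (suc n)) (λ v → ∑ (allVecs E′ (suc n)) (λ w → F (Vec.zip v w)))
    ∎
  where open ≡-Reasoning

-- Lets the sum be sliced along the one coordinate whose unit vector lies outside the subspace at
-- hand.
∑-allVecs-insertAt : (E : List A₁) (n : ℕ) (i : Fin (suc n)) (F : Vec A₁ (suc n) → ℕ) →
  ∑ (allVecs E (suc n)) F ≡ ∑ E (λ x → ∑ (allVecs E n) (λ v → F (Vec.insertAt v i x)))
∑-allVecs-insertAt E n       zero    F = ∑-allVecs E n F
∑-allVecs-insertAt E (suc n) (suc i) F = begin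
  ∑ (allVecs E (suc (suc n))) F
    ≡⟨ ∑-allVecs E (suc n) F ⟩
  ∑ E (λ y → ∑ (allVecs E (suc n)) (λ v → F (y ∷ v)))
    ≡⟨ ∑-cong E (λ y → ∑-allVecs-insertAt E n i _) ⟩
  ∑ E (λ y → ∑ E (λ x → ∑ (allVecs E n) (λ v → F (y ∷ Vec.insertAt v i x))))
    ≡⟨ ∑-swap E E _ ⟩
  ∑ E (λ x → ∑ E (λ y → ∑ (allVecs E n) (λ v → F (y ∷ Vec.insertAt v i x))))
    ≡⟨ ∑-cong E (λ x → ∑-allVecs E n _) ⟨
  ∑ E (λ x → ∑ (allVecs E (suc n)) (λ v → F (Vec.insertAt v (suc i) x)))
    ∎
  where open ≡-Reasoning

-- Additive energy in ordered abelian groups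

2*m*n≤m²+n² : ∀ m n → 2 * (m * n) ≤ m * m + n * n
2*m*n≤m²+n² m n with ≤-total m n
... | inj₁ m≤n = subst (λ k → 2 * (m * k) ≤ m * m + k * k) (m+[n∸m]≡n m≤n) (lem m (n ∸ m))
  where
  lem : ∀ m d → 2 * (m * (m + d)) ≤ m * m + (m + d) * (m + d)
  lem m d = ≤-trans (m≤m+n _ (d * d)) (≤-reflexive (eq m d))
    where
    eq : ∀ m d → 2 * (m * (m + d)) + d * d ≡ m * m + (m + d) * (m + d)
    eq = solve-∀
... | inj₂ n≤m = subst (λ k → 2 * (k * n) ≤ k * k + n * n) (m+[n∸m]≡n n≤m) (lem n (m ∸ n))
  where
  lem : ∀ n d → 2 * ((n + d) * n) ≤ (n + d) * (n + d) + n * n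
  lem n d = ≤-trans (m≤m+n _ (d * d)) (≤-reflexive (eq n d))
    where
    eq : ∀ n d → 2 * ((n + d) * n) + d * d ≡ (n + d) * (n + d) + n * n
    eq = solve-∀

module Coincidences {H : Set} (_≟_ : DecidableEquality H) where

  mult : List H → H → ℕ
  mult xs h = ∑ xs (λ x → 𝟙 (h ≟ x))

  coinc : List H → List H → ℕ
  coinc xs ys = ∑ xs (λ x → ∑ ys (λ y → 𝟙 (x ≟ y)))

  coinc-comm : ∀ xs ys → coinc xs ys ≡ coinc ys xs
  coinc-comm xs ys = trans (∑-swap xs ys _) (∑-cong ys (λ y → ∑-cong xs (λ x → 𝟙-cong (x ≟ y) (y ≟ x) sym sym)))

  coinc-++ˡ : ∀ xs xs′ ys → coinc (xs ++ xs′) ys ≡ coinc xs ys + coinc xs′ ys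
  coinc-++ˡ xs xs′ ys = ∑-++ xs xs′ _

  coinc-++ʳ : ∀ xs ys ys′ → coinc xs (ys ++ ys′) ≡ coinc xs ys + coinc xs ys′
  coinc-++ʳ xs ys ys′ = trans (∑-cong xs (λ x → ∑-++ ys ys′ _)) (∑-distrib-+ xs _ _)

  nub : List H → List H
  nub [] = []
  nub (x ∷ xs) with mult (nub xs) x
  ... | zero  = x ∷ nub xs
  ... | suc _ = nub xs

  mult-nub≤1 : ∀ xs h → mult (nub xs) h ≤ 1
  mult-nub≤1 [] h = z≤n
  mult-nub≤1 (x ∷ xs) h with mult (nub xs) x in eq
  ... | suc _ = mult-nub≤1 xs h
  ... | zero with h ≟ x
  ...   | yes refl = ≤-reflexive (cong suc eq)
  ...   | no _     = mult-nub≤1 xs h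

  mult-nub-mono : ∀ x xs h → mult (nub xs) h ≤ mult (nub (x ∷ xs)) h
  mult-nub-mono x xs h with mult (nub xs) x
  ... | suc _ = ≤-refl
  ... | zero  = m≤n+m _ _

  mult-nub-head : ∀ x xs → 1 ≤ mult (nub (x ∷ xs)) x
  mult-nub-head x xs with mult (nub xs) x in eq
  ... | suc _ = subst (1 ≤_) (sym eq) (s≤s z≤n)
  ... | zero  = ≤-trans (≤-reflexive (sym (𝟙-yes (x ≟ x) refl))) (m≤m+n _ _)

  nub-covers : ∀ xs → All (λ x → mult (nub xs) x ≡ 1) xs
  nub-covers xs = All.map (λ {h} p → ≤-antisym (mult-nub≤1 xs h) p) (go xs)
    where
    go : ∀ xs → All (λ x → 1 ≤ mult (nub xs) x) xs
    go []       = []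
    go (x ∷ xs) = mult-nub-head x xs ∷ All.map (λ {h} p → ≤-trans p (mult-nub-mono x xs h)) (go xs)

  -- Turns a sum over a multiset into a sum over values with multiplicities. The list `us` must
  -- contain each value of `xs` exactly once, which is what `nub` provides.
  ∑-by-values : ∀ us xs (f : H → ℕ) → All (λ x → mult us x ≡ 1) xs →
    ∑ xs f ≡ ∑ us (λ u → ∑ xs (λ x → 𝟙 (x ≟ u)) * f u)
  ∑-by-values us xs f cov = begin
    ∑ xs f                                      ≡⟨ ∑-cong-All cov (λ x p → sym (at x p)) ⟩
    ∑ xs (λ x → ∑ us (λ u → 𝟙 (x ≟ u) * f u))     ≡⟨ ∑-swap xs us _ ⟩
    ∑ us (λ u → ∑ xs (λ x → 𝟙 (x ≟ u) * f u))     ≡⟨ ∑-cong us (λ u → ∑-*ʳ xs _ (f u)) ⟩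
    ∑ us (λ u → ∑ xs (λ x → 𝟙 (x ≟ u)) * f u)     ∎
    where
    open ≡-Reasoning
    transport : ∀ x u → 𝟙 (x ≟ u) * f u ≡ 𝟙 (x ≟ u) * f x
    transport x u with x ≟ u
    ... | yes refl = refl
    ... | no _     = refl
    at : ∀ x → mult us x ≡ 1 → ∑ us (λ u → 𝟙 (x ≟ u) * f u) ≡ f x
    at x p = trans (∑-cong us (transport x)) (trans (∑-*ʳ us _ (f x)) (trans (cong (_* f x) p) (*-identityˡ (f x))))

  -- For the multiplicity functions f and g of the two lists this is 2⟨f,g⟩ ≤ ⟨f,f⟩ + ⟨g,g⟩, summed
  -- over the distinct values of both lists together.
  2*coinc≤ : ∀ xs ys → 2 * coinc xs ys ≤ coinc xs xs + coinc ys ys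
  2*coinc≤ xs ys = begin
    2 * coinc xs ys                         ≡⟨ cong (2 *_) (by-values xs ys covˡ) ⟩
    2 * ∑ us (λ u → m xs u * m ys u)         ≡⟨ ∑-*ˡ 2 us _ ⟨
    ∑ us (λ u → 2 * (m xs u * m ys u))       ≤⟨ ∑-mono us (λ u → 2*m*n≤m²+n² (m xs u) (m ys u)) ⟩
    ∑ us (λ u → m xs u * m xs u + m ys u * m ys u) ≡⟨ ∑-distrib-+ us _ _ ⟩
    ∑ us (λ u → m xs u * m xs u) + ∑ us (λ u → m ys u * m ys u)
      ≡⟨ cong₂ _+_ (by-values xs xs covˡ) (by-values ys ys covʳ) ⟨
    coinc xs xs + coinc ys ys               ∎
    where
    open ≤-Reasoning
    us = nub (xs ++ ys)
    covˡ = ++⁻ˡ xs (nub-covers (xs ++ ys))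
    covʳ = ++⁻ʳ xs (nub-covers (xs ++ ys))
    m : List H → H → ℕ
    m xs u = ∑ xs (λ x → 𝟙 (x ≟ u))
    by-values : ∀ xs ys → All (λ x → mult us x ≡ 1) xs → coinc xs ys ≡ ∑ us (λ u → m xs u * m ys u)
    by-values xs ys cov = trans (∑-by-values us xs _ cov)
      (∑-cong us (λ u → cong (m xs u *_) (∑-cong ys (λ y → 𝟙-cong (u ≟ y) (y ≟ u) sym sym))))

-- Energy gain of a doubling in an ordered group

record OrderedAbelianGroup : Set₁ where
  infix  4 _≟_
  infixl 6 _⊕_ _⊝_
  infix  8 ⊖_
  field
    H              : Set
    _≟_            : DecidableEquality H
    _⊕_            : H → H → H
    𝟘              : H
    ⊖_             : H → H
    isAbelianGroup : IsAbelianGroup _≡_ _⊕_ 𝟘 ⊖_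
    Pos            : H → Set
    Pos?           : ∀ x → Dec (Pos x)
    Pos-⊕          : ∀ {x y} → Pos x → Pos y → Pos (x ⊕ y)
    ¬Pos-𝟘         : ¬ Pos 𝟘
    trichotomy     : ∀ x → Pos x ⊎ x ≡ 𝟘 ⊎ Pos (⊖ x)
  _⊝_ : H → H → H
  x ⊝ y = x ⊕ ⊖ y

module Energy (G : OrderedAbelianGroup) where
  open OrderedAbelianGroup G
  open Coincidences _≟_ public
  open IsAbelianGroup isAbelianGroup
    using (identityˡ; identityʳ; inverseˡ; inverseʳ) renaming (assoc to ⊕-assoc; comm to ⊕-comm)

  ⊝-⊕-cancel : ∀ x y → (x ⊝ y) ⊕ y ≡ x
  ⊝-⊕-cancel x y = trans (⊕-assoc x (⊖ y) y) (trans (cong (x ⊕_) (inverseˡ y)) (identityʳ x))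

  ⊕-⊝-cancel : ∀ x y → (x ⊕ y) ⊝ y ≡ x
  ⊕-⊝-cancel x y = trans (⊕-assoc x y (⊖ y)) (trans (cong (x ⊕_) (inverseʳ y)) (identityʳ x))

  ⊕-cancelʳ : ∀ {x y} z → x ⊕ z ≡ y ⊕ z → x ≡ y
  ⊕-cancelʳ {x} {y} z e = trans (sym (⊕-⊝-cancel x z)) (trans (cong (_⊝ z) e) (⊕-⊝-cancel y z))

  ⊖-involutive : ∀ x → ⊖ (⊖ x) ≡ x
  ⊖-involutive x = ⊕-cancelʳ (⊖ x) (trans (inverseˡ (⊖ x)) (sym (inverseʳ x)))

  ⊖-𝟘 : ⊖ 𝟘 ≡ 𝟘
  ⊖-𝟘 = trans (sym (identityʳ (⊖ 𝟘))) (inverseˡ 𝟘)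

  ⊖-⊝ : ∀ x y → ⊖ (x ⊝ y) ≡ y ⊝ x
  ⊖-⊝ x y = ⊕-cancelʳ (x ⊝ y) (trans (inverseˡ _) (sym (begin
    (y ⊝ x) ⊕ (x ⊝ y)     ≡⟨ ⊕-assoc (y ⊝ x) x (⊖ y) ⟨
    ((y ⊝ x) ⊕ x) ⊝ y     ≡⟨ cong (_⊝ y) (⊝-⊕-cancel y x) ⟩
    y ⊝ y                 ≡⟨ inverseʳ y ⟩
    𝟘                     ∎)))
    where open ≡-Reasoning

  ⊝-split : ∀ x y z → x ⊝ z ≡ (x ⊝ y) ⊕ (y ⊝ z)
  ⊝-split x y z = trans (cong (_⊝ z) (sym (⊝-⊕-cancel x y))) (⊕-assoc (x ⊝ y) y (⊖ z))

  translate : H → List H → List H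
  translate d = map (_⊕ d)

  coinc-map : ∀ (f : H → H) → (∀ {x y} → f x ≡ f y → x ≡ y) → ∀ xs ys → coinc (map f xs) (map f ys) ≡ coinc xs ys
  coinc-map f inj xs ys = trans (∑-map f xs _) (∑-cong xs (λ x → trans (∑-map f ys _) (∑-cong ys (λ y → 𝟙-cong (f x ≟ f y) (x ≟ y) inj (cong f)))))

  sumset : List H → List H
  sumset F = map (λ p → proj₁ p ⊕ proj₂ p) (F ⊗ F)

  ∑-sumset : ∀ F (f : H → ℕ) → ∑ (sumset F) f ≡ ∑ F (λ a → ∑ F (λ b → f (a ⊕ b)))
  ∑-sumset F f = trans (∑-map _ (F ⊗ F) f) (∑-⊗ F F _)

  -- Pairs with sum t are coincidences of F with its reflection t - F, which has the same
  -- self-coincidences as F. So a point probability of a sum of two independent copies is at most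
  -- the collision probability of one copy.
  ∑-sum≤coinc : ∀ F t → ∑ F (λ a → ∑ F (λ b → 𝟙 (a ⊕ b ≟ t))) ≤ coinc F F
  ∑-sum≤coinc F t = *-cancelˡ-≤ 2 (≤-trans (≤-reflexive (cong (2 *_) eq)) (≤-trans (2*coinc≤ F (map (t ⊝_) F))
    (≤-reflexive (trans (cong (coinc F F +_) (coinc-map (t ⊝_) inj F F)) (cong (coinc F F +_) (sym (+-identityʳ _)))))))
    where
    eq : ∑ F (λ a → ∑ F (λ b → 𝟙 (a ⊕ b ≟ t))) ≡ coinc F (map (t ⊝_) F)
    eq = ∑-cong F (λ a → trans (∑-cong F (λ b → 𝟙-cong (a ⊕ b ≟ t) (a ≟ t ⊝ b)
      (λ e → trans (sym (⊕-⊝-cancel a b)) (cong (_⊝ b) e)) (λ e → trans (cong (_⊕ b) e) (⊝-⊕-cancel t b)))) (sym (∑-map (t ⊝_) F _)))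
    inj : ∀ {x y} → t ⊝ x ≡ t ⊝ y → x ≡ y
    inj {x} {y} e = begin
      x              ≡⟨ ⊕-⊝-cancel x (t ⊝ x) ⟨
      x ⊕ (t ⊝ x) ⊝ (t ⊝ x) ≡⟨ cong₂ _⊝_ (trans (trans (⊕-comm x _) (⊝-⊕-cancel t x)) (sym (trans (⊕-comm y _) (⊝-⊕-cancel t y)))) e ⟩
      y ⊕ (t ⊝ y) ⊝ (t ⊝ y) ≡⟨ ⊕-⊝-cancel y (t ⊝ y) ⟩
      y              ∎
      where open ≡-Reasoning

  module _ (F : List H) where

    -- The autocorrelation of F: how often d occurs as a difference of two entries. Its maximum `Q`
    -- is attained at `𝟘`.
    R : H → ℕ
    R d = coinc F (translate d F)

    Q : ℕ
    Q = coinc F F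

    R-∑ : ∀ d → R d ≡ ∑ F (λ a → ∑ F (λ b → 𝟙 (a ≟ b ⊕ d)))
    R-∑ d = ∑-cong F (λ a → ∑-map (_⊕ d) F _)

    R-𝟘 : R 𝟘 ≡ Q
    R-𝟘 = trans (R-∑ 𝟘) (∑-cong F (λ a → ∑-cong F (λ b → 𝟙-cong (a ≟ b ⊕ 𝟘) (a ≟ b)
      (λ e → trans e (identityʳ b)) (λ e → trans e (sym (identityʳ b))))))

    R-⊖ : ∀ d → R (⊖ d) ≡ R d
    R-⊖ d = trans (R-∑ (⊖ d)) (trans (∑-swap F F _) (trans (∑-cong F (λ a → ∑-cong F (λ b →
      𝟙-cong (b ≟ a ⊝ d) (a ≟ b ⊕ d)
        (λ e → trans (sym (⊝-⊕-cancel a d)) (cong (_⊕ d) (sym e)))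
        (λ e → trans (sym (⊕-⊝-cancel b d)) (cong (_⊝ d) (sym e)))))) (sym (R-∑ d))))

    R≤Q : ∀ d → R d ≤ Q
    R≤Q d = *-cancelˡ-≤ 2 (≤-trans (2*coinc≤ F (translate d F))
      (≤-reflexive (trans (cong (Q +_) (coinc-map (_⊕ d) (⊕-cancelʳ d) F F)) (cong (Q +_) (sym (+-identityʳ Q))))))

    -- Expand Σₓ (f(x) + f(x-d-d′) - 2 f(x-d))² ≥ 0, where f is the multiplicity function of F.
    R-triangle : ∀ d d′ → 2 * R d + 2 * R d′ ≤ R (d ⊕ d′) + 3 * Q
    R-triangle d d′ = *-cancelˡ-≤ 2 (≤-trans (≤-reflexive lhs) (≤-trans (2*coinc≤ xs ys) (≤-reflexive rhs)))
      where
      F₁ = translate d F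
      F₂ = translate (d ⊕ d′) F
      xs = F ++ F₂
      ys = F₁ ++ F₁
      c₂₁ : coinc F₂ F₁ ≡ R d′
      c₂₁ = begin
        coinc F₂ F₁ ≡⟨ trans (∑-map _ F _) (∑-cong F (λ a → ∑-map _ F _)) ⟩
        ∑ F (λ a → ∑ F (λ b → 𝟙 (a ⊕ (d ⊕ d′) ≟ b ⊕ d))) ≡⟨ ∑-swap F F _ ⟩
        ∑ F (λ b → ∑ F (λ a → 𝟙 (a ⊕ (d ⊕ d′) ≟ b ⊕ d))) ≡⟨ ∑-cong F (λ b → ∑-cong F (λ a → 𝟙-cong (a ⊕ (d ⊕ d′) ≟ b ⊕ d) (b ≟ a ⊕ d′)
             (λ e → ⊕-cancelʳ d (trans (sym e) (shuffle a))) (λ e → trans (shuffle a) (cong (_⊕ d) (sym e))))) ⟩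
        ∑ F (λ b → ∑ F (λ a → 𝟙 (b ≟ a ⊕ d′))) ≡⟨ R-∑ d′ ⟨
        R d′ ∎
        where
        open ≡-Reasoning
        shuffle : ∀ a → a ⊕ (d ⊕ d′) ≡ a ⊕ d′ ⊕ d
        shuffle a = trans (cong (a ⊕_) (⊕-comm d d′)) (sym (⊕-assoc a d′ d))
      lhs : 2 * (2 * R d + 2 * R d′) ≡ 2 * coinc xs ys
      lhs = cong (2 *_) (sym (trans (coinc-++ʳ xs F₁ F₁) (trans
        (cong (λ k → k + k) (trans (coinc-++ˡ F F₂ F₁) (cong (R d +_) c₂₁))) (eq (R d) (R d′)))))
        where
        eq : ∀ x y → (x + y) + (x + y) ≡ 2 * x + 2 * y
        eq = solve-∀
      rhs : coinc xs xs + coinc ys ys ≡ 2 * (R (d ⊕ d′) + 3 * Q)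
      rhs = trans (cong₂ _+_
        (trans (coinc-++ˡ F F₂ xs) (cong₂ _+_ (coinc-++ʳ F F F₂) (coinc-++ʳ F₂ F F₂)))
        (trans (coinc-++ˡ F₁ F₁ ys) (cong₂ _+_ (coinc-++ʳ F₁ F₁ F₁) (coinc-++ʳ F₁ F₁ F₁))))
        (trans (cong₂ (λ p q → ((Q + R (d ⊕ d′)) + (p + q)) + ((c₁ + c₁) + (c₁ + c₁)))
            (coinc-comm F₂ F) (coinc-map (_⊕ (d ⊕ d′)) (⊕-cancelʳ _) F F))
          (trans (cong (λ c → ((Q + R (d ⊕ d′)) + (R (d ⊕ d′) + Q)) + ((c + c) + (c + c))) (coinc-map (_⊕ d) (⊕-cancelʳ d) F F))
            (eq Q (R (d ⊕ d′)))))
        where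
        c₁ = coinc F₁ F₁
        eq : ∀ q r → ((q + r) + (r + q)) + ((q + q) + (q + q)) ≡ 2 * (r + 3 * q)
        eq = solve-∀

    D : List H
    D = map (λ p → proj₁ p ⊝ proj₂ p) (F ⊗ F)

    ∑-D : ∀ f → ∑ D f ≡ ∑ F (λ a → ∑ F (λ b → f (a ⊝ b)))
    ∑-D f = trans (∑-map _ (F ⊗ F) f) (∑-⊗ F F _)

    length-D : length D ≡ length F * length F
    length-D = trans (length-map _ (F ⊗ F)) (length-⊗ F F)

    ∑-D-⊖ : ∀ f → ∑ D (f ∘ ⊖_) ≡ ∑ D f
    ∑-D-⊖ f = trans (∑-D _) (trans (∑-cong F (λ a → ∑-cong F (λ b → cong f (⊖-⊝ a b)))) (trans (∑-swap F F _) (sym (∑-D f))))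

    ∑-D-at : ∀ t → ∑ D (λ x → 𝟙 (x ≟ t)) ≡ R t
    ∑-D-at t = trans (∑-D _) (trans (∑-cong F (λ a → ∑-cong F (λ b → 𝟙-cong (a ⊝ b ≟ t) (a ≟ b ⊕ t)
      (λ e → trans (sym (⊝-⊕-cancel a b)) (trans (cong (_⊕ b) e) (⊕-comm t b)))
      (λ e → trans (cong (_⊝ b) (trans e (⊕-comm b t))) (⊕-⊝-cancel t b))))) (sym (R-∑ t)))

    -- Rewriting a + b = c + e as a - c = e - b shows that the energy of the sumset sums the
    -- autocorrelation over all differences, so it is close to its maximum only if most differences
    -- are near-periods.
    coinc-sumset : coinc (sumset F) (sumset F) ≡ ∑ D R
    coinc-sumset = begin
      coinc (sumset F) (sumset F)
        ≡⟨ ∑-sumset F _ ⟩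
      ∑ F (λ a → ∑ F (λ b → ∑ (sumset F) (λ y → 𝟙 (a ⊕ b ≟ y))))
        ≡⟨ ∑-cong F (λ a → ∑-cong F (λ b → ∑-sumset F _)) ⟩
      ∑ F (λ a → ∑ F (λ b → ∑ F (λ c → ∑ F (λ e → 𝟙 (a ⊕ b ≟ c ⊕ e)))))
        ≡⟨ ∑-cong F (λ a → ∑-swap F F _) ⟩
      ∑ F (λ a → ∑ F (λ c → ∑ F (λ b → ∑ F (λ e → 𝟙 (a ⊕ b ≟ c ⊕ e)))))
        ≡⟨ ∑-cong F (λ a → ∑-cong F (λ c → ∑-swap F F _)) ⟩
      ∑ F (λ a → ∑ F (λ c → ∑ F (λ e → ∑ F (λ b → 𝟙 (a ⊕ b ≟ c ⊕ e)))))
        ≡⟨ ∑-cong F (λ a → ∑-cong F (λ c → trans (R-∑ (a ⊝ c)) (∑-cong F (λ e → ∑-cong F (λ b → step a c e b))))) ⟨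
      ∑ F (λ a → ∑ F (λ c → R (a ⊝ c)))
        ≡⟨ ∑-D R ⟨
      ∑ D R ∎
      where
      open ≡-Reasoning
      eq : ∀ a b c → (b ⊕ (a ⊝ c)) ⊕ c ≡ a ⊕ b
      eq a b c = trans (⊕-assoc b (a ⊝ c) c) (trans (cong (b ⊕_) (⊝-⊕-cancel a c)) (⊕-comm b a))
      step : ∀ a c e b → 𝟙 (e ≟ b ⊕ (a ⊝ c)) ≡ 𝟙 (a ⊕ b ≟ c ⊕ e)
      step a c e b = 𝟙-cong (e ≟ b ⊕ (a ⊝ c)) (a ⊕ b ≟ c ⊕ e)
        (λ p → trans (sym (eq a b c)) (trans (cong (_⊕ c) (sym p)) (⊕-comm e c)))
        (λ p → ⊕-cancelʳ c (trans (⊕-comm e c) (trans (sym p) (sym (eq a b c)))))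

    -- Good differences are the near-periods of F. The fraction 19/20 is close enough to 1 that
    -- `R-triangle` gives R ≥ (4 · 19/20 - 3) Q = 4Q/5 at a sum of two good differences.
    Good : H → Set
    Good d = 19 * Q ≤ 20 * R d

    Good? : ∀ d → Dec (Good d)
    Good? d = 19 * Q ≤? 20 * R d

    Good-𝟘 : Good 𝟘
    Good-𝟘 = ≤-trans (*-monoˡ-≤ Q (n≤1+n 19)) (≤-reflexive (cong (20 *_) (sym R-𝟘)))

    Good-⊖ : ∀ d → Good d → Good (⊖ d)
    Good-⊖ d = subst (λ k → 19 * Q ≤ 20 * k) (sym (R-⊖ d))

    -- The search starts from `𝟘`, which is good, so the result is never negative and adding it
    -- keeps positive elements positive.
    greatest-good : ∀ xs → Σ H λ e → Good e × (e ≡ 𝟘 ⊎ Pos e) × All (λ x → Good x → ¬ Pos (x ⊝ e)) xs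
    greatest-good [] = 𝟘 , Good-𝟘 , inj₁ refl , []
    greatest-good (x ∷ xs) with greatest-good xs
    ... | e , ge , e≥0 , all with Good? x | Pos? (x ⊝ e)
    ...   | no ¬g | _     = e , ge , e≥0 , (λ g → ⊥-elim (¬g g)) ∷ all
    ...   | yes g | no ¬p = e , ge , e≥0 , (λ _ → ¬p) ∷ all
    ...   | yes g | yes p = x , g , inj₂ (pos e≥0) ,
      (λ _ q → ¬Pos-𝟘 (subst Pos (inverseʳ x) q)) ∷ All.map (λ {y} f gy q → f gy (subst Pos (sym (⊝-split y x e)) (Pos-⊕ q p))) all
      where
      pos : e ≡ 𝟘 ⊎ Pos e → Pos x
      pos (inj₁ refl) = subst Pos (trans (cong (x ⊕_) ⊖-𝟘) (identityʳ x)) p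
      pos (inj₂ pe)   = subst Pos (⊝-⊕-cancel x e) (Pos-⊕ p pe)

    g b pos zer : H → ℕ
    g x   = 𝟙 (Good? x)
    b x   = 𝟙 (¬? (Good? x))
    pos x = 𝟙 (Pos? x)
    zer x = 𝟙 (x ≟ 𝟘)

    g+b≡1 : ∀ x → g x + b x ≡ 1
    g+b≡1 x with Good? x
    ... | yes _ = refl
    ... | no _  = refl

    g-⊖ : ∀ x → g (⊖ x) ≡ g x
    g-⊖ x = 𝟙-cong (Good? (⊖ x)) (Good? x) (λ p → subst Good (⊖-involutive x) (Good-⊖ _ p)) (Good-⊖ x)

    signs : ∀ x → pos x + zer x + pos (⊖ x) ≡ 1
    signs x with trichotomy x
    ... | inj₁ p = cong₂ _+_ (cong₂ _+_ (𝟙-yes (Pos? x) p) (𝟙-no (x ≟ 𝟘) (λ { refl → ¬Pos-𝟘 p })))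
          (𝟙-no (Pos? (⊖ x)) (λ q → ¬Pos-𝟘 (subst Pos (inverseʳ x) (Pos-⊕ p q))))
    ... | inj₂ (inj₁ refl) = cong₂ _+_ (cong₂ _+_ (𝟙-no (Pos? 𝟘) ¬Pos-𝟘) (𝟙-yes (𝟘 ≟ 𝟘) refl))
          (𝟙-no (Pos? (⊖ 𝟘)) (λ q → ¬Pos-𝟘 (subst Pos ⊖-𝟘 q)))
    ... | inj₂ (inj₂ p) = cong₂ _+_ (cong₂ _+_ (𝟙-no (Pos? x) (λ q → ¬Pos-𝟘 (subst Pos (inverseʳ x) (Pos-⊕ q p))))
          (𝟙-no (x ≟ 𝟘) (λ { refl → ¬Pos-𝟘 (subst Pos ⊖-𝟘 p) }))) (𝟙-yes (Pos? (⊖ x)) p)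

    ∑-zer : ∑ D zer ≡ Q
    ∑-zer = trans (∑-D-at 𝟘) R-𝟘

    g⁺ b⁺ : ℕ
    g⁺ = ∑ D (λ x → g x * pos x)
    b⁺ = ∑ D (λ x → b x * pos x)

    length-D-split : length D ≡ 2 * (g⁺ + b⁺) + Q
    length-D-split = begin
      length D                                               ≡⟨ length-∑ D ⟩
      ∑ D (λ _ → 1)                                           ≡⟨ ∑-cong D (λ x → sym (signs x)) ⟩
      ∑ D (λ x → pos x + zer x + pos (⊖ x))                    ≡⟨ ∑-distrib-+ D _ _ ⟩
      ∑ D (λ x → pos x + zer x) + ∑ D (pos ∘ ⊖_)               ≡⟨ cong₂ _+_ (∑-distrib-+ D _ _) (∑-D-⊖ pos) ⟩
      ∑ D pos + ∑ D zer + ∑ D pos                             ≡⟨ cong₂ (λ p z → p + z + p) pos-split ∑-zer ⟩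
      g⁺ + b⁺ + Q + (g⁺ + b⁺)                                 ≡⟨ eq (g⁺ + b⁺) Q ⟩
      2 * (g⁺ + b⁺) + Q                                       ∎
      where
      open ≡-Reasoning
      eq : ∀ p q → p + q + p ≡ 2 * p + q
      eq = solve-∀
      pos-split : ∑ D pos ≡ g⁺ + b⁺
      pos-split = trans (∑-cong D (λ x → trans (sym (*-identityˡ (pos x))) (trans (cong (_* pos x) (sym (g+b≡1 x))) (*-distribʳ-+ (pos x) (g x) (b x)))))
        (∑-distrib-+ D _ _)

    ∑-good : ∑ D g ≡ 2 * g⁺ + Q
    ∑-good = begin
      ∑ D g ≡⟨ ∑-cong D split ⟩
      ∑ D (λ x → g x * pos x + zer x + g (⊖ x) * pos (⊖ x)) ≡⟨ ∑-distrib-+ D _ _ ⟩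
      ∑ D (λ x → g x * pos x + zer x) + ∑ D (λ x → g (⊖ x) * pos (⊖ x)) ≡⟨ cong₂ _+_ (∑-distrib-+ D _ _) (∑-D-⊖ (λ x → g x * pos x)) ⟩
      g⁺ + ∑ D zer + g⁺ ≡⟨ cong (λ z → g⁺ + z + g⁺) ∑-zer ⟩
      g⁺ + Q + g⁺ ≡⟨ eq g⁺ Q ⟩
      2 * g⁺ + Q ∎
      where
      open ≡-Reasoning
      eq : ∀ p q → p + q + p ≡ 2 * p + q
      eq = solve-∀
      g-zer : ∀ x → g x * zer x ≡ zer x
      g-zer x with x ≟ 𝟘
      ... | no _     = *-zeroʳ (g x)
      ... | yes refl = trans (*-identityʳ (g 𝟘)) (𝟙-yes (Good? 𝟘) Good-𝟘)
      dist : ∀ a p z q → a * (p + z + q) ≡ a * p + a * z + a * q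
      dist = solve-∀
      split : ∀ x → g x ≡ g x * pos x + zer x + g (⊖ x) * pos (⊖ x)
      split x = trans (sym (*-identityʳ (g x))) (trans (cong (g x *_) (sym (signs x))) (trans (dist (g x) (pos x) (zer x) (pos (⊖ x)))
        (cong₂ (λ z k → g x * pos x + z + k * pos (⊖ x)) (g-zer x) (sym (g-⊖ x)))))

    -- Adding the greatest good difference e maps good positive differences to bad positive ones,
    -- and each value in the image is still attained at least 4Q/5 times.
    4g⁺≤5b⁺ : 0 < Q → 4 * g⁺ ≤ 5 * b⁺
    4g⁺≤5b⁺ 0<Q with greatest-good D
    ... | e , ge , e≥0 , max = cancel Q 0<Q (≤-trans (≤-reflexive (eq₁ Q g⁺)) (≤-trans lower (≤-trans (*-monoʳ-≤ 5 upper) (≤-reflexive (eq₂ Q b⁺)))))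
      where
      eq₁ : ∀ q x → q * (4 * x) ≡ 4 * q * x
      eq₁ = solve-∀
      eq₂ : ∀ q x → 5 * (q * x) ≡ q * (5 * x)
      eq₂ = solve-∀
      cancel : ∀ q → 0 < q → ∀ {x y} → q * x ≤ q * y → x ≤ y
      cancel (suc q) _ = *-cancelˡ-≤ (suc q)
      M = ∑ D (λ x → g x * pos x * R (x ⊕ e))
      many : ∀ x → Good x → 4 * Q ≤ 5 * R (x ⊕ e)
      many x gx = *-cancelˡ-≤ 4 (+-cancelʳ-≤ (60 * Q) _ _ (begin
        4 * (4 * Q) + 60 * Q ≡⟨ e₁ Q ⟩
        2 * (19 * Q) + 2 * (19 * Q) ≤⟨ +-mono-≤ (*-monoʳ-≤ 2 gx) (*-monoʳ-≤ 2 ge) ⟩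
        2 * (20 * R x) + 2 * (20 * R e) ≡⟨ e₂ (R x) (R e) ⟩
        20 * (2 * R x + 2 * R e) ≤⟨ *-monoʳ-≤ 20 (R-triangle x e) ⟩
        20 * (R (x ⊕ e) + 3 * Q) ≡⟨ e₃ (R (x ⊕ e)) Q ⟩
        4 * (5 * R (x ⊕ e)) + 60 * Q ∎))
        where
        open ≤-Reasoning
        e₁ : ∀ q → 4 * (4 * q) + 60 * q ≡ 2 * (19 * q) + 2 * (19 * q)
        e₁ = solve-∀
        e₂ : ∀ x y → 2 * (20 * x) + 2 * (20 * y) ≡ 20 * (2 * x + 2 * y)
        e₂ = solve-∀
        e₃ : ∀ r q → 20 * (r + 3 * q) ≡ 4 * (5 * r) + 60 * q
        e₃ = solve-∀
      lower : 4 * Q * g⁺ ≤ 5 * M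
      lower = ≤-trans (≤-reflexive (sym (∑-*ˡ (4 * Q) D _))) (≤-trans (∑-mono D pointwise) (≤-reflexive (∑-*ˡ 5 D _)))
        where
        comm₃ : ∀ a p r → a * p * (5 * r) ≡ 5 * (a * p * r)
        comm₃ = solve-∀
        pointwise : ∀ x → 4 * Q * (g x * pos x) ≤ 5 * (g x * pos x * R (x ⊕ e))
        pointwise x with Good? x
        ... | no _   = ≤-reflexive (*-zeroʳ (4 * Q))
        ... | yes gx = ≤-trans (≤-reflexive (*-comm (4 * Q) _)) (≤-trans (*-monoʳ-≤ (1 * pos x) (many x gx)) (≤-reflexive (comm₃ 1 (pos x) (R (x ⊕ e)))))
      Pos-⊕e : ∀ {x} → Pos x → Pos (x ⊕ e)
      Pos-⊕e {x} p = go e≥0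
        where
        go : e ≡ 𝟘 ⊎ Pos e → Pos (x ⊕ e)
        go (inj₁ e≡𝟘) = subst Pos (sym (trans (cong (x ⊕_) e≡𝟘) (identityʳ x))) p
        go (inj₂ pe)  = Pos-⊕ p pe
      shifted : ∀ x y → (Good y → ¬ Pos (y ⊝ e)) → g x * pos x * 𝟙 (y ≟ x ⊕ e) ≤ b y * pos y * 𝟙 (x ≟ y ⊝ e)
      shifted x y my with y ≟ x ⊕ e | Pos? x
      ... | no _     | _     = ≤-trans (≤-reflexive (*-zeroʳ (g x * _))) z≤n
      ... | yes refl | no _  = ≤-trans (≤-reflexive (cong (_* 1) (*-zeroʳ (g x)))) z≤n
      ... | yes refl | yes p = ≤-trans (*-mono-≤ (*-mono-≤ (𝟙≤1 (Good? x)) (≤-refl {1})) (≤-refl {1}))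
        (≤-reflexive (sym (cong₂ _*_ (cong₂ _*_ (𝟙-yes (¬? (Good? (x ⊕ e))) (λ gy → my gy (subst Pos (sym (⊕-⊝-cancel x e)) p)))
            (𝟙-yes (Pos? (x ⊕ e)) (Pos-⊕e p)))
          (𝟙-yes (x ≟ x ⊕ e ⊝ e) (sym (⊕-⊝-cancel x e))))))
      upper : M ≤ Q * b⁺
      upper = ≤-trans (≤-reflexive (trans (∑-cong D (λ x → trans (cong (g x * pos x *_) (sym (∑-D-at (x ⊕ e)))) (sym (∑-*ˡ (g x * pos x) D _)))) (∑-swap D D _)))
        (≤-trans (∑-mono-All max (λ y my → ∑-mono D (λ x → shifted x y my)))
        (≤-trans (≤-reflexive (∑-cong D (λ y → trans (∑-*ˡ (b y * pos y) D _) (cong (b y * pos y *_) (∑-D-at (y ⊝ e))))))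
        (≤-trans (∑-mono D (λ y → *-monoʳ-≤ (b y * pos y) (R≤Q (y ⊝ e)))) (≤-reflexive (trans (∑-*ʳ D _ Q) (*-comm b⁺ Q))))))

    energy-≤ : coinc (sumset F) (sumset F) ≤ length F * length F * Q
    energy-≤ = ≤-trans (≤-reflexive coinc-sumset) (≤-trans (∑-≤-length D R R≤Q) (≤-reflexive (cong (_* Q) length-D)))

    -- Zero differences make up at most half of all differences, and by `4g⁺≤5b⁺` at most 5/9 of the
    -- nonzero ones are good, so at most 1/2 + 5/18 = 7/9 of all are good. The others have R below
    -- 19Q/20, hence the average of R is at most (19 + 7/9)/20 = 89/90 of Q.
    energy-gain : 2 * Q ≤ length F * length F → 90 * coinc (sumset F) (sumset F) ≤ 89 * (length F * length F * Q)
    energy-gain 2Q≤ with Q in eqQ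
    ... | zero = subst (λ k → 90 * k ≤ 89 * (length F * length F * 0)) (sym (n≤0⇒n≡0
                   (≤-trans (subst (λ q → coinc (sumset F) (sumset F) ≤ length F * length F * q) eqQ energy-≤) (≤-reflexive (*-zeroʳ (length F * length F)))))) z≤n
    ... | suc q = subst (λ k → 90 * coinc (sumset F) (sumset F) ≤ 89 * (length F * length F * k)) eqQ
                   (subst₂ (λ E L → 90 * E ≤ 89 * (L * Q)) (sym coinc-sumset) length-D
                    (*-cancelˡ-≤ 2 (main (subst₂ (λ k L → 2 * k ≤ L) (sym eqQ) (sym length-D) 2Q≤))))
      where
      open ≤-Reasoning
      pointwise : ∀ x → 20 * R x ≤ 19 * Q + Q * g x
      pointwise x with Good? x
      ... | yes _ = ≤-trans (*-monoʳ-≤ 20 (R≤Q x)) (≤-reflexive (e₀ Q))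
        where
        e₀ : ∀ q → 20 * q ≡ 19 * q + q * 1
        e₀ = solve-∀
      ... | no ¬g = ≤-trans (<⇒≤ (≰⇒> ¬g)) (m≤m+n (19 * Q) _)
      20E≤ : 20 * ∑ D R ≤ 19 * (length D * Q) + Q * ∑ D g
      20E≤ = ≤-trans (≤-reflexive (sym (∑-*ˡ 20 D R))) (≤-trans (∑-mono D pointwise) (≤-reflexive
        (trans (∑-distrib-+ D _ _) (cong₂ _+_ (trans (∑-const D (19 * Q)) (e₀ (length D) Q)) (∑-*ˡ Q D g)))))
        where
        e₀ : ∀ l q → l * (19 * q) ≡ 19 * (l * q)
        e₀ = solve-∀
      9g≤7L : 2 * Q ≤ length D → 9 * ∑ D g ≤ 7 * length D
      9g≤7L h = subst₂ (λ G L → 9 * G ≤ 7 * L) (sym ∑-good) (sym length-D-split)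
        (lem g⁺ b⁺ Q (4g⁺≤5b⁺ (subst (0 <_) (sym eqQ) (s≤s z≤n))) (subst (2 * Q ≤_) length-D-split h))
        where
        lem : ∀ G B q → 4 * G ≤ 5 * B → 2 * q ≤ 2 * (G + B) + q → 9 * (2 * G + q) ≤ 7 * (2 * (G + B) + q)
        lem G B q h₁ h₂ = begin
          9 * (2 * G + q)                          ≡⟨ e₁ G q ⟩
          2 * (4 * G) + 10 * G + 7 * q + 2 * q      ≤⟨ +-monoʳ-≤ (2 * (4 * G) + 10 * G + 7 * q) h₃ ⟩
          2 * (4 * G) + 10 * G + 7 * q + 4 * (G + B) ≤⟨ +-monoˡ-≤ (4 * (G + B)) (+-monoˡ-≤ (7 * q) (+-monoˡ-≤ (10 * G) (*-monoʳ-≤ 2 h₁))) ⟩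
          2 * (5 * B) + 10 * G + 7 * q + 4 * (G + B) ≡⟨ e₂ G B q ⟩
          7 * (2 * (G + B) + q)                    ∎
          where
          h₃ : 2 * q ≤ 4 * (G + B)
          h₃ = ≤-trans (*-monoʳ-≤ 2 (+-cancelʳ-≤ q q _ (≤-trans (≤-reflexive (cong (q +_) (sym (+-identityʳ q)))) h₂))) (≤-reflexive (e₃ (G + B)))
            where
            e₃ : ∀ x → 2 * (2 * x) ≡ 4 * x
            e₃ = solve-∀
          e₁ : ∀ G q → 9 * (2 * G + q) ≡ 2 * (4 * G) + 10 * G + 7 * q + 2 * q
          e₁ = solve-∀
          e₂ : ∀ G B q → 2 * (5 * B) + 10 * G + 7 * q + 4 * (G + B) ≡ 7 * (2 * (G + B) + q)
          e₂ = solve-∀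
      main : 2 * Q ≤ length D → 2 * (90 * ∑ D R) ≤ 2 * (89 * (length D * Q))
      main h = begin
        2 * (90 * ∑ D R)                             ≡⟨ e₁ (∑ D R) ⟩
        9 * (20 * ∑ D R)                             ≤⟨ *-monoʳ-≤ 9 20E≤ ⟩
        9 * (19 * (length D * Q) + Q * ∑ D g)        ≡⟨ e₂ (length D) Q (∑ D g) ⟩
        171 * (length D * Q) + Q * (9 * ∑ D g)       ≤⟨ +-monoʳ-≤ _ (*-monoʳ-≤ Q (9g≤7L h)) ⟩
        171 * (length D * Q) + Q * (7 * length D)    ≡⟨ e₃ (length D) Q ⟩
        2 * (89 * (length D * Q))                    ∎
        where
        e₁ : ∀ x → 2 * (90 * x) ≡ 9 * (20 * x)
        e₁ = solve-∀
        e₂ : ∀ l q g → 9 * (19 * (l * q) + q * g) ≡ 171 * (l * q) + q * (9 * g)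
        e₂ = solve-∀
        e₃ : ∀ l q → 171 * (l * q) + q * (7 * l) ≡ 2 * (89 * (l * q))
        e₃ = solve-∀

-- Rational subspaces

infix 4 _≟ᵥ_
_≟ᵥ_ : DecidableEquality (Vec ℤ n)
_≟ᵥ_ = ≡-dec ℤ._≟_

0ᵥ : Vec ℤ n
0ᵥ = replicate _ 0ℤ

infixl 6 _+ᵥ_
_+ᵥ_ : Vec ℤ n → Vec ℤ n → Vec ℤ n
_+ᵥ_ = zipWith ℤ._+_

negᵥ : Vec ℤ n → Vec ℤ n
negᵥ = Vec.map (ℤ.-_)

lin : ℤ → Vec ℤ n → ℤ → Vec ℤ n → Vec ℤ n
lin a x b y = zipWith (λ p q → a ℤ.* p ℤ.+ b ℤ.* q) x y

LexPos : Vec ℤ n → Set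
LexPos []       = ⊥
LexPos (x ∷ xs) = (0ℤ ℤ.< x) ⊎ (x ≡ 0ℤ × LexPos xs)

LexPos? : (x : Vec ℤ n) → Dec (LexPos x)
LexPos? []       = no (λ ())
LexPos? (x ∷ xs) = (0ℤ ℤ.<? x) ⊎-dec ((x ℤ.≟ 0ℤ) ×-dec LexPos? xs)

LexPos-+ : {x y : Vec ℤ n} → LexPos x → LexPos y → LexPos (x +ᵥ y)
LexPos-+ {x = _ ∷ _} {y = _ ∷ _} (inj₁ p)          (inj₁ q)          = inj₁ (ℤₚ.+-mono-< p q)
LexPos-+ {x = _ ∷ _} {y = _ ∷ _} (inj₁ p)          (inj₂ (refl , q)) = inj₁ (ℤₚ.+-mono-<-≤ p ℤₚ.≤-refl)
LexPos-+ {x = _ ∷ _} {y = _ ∷ _} (inj₂ (refl , p)) (inj₁ q)          = inj₁ (ℤₚ.+-mono-≤-< (ℤₚ.≤-refl {0ℤ}) q)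
LexPos-+ {x = _ ∷ _} {y = _ ∷ _} (inj₂ (refl , p)) (inj₂ (refl , q)) = inj₂ (refl , LexPos-+ p q)

¬LexPos-0 : ∀ n → ¬ LexPos (0ᵥ {n})
¬LexPos-0 (suc n) (inj₁ (ℤ.+<+ ()))
¬LexPos-0 (suc n) (inj₂ (_ , p)) = ¬LexPos-0 n p

lex-trichotomy : (x : Vec ℤ n) → LexPos x ⊎ x ≡ 0ᵥ ⊎ LexPos (negᵥ x)
lex-trichotomy [] = inj₂ (inj₁ refl)
lex-trichotomy (x ∷ xs) with ℤₚ.<-cmp 0ℤ x
... | tri< p _ _ = inj₁ (inj₁ p)
... | tri> _ _ p = inj₂ (inj₂ (inj₁ (ℤₚ.neg-mono-< p)))
... | tri≈ _ refl _ with lex-trichotomy xs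
...   | inj₁ p        = inj₁ (inj₂ (refl , p))
...   | inj₂ (inj₁ e) = inj₂ (inj₁ (cong (0ℤ ∷_) e))
...   | inj₂ (inj₂ p) = inj₂ (inj₂ (inj₂ (refl , p)))

lexGroup : ℕ → OrderedAbelianGroup
lexGroup n = record
  { H = Vec ℤ n ; _≟_ = _≟ᵥ_ ; _⊕_ = _+ᵥ_ ; 𝟘 = 0ᵥ ; ⊖_ = negᵥ
  ; isAbelianGroup = record
    { isGroup = record
      { isMonoid = record
        { isSemigroup = record
          { isMagma = record { isEquivalence = isEquivalence ; ∙-cong = cong₂ _+ᵥ_ }
          ; assoc = zipWith-assoc ℤₚ.+-assoc }
        ; identity = zipWith-identityˡ ℤₚ.+-identityˡ , zipWith-identityʳ ℤₚ.+-identityʳ }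
      ; inverse = zipWith-inverseˡ ℤₚ.+-inverseˡ , zipWith-inverseʳ ℤₚ.+-inverseʳ
      ; ⁻¹-cong = cong negᵥ }
    ; comm = zipWith-comm ℤₚ.+-comm }
  ; Pos = LexPos ; Pos? = LexPos? ; Pos-⊕ = LexPos-+ ; ¬Pos-𝟘 = ¬LexPos-0 n ; trichotomy = lex-trichotomy }

lin-lin : ∀ c a b (x y u : Vec ℤ n) x₀ y₀ →
  lin c (lin a x b y) (ℤ.- (a ℤ.* x₀ ℤ.+ b ℤ.* y₀)) u ≡ lin a (lin c x (ℤ.- x₀) u) b (lin c y (ℤ.- y₀) u)
lin-lin c a b [] [] [] x₀ y₀ = refl
lin-lin c a b (x ∷ xs) (y ∷ ys) (u ∷ us) x₀ y₀ = cong₂ _∷_ (eq c a b x y u x₀ y₀) (lin-lin c a b xs ys us x₀ y₀)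
  where
  eq : ∀ c a b x y u x₀ y₀ → c ℤ.* (a ℤ.* x ℤ.+ b ℤ.* y) ℤ.+ (ℤ.- (a ℤ.* x₀ ℤ.+ b ℤ.* y₀)) ℤ.* u
    ≡ a ℤ.* (c ℤ.* x ℤ.+ (ℤ.- x₀) ℤ.* u) ℤ.+ b ℤ.* (c ℤ.* y ℤ.+ (ℤ.- y₀) ℤ.* u)
  eq = ℤ-Solver.solve-∀

lin-0ᵥ : ∀ n a b → lin a (0ᵥ {n}) b 0ᵥ ≡ 0ᵥ
lin-0ᵥ zero    a b = refl
lin-0ᵥ (suc n) a b = cong₂ _∷_ (cong₂ ℤ._+_ (ℤₚ.*-zeroʳ a) (ℤₚ.*-zeroʳ b)) (lin-0ᵥ n a b)

lin≡0⇒≡0 : ∀ {a} → a ≢ 0ℤ → (x y : Vec ℤ n) → lin a x 0ℤ y ≡ 0ᵥ → x ≡ 0ᵥ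
lin≡0⇒≡0 nz [] [] e = refl
lin≡0⇒≡0 {a = a} nz (x ∷ xs) (y ∷ ys) e with ∷-injective e
... | e₀ , es = cong₂ _∷_ (head (ℤₚ.i*j≡0⇒i≡0∨j≡0 a (trans (eq a x y) e₀))) (lin≡0⇒≡0 nz xs ys es)
  where
  eq : ∀ a x y → a ℤ.* x ≡ a ℤ.* x ℤ.+ 0ℤ ℤ.* y
  eq = ℤ-Solver.solve-∀
  head : a ≡ 0ℤ ⊎ x ≡ 0ℤ → x ≡ 0ℤ
  head (inj₁ a≡0) = ⊥-elim (nz a≡0)
  head (inj₂ x≡0) = x≡0

-- A rational subspace of ℚⁿ, by an echelon basis: either every member has first coordinate 0,
-- or (c , u) is a member with pivot c ≠ 0; the argument W is the slice of members with first coordinate 0.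
data Subspace : ℕ → Set where
  nil  : Subspace 0
  skip : Subspace n → Subspace (suc n)
  piv  : (c : ℤ) → c ≢ 0ℤ → Vec ℤ n → Subspace n → Subspace (suc n)

dim codim : Subspace n → ℕ
dim nil           = 0
dim (skip W)      = dim W
dim (piv _ _ _ W) = suc (dim W)
codim nil           = 0
codim (skip W)      = suc (codim W)
codim (piv _ _ _ W) = codim W

dim+codim : (W : Subspace n) → dim W + codim W ≡ n
dim+codim nil           = refl
dim+codim (skip W)      = trans (+-suc (dim W) (codim W)) (cong suc (dim+codim W))
dim+codim (piv _ _ _ W) = cong suc (dim+codim W)

-- Reduction modulo W to the coordinates without pivot. A pivot is cleared by cross-multiplication
-- instead of division, so the map is linear over ℤ and its kernel consists of the integer points of
-- the rational subspace. Its values thus model ℤⁿ/W inside a lexicographically ordered group.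
residue : (W : Subspace n) → Vec ℤ n → Vec ℤ (codim W)
residue nil           []       = []
residue (skip W)      (x ∷ xs) = x ∷ residue W xs
residue (piv c _ u W) (x ∷ xs) = residue W (lin c xs (ℤ.- x) u)

residue-lin : (W : Subspace n) → ∀ a x b y → residue W (lin a x b y) ≡ lin a (residue W x) b (residue W y)
residue-lin nil           a []       b []       = refl
residue-lin (skip W)      a (x ∷ xs) b (y ∷ ys) = cong (_ ∷_) (residue-lin W a xs b ys)
residue-lin (piv c _ u W) a (x ∷ xs) b (y ∷ ys) =
  trans (cong (residue W) (lin-lin c a b xs ys u x y)) (residue-lin W a _ b _)

infix 4 _∈_ _∈?_ _⊆_
_∈_ : Vec ℤ n → Subspace n → Set
x ∈ W = residue W x ≡ 0ᵥ

_∈?_ : (x : Vec ℤ n) (W : Subspace n) → Dec (x ∈ W)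
x ∈? W = residue W x ≟ᵥ 0ᵥ

_⊆_ : Subspace n → Subspace n → Set
W ⊆ U = ∀ x → x ∈ W → x ∈ U

∈-lin : (W : Subspace n) → ∀ a {x} b {y} → x ∈ W → y ∈ W → lin a x b y ∈ W
∈-lin W a b p q = trans (residue-lin W a _ b _) (trans (cong₂ (λ s t → lin a s b t) p q) (lin-0ᵥ _ a b))

-- Undoes the scalars that cross-multiplication introduces. The vector y only fills the second slot
-- of `lin`, which in this way also serves as scalar multiplication.
∈-saturated : (W : Subspace n) → ∀ {a} → a ≢ 0ℤ → ∀ x y → lin a x 0ℤ y ∈ W → x ∈ W
∈-saturated W {a} nz x y p = lin≡0⇒≡0 nz (residue W x) (residue W y) (trans (sym (residue-lin W a x 0ℤ y)) p)

lin-identityˡ : (x y : Vec ℤ n) → lin 1ℤ x 0ℤ y ≡ x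
lin-identityˡ []       []       = refl
lin-identityˡ (x ∷ xs) (y ∷ ys) = cong₂ _∷_ (eq x y) (lin-identityˡ xs ys)
  where
  eq : ∀ x y → 1ℤ ℤ.* x ℤ.+ 0ℤ ℤ.* y ≡ x
  eq = ℤ-Solver.solve-∀

lin-0-0 : (x y : Vec ℤ n) → lin 0ℤ x 0ℤ y ≡ 0ᵥ
lin-0-0 []       []       = refl
lin-0-0 (x ∷ xs) (y ∷ ys) = cong₂ _∷_ refl (lin-0-0 xs ys)

0ᵥ-∈ : (W : Subspace n) → 0ᵥ ∈ W
0ᵥ-∈ W = trans (cong (residue W) (sym (lin-0-0 0ᵥ 0ᵥ))) (trans (residue-lin W 0ℤ 0ᵥ 0ℤ 0ᵥ) (lin-0-0 _ _))

insert : Subspace n → Vec ℤ n → Subspace n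
insert nil            []       = nil
insert (skip W)       (x ∷ xs) with x ℤ.≟ 0ℤ
... | yes _  = skip (insert W xs)
... | no x≢0 = piv x x≢0 xs W
insert (piv c c≢0 u W) (x ∷ xs) = piv c c≢0 u (insert W (lin c xs (ℤ.- x) u))

-- An equality of echelon bases and not just of the spaces, so that expressions in `span` can be
-- rewritten along it.
insert-∈ : (W : Subspace n) (x : Vec ℤ n) → x ∈ W → insert W x ≡ W
insert-∈ nil            []       p = refl
insert-∈ (skip W)       (x ∷ xs) p with x ℤ.≟ 0ℤ
... | yes _  = cong skip (insert-∈ W xs (proj₂ (∷-injective p)))
... | no x≢0 = ⊥-elim (x≢0 (proj₁ (∷-injective p)))
insert-∈ (piv c c≢0 u W) (x ∷ xs) p = cong (piv c c≢0 u) (insert-∈ W _ p)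

dim-insert-∉ : (W : Subspace n) (x : Vec ℤ n) → ¬ x ∈ W → dim (insert W x) ≡ suc (dim W)
dim-insert-∉ nil            []       ∉ = ⊥-elim (∉ refl)
dim-insert-∉ (skip W)       (x ∷ xs) ∉ with x ℤ.≟ 0ℤ
... | yes refl = dim-insert-∉ W xs (λ p → ∉ (cong (0ℤ ∷_) p))
... | no x≢0   = refl
dim-insert-∉ (piv c c≢0 u W) (x ∷ xs) ∉ = cong suc (dim-insert-∉ W _ ∉)

dim-insert-≤ : (W : Subspace n) (x : Vec ℤ n) → dim (insert W x) ≤ suc (dim W)
dim-insert-≤ W x with x ∈? W
... | yes p = ≤-trans (≤-reflexive (cong dim (insert-∈ W x p))) (n≤1+n _)
... | no ∉  = ≤-reflexive (dim-insert-∉ W x ∉)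

lin-self : ∀ a (x : Vec ℤ n) → lin a x (ℤ.- a) x ≡ 0ᵥ
lin-self a []       = refl
lin-self a (x ∷ xs) = cong₂ _∷_ (eq a x) (lin-self a xs)
  where
  eq : ∀ a x → a ℤ.* x ℤ.+ (ℤ.- a) ℤ.* x ≡ 0ℤ
  eq = ℤ-Solver.solve-∀

pivot-∈ : ∀ c c≢0 (u : Vec ℤ n) W → (c ∷ u) ∈ piv c c≢0 u W
pivot-∈ c c≢0 u W = trans (cong (residue W) (lin-self c u)) (0ᵥ-∈ W)

slice-∈ : ∀ c c≢0 (u : Vec ℤ n) W {x} → x ∈ W → (0ℤ ∷ x) ∈ piv c c≢0 u W
slice-∈ c c≢0 u W {x} p = trans (residue-lin W c x 0ℤ u)
  (trans (cong (λ k → lin c k 0ℤ (residue W u)) p) (zeros c (residue W u)))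
  where
  zeros : ∀ {k} c (y : Vec ℤ k) → lin c 0ᵥ 0ℤ y ≡ 0ᵥ
  zeros c []       = refl
  zeros c (y ∷ ys) = cong₂ _∷_ (eq c y) (zeros c ys)
    where
    eq : ∀ c y → c ℤ.* 0ℤ ℤ.+ 0ℤ ℤ.* y ≡ 0ℤ
    eq = ℤ-Solver.solve-∀

∈-slice : ∀ c c≢0 (u : Vec ℤ n) W {x} → (0ℤ ∷ x) ∈ piv c c≢0 u W → x ∈ W
∈-slice c c≢0 u W {x} p = ∈-saturated W c≢0 x u p

∈-insert : (W : Subspace n) (x : Vec ℤ n) → x ∈ insert W x
∈-insert nil            []       = refl
∈-insert (skip W)       (x ∷ xs) with x ℤ.≟ 0ℤ
... | yes refl = cong (0ℤ ∷_) (∈-insert W xs)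
... | no x≢0   = pivot-∈ x x≢0 xs W
∈-insert (piv c c≢0 u W) (x ∷ xs) = ∈-insert W _

⊆-insert : (W : Subspace n) (x : Vec ℤ n) → W ⊆ insert W x
⊆-insert nil            []       []       p = refl
⊆-insert (skip W)       (x ∷ xs) (y ∷ ys) p with x ℤ.≟ 0ℤ | ∷-injective p
... | yes _  | refl , q = cong (0ℤ ∷_) (⊆-insert W xs ys q)
... | no x≢0 | refl , q = slice-∈ x x≢0 xs W q
⊆-insert (piv c c≢0 u W) (x ∷ xs) (y ∷ ys) p = ⊆-insert W _ _ p

-- The integers c ≠ 0 and α encode the rational relation y ≡ -(α/c) x modulo W. Where x supplies a
-- new pivot, the relation is the cross product x₀ y - y₀ x.
insert-elim : (W : Subspace n) (x y : Vec ℤ n) → y ∈ insert W x →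
  Σ ℤ λ c → Σ ℤ λ α → c ≢ 0ℤ × lin c y α x ∈ W
insert-elim nil            []       []       p = 1ℤ , 0ℤ , (λ ()) , refl
insert-elim (skip W)       (x ∷ xs) (y ∷ ys) p with x ℤ.≟ 0ℤ
... | no x≢0   = x , ℤ.- y , x≢0 , cong₂ _∷_ (eq x y) p
  where
  eq : ∀ x y → x ℤ.* y ℤ.+ (ℤ.- y) ℤ.* x ≡ 0ℤ
  eq = ℤ-Solver.solve-∀
... | yes refl with ∷-injective p
...   | refl , q with insert-elim W xs ys q
...     | c , α , c≢0 , r = c , α , c≢0 , cong₂ _∷_ (cong₂ ℤ._+_ (ℤₚ.*-zeroʳ c) (ℤₚ.*-zeroʳ α)) r
insert-elim (piv c c≢0 u W) (x ∷ xs) (y ∷ ys) p with insert-elim W _ _ p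
... | c′ , α , c′≢0 , r = c′ , α , c′≢0 , trans (cong (residue W) (lin-lin c c′ α ys xs u y x)) r

insert-least : (W U : Subspace n) (x : Vec ℤ n) → W ⊆ U → x ∈ U → insert W x ⊆ U
insert-least W U x W⊆U x∈U y y∈ with insert-elim W x y y∈
... | c , α , c≢0 , r = ∈-saturated U c≢0 y x (subst (_∈ U) (eqᵥ y x) (∈-lin U 1ℤ (ℤ.- α) (W⊆U _ r) x∈U))
  where
  eq : ∀ c α y x → 1ℤ ℤ.* (c ℤ.* y ℤ.+ α ℤ.* x) ℤ.+ (ℤ.- α) ℤ.* x ≡ c ℤ.* y ℤ.+ 0ℤ ℤ.* x
  eq = ℤ-Solver.solve-∀
  eqᵥ : ∀ {k} (y x : Vec ℤ k) → lin 1ℤ (lin c y α x) (ℤ.- α) x ≡ lin c y 0ℤ x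
  eqᵥ []       []       = refl
  eqᵥ (y ∷ ys) (x ∷ xs) = cong₂ _∷_ (eq c α y x) (eqᵥ ys xs)

dim-mono : (W U : Subspace n) → W ⊆ U → dim W ≤ dim U
dim-mono nil            nil             W⊆U = z≤n
dim-mono (skip W)       (skip U)        W⊆U = dim-mono W U (λ x p → proj₂ (∷-injective (W⊆U (0ℤ ∷ x) (cong (0ℤ ∷_) p))))
dim-mono (skip W)       (piv c c≢0 u U) W⊆U = ≤-trans (dim-mono W U (λ x p → ∈-slice c c≢0 u U (W⊆U (0ℤ ∷ x) (cong (0ℤ ∷_) p)))) (n≤1+n _)
dim-mono (piv c c≢0 u W) (skip U)       W⊆U = ⊥-elim (c≢0 (proj₁ (∷-injective (W⊆U (c ∷ u) (pivot-∈ c c≢0 u W)))))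
dim-mono (piv c c≢0 u W) (piv c′ c′≢0 u′ U) W⊆U =
  s≤s (dim-mono W U (λ x p → ∈-slice c′ c′≢0 u′ U (W⊆U (0ℤ ∷ x) (slice-∈ c c≢0 u W p))))

∈-full : (W : Subspace n) → dim W ≡ n → ∀ x → x ∈ W
∈-full W e x with codim W in eqc | residue W x
... | zero  | [] = refl
... | suc k | r  = ⊥-elim (1+n≢0 {k} (+-cancelˡ-≡ (dim W) _ _ (trans (trans (cong (dim W +_) (sym eqc)) (dim+codim W)) (trans (sym e) (sym (+-identityʳ _))))))

unit : Fin (suc n) → Vec ℤ (suc n)
unit i = insertAt 0ᵥ i 1ℤ

-- Provides the coordinate at which the two row laws are compared: changing a row in that coordinate
-- alone always changes its coset modulo W.
unit-∉ : (W : Subspace (suc n)) → dim W < suc n → Σ (Fin (suc n)) λ i → ¬ unit i ∈ W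
unit-∉ (skip W) _ = zero , λ p → one (proj₁ (∷-injective p))
  where
  one : ¬ 1ℤ ≡ 0ℤ
  one ()
unit-∉ {zero} (piv c c≢0 u nil) (s≤s ())
unit-∉ {suc n} (piv c c≢0 u W) (s≤s lt) with unit-∉ W lt
... | i , ∉ = suc i , λ p → ∉ (∈-slice c c≢0 u W p)

zeroSubspace : ∀ n → Subspace n
zeroSubspace zero    = nil
zeroSubspace (suc n) = skip (zeroSubspace n)

dim-zeroSubspace : ∀ n → dim (zeroSubspace n) ≡ 0
dim-zeroSubspace zero    = refl
dim-zeroSubspace (suc n) = dim-zeroSubspace n

zeroSubspace-least : (W : Subspace n) → zeroSubspace n ⊆ W
zeroSubspace-least {n} W x p = subst (_∈ W) (sym (go x p)) (0ᵥ-∈ W)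
  where
  go : ∀ {n} (x : Vec ℤ n) → x ∈ zeroSubspace n → x ≡ 0ᵥ
  go []       p = refl
  go (x ∷ xs) p with ∷-injective p
  ... | refl , q = cong (0ℤ ∷_) (go xs q)

span : ∀ {k} → Subspace n → Vec (Vec ℤ n) k → Subspace n
span W []       = W
span W (x ∷ xs) = span (insert W x) xs

⊆-span : ∀ {k} (W : Subspace n) (xs : Vec (Vec ℤ n) k) → W ⊆ span W xs
⊆-span W []       y p = p
⊆-span W (x ∷ xs) y p = ⊆-span (insert W x) xs y (⊆-insert W x y p)

dim-span-≤ : ∀ {k} (W : Subspace n) (xs : Vec (Vec ℤ n) k) → dim (span W xs) ≤ dim W + k
dim-span-≤ W [] = ≤-reflexive (sym (+-identityʳ _))
dim-span-≤ {k = suc k} W (x ∷ xs) = ≤-trans (dim-span-≤ (insert W x) xs)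
  (≤-trans (+-monoˡ-≤ k (dim-insert-≤ W x)) (≤-reflexive (sym (+-suc (dim W) k))))

-- Odlyzko's bound for product laws

module _ {A : Set} (_≟A_ : DecidableEquality A) (a b : ℕ) (E : List A)
  (atom : ∀ v → b * ∑ E (λ y → 𝟙 (y ≟A v)) ≤ a * length E) where

  atom-unique : {P : A → Set} (P? : ∀ y → Dec (P y)) → (∀ {y y′} → P y → P y′ → y ≡ y′) →
    b * ∑ E (λ y → 𝟙 (P? y)) ≤ a * length E
  atom-unique {P} P? uniq with Any.any? P? E
  ... | yes w = ≤-trans (*-monoʳ-≤ b (∑-mono E (λ y → 𝟙-mono (P? y) (y ≟A proj₁ v) (λ p → uniq p (proj₂ v))))) (atom (proj₁ v))
    where v = Any.satisfied w
  ... | no ¬w = subst (λ k → b * k ≤ a * length E) (sym (none E ¬w)) (subst (_≤ a * length E) (sym (*-zeroʳ b)) z≤n)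
    where
    none : ∀ xs → ¬ Any P xs → ∑ xs (λ y → 𝟙 (P? y)) ≡ 0
    none []       ¬w = refl
    none (x ∷ xs) ¬w = cong₂ _+_ (𝟙-no (P? x) (¬w ∘ here)) (none xs (¬w ∘ there))

module _ (a b : ℕ) (E : List ℤ) (atom : ∀ v → b * ∑ E (λ y → 𝟙 (y ℤ.≟ v)) ≤ a * length E) where

  -- Reading the coordinates in order, a pivot coordinate is unrestricted, while each of the
  -- `codim W` others is determined by the earlier ones and costs a factor a/b. The induction needs
  -- the affine form with a scalar, because fixing a pivot coordinate both rescales and translates
  -- the rest of the row.
  odlyzko-affine : (W : Subspace n) → ∀ c (t : Vec ℤ n) → c ≢ 0ℤ →
    b ^ codim W * ∑ (allVecs E n) (λ x → 𝟙 (lin c x 1ℤ t ∈? W)) ≤ a ^ codim W * length E ^ n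
  odlyzko-affine nil c [] c≢0 = ≤-refl
  odlyzko-affine {suc n} (skip W) c (t₀ ∷ t) c≢0 = begin
    b * b ^ k * ∑ (allVecs E (suc n)) (λ x → 𝟙 (lin c x 1ℤ (t₀ ∷ t) ∈? skip W))
      ≡⟨ cong (b * b ^ k *_) (∑-allVecs E n _) ⟩
    b * b ^ k * ∑ E (λ x₀ → ∑ (allVecs E n) (λ x → 𝟙 (lin c (x₀ ∷ x) 1ℤ (t₀ ∷ t) ∈? skip W)))
      ≤⟨ *-monoʳ-≤ (b * b ^ k) (∑-mono E (λ x₀ → ∑-mono (allVecs E n) (λ x → both x₀ x))) ⟩
    b * b ^ k * ∑ E (λ x₀ → ∑ (allVecs E n) (λ x → 𝟙 (first? x₀) * q x))
      ≡⟨ cong (b * b ^ k *_) (trans (∑-cong E (λ x₀ → ∑-*ˡ (𝟙 (first? x₀)) (allVecs E n) q)) (∑-*ʳ E _ _)) ⟩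
    b * b ^ k * (∑ E (λ x₀ → 𝟙 (first? x₀)) * ∑ (allVecs E n) q)
      ≡⟨ shuffle b (b ^ k) _ _ ⟩
    (b * ∑ E (λ x₀ → 𝟙 (first? x₀))) * (b ^ k * ∑ (allVecs E n) q)
      ≤⟨ *-mono-≤ (atom-unique ℤ._≟_ a b E atom first? uniq) (odlyzko-affine W c t c≢0) ⟩
    (a * length E) * (a ^ k * length E ^ n)
      ≡⟨ shuffle a (a ^ k) _ _ ⟨
    a * a ^ k * (length E * length E ^ n) ∎
    where
    open ≤-Reasoning
    k = codim W
    q : Vec ℤ n → ℕ
    q x = 𝟙 (lin c x 1ℤ t ∈? W)
    first? : ∀ x₀ → Dec (c ℤ.* x₀ ℤ.+ 1ℤ ℤ.* t₀ ≡ 0ℤ)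
    first? x₀ = c ℤ.* x₀ ℤ.+ 1ℤ ℤ.* t₀ ℤ.≟ 0ℤ
    instance _ = ℤ.≢-nonZero c≢0
    uniq : ∀ {y y′} → c ℤ.* y ℤ.+ 1ℤ ℤ.* t₀ ≡ 0ℤ → c ℤ.* y′ ℤ.+ 1ℤ ℤ.* t₀ ≡ 0ℤ → y ≡ y′
    uniq {y} {y′} p p′ = ℤₚ.*-cancelˡ-≡ c y y′ (∙-cancelʳ ℤₚ.+-0-abelianGroup (1ℤ ℤ.* t₀) _ _ (trans p (sym p′)))
    shuffle : ∀ p q r s → p * q * (r * s) ≡ (p * r) * (q * s)
    shuffle = solve-∀
    both : ∀ x₀ x → 𝟙 (lin c (x₀ ∷ x) 1ℤ (t₀ ∷ t) ∈? skip W) ≤ 𝟙 (first? x₀) * q x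
    both x₀ x with lin c (x₀ ∷ x) 1ℤ (t₀ ∷ t) ∈? skip W
    ... | no _  = z≤n
    ... | yes p with ∷-injective p
    ...   | p₀ , ps = ≤-reflexive (sym (cong₂ _*_ (𝟙-yes (first? x₀) p₀) (𝟙-yes (lin c x 1ℤ t ∈? W) ps)))
  odlyzko-affine {suc n} (piv c′ c′≢0 u W) c (t₀ ∷ t) c≢0 = begin
    b ^ k * ∑ (allVecs E (suc n)) (λ x → 𝟙 (lin c x 1ℤ (t₀ ∷ t) ∈? piv c′ c′≢0 u W))
      ≡⟨ cong (b ^ k *_) (∑-allVecs E n _) ⟩
    b ^ k * ∑ E (λ x₀ → ∑ (allVecs E n) (λ x → 𝟙 (lin c′ (lin c x 1ℤ t) (ℤ.- (c ℤ.* x₀ ℤ.+ 1ℤ ℤ.* t₀)) u ∈? W)))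
      ≡⟨ ∑-*ˡ (b ^ k) E _ ⟨
    ∑ E (λ x₀ → b ^ k * ∑ (allVecs E n) (λ x → 𝟙 (lin c′ (lin c x 1ℤ t) (ℤ.- (c ℤ.* x₀ ℤ.+ 1ℤ ℤ.* t₀)) u ∈? W)))
      ≤⟨ ∑-mono E (λ x₀ → ≤-trans (≤-reflexive (cong (b ^ k *_) (∑-cong (allVecs E n) (λ x →
           cong (λ v → 𝟙 (v ∈? W)) (reassoc c′ c (s x₀) x t u))))) (odlyzko-affine W (c′ ℤ.* c) (lin c′ t (s x₀) u) c′c≢0)) ⟩
    ∑ E (λ x₀ → a ^ k * length E ^ n)
      ≡⟨ ∑-const E _ ⟩
    length E * (a ^ k * length E ^ n)
      ≡⟨ shuffle (length E) (a ^ k) (length E ^ n) ⟩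
    a ^ k * (length E * length E ^ n) ∎
    where
    open ≤-Reasoning
    k = codim W
    shuffle : ∀ p q r → p * (q * r) ≡ q * (p * r)
    shuffle = solve-∀
    s : ℤ → ℤ
    s x₀ = ℤ.- (c ℤ.* x₀ ℤ.+ 1ℤ ℤ.* t₀)
    c′c≢0 : c′ ℤ.* c ≢ 0ℤ
    c′c≢0 e with ℤₚ.i*j≡0⇒i≡0∨j≡0 c′ e
    ... | inj₁ p = c′≢0 p
    ... | inj₂ p = c≢0 p
    reassoc : ∀ {k} c′ c s (x t u : Vec ℤ k) → lin c′ (lin c x 1ℤ t) s u ≡ lin (c′ ℤ.* c) x 1ℤ (lin c′ t s u)
    reassoc c′ c s []       []       []       = refl
    reassoc c′ c s (x ∷ xs) (t ∷ ts) (u ∷ us) = cong₂ _∷_ (eq c′ c s x t u) (reassoc c′ c s xs ts us)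
      where
      eq : ∀ c′ c s x t u → c′ ℤ.* (c ℤ.* x ℤ.+ 1ℤ ℤ.* t) ℤ.+ s ℤ.* u ≡ c′ ℤ.* c ℤ.* x ℤ.+ 1ℤ ℤ.* (c′ ℤ.* t ℤ.+ s ℤ.* u)
      eq = ℤ-Solver.solve-∀

  odlyzko : (W : Subspace n) → b ^ codim W * ∑ (allVecs E n) (λ x → 𝟙 (x ∈? W)) ≤ a ^ codim W * length E ^ n
  odlyzko {n} W = subst (λ k → b ^ codim W * k ≤ a ^ codim W * length E ^ n)
    (∑-cong (allVecs E n) (λ x → cong (λ v → 𝟙 (v ∈? W)) (eqᵥ x))) (odlyzko-affine W 1ℤ 0ᵥ (λ ()))
    where
    eqᵥ : ∀ {k} (x : Vec ℤ k) → lin 1ℤ x 1ℤ 0ᵥ ≡ x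
    eqᵥ []       = refl
    eqᵥ (x ∷ xs) = cong₂ _∷_ (eq x) (eqᵥ xs)
      where
      eq : ∀ x → 1ℤ ℤ.* x ℤ.+ 1ℤ ℤ.* 0ℤ ≡ x
      eq = ℤ-Solver.solve-∀

-- Singular matrices have dependent rows

+ℤ-congʳ : ∀ x {y z} → y ≡ z → x ℤ.+ y ≡ x ℤ.+ z
+ℤ-congʳ x refl = refl

-- The exterior algebra of ℤⁿ: the pair (s , t) stands for s + e₀ ∧ t.
Λ : ℕ → Set
Λ zero    = ℤ
Λ (suc n) = Λ n × Λ n

0Λ 1Λ : Λ n
0Λ {zero}  = 0ℤ
0Λ {suc n} = 0Λ , 0Λ
1Λ {zero}  = 1ℤ
1Λ {suc n} = 1Λ , 0Λ

linΛ : ℤ → Λ n → ℤ → Λ n → Λ n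
linΛ {zero}  a s       b t         = a ℤ.* s ℤ.+ b ℤ.* t
linΛ {suc n} a (s , t) b (s′ , t′) = linΛ a s b s′ , linΛ a t b t′

-- With x′ the tail of x, the rule is x ∧ (s + e₀ ∧ t) = x′ ∧ s + e₀ ∧ (x₀ s - x′ ∧ t).
wedge : Vector ℤ n → Λ n → Λ n
wedge {zero}  x s       = 0ℤ
wedge {suc n} x (s , t) = wedge (x ∘ suc) s , linΛ (x zero) s -1ℤ (wedge (x ∘ suc) t)

top : Λ n → ℤ
top {zero}  s       = s
top {suc n} (s , t) = top t

-- Sets the generator e_j to 0 and renumbers the others, which on products of rows deletes column j.
del : Fin (suc n) → Λ (suc n) → Λ n
del             zero    (s , t) = s
del {n = suc n} (suc j) (s , t) = del j s , del j t

linΛ-0 : ∀ n a b → linΛ a (0Λ {n}) b 0Λ ≡ 0Λ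
linΛ-0 zero    a b = cong₂ ℤ._+_ (ℤₚ.*-zeroʳ a) (ℤₚ.*-zeroʳ b)
linΛ-0 (suc n) a b = cong₂ _,_ (linΛ-0 n a b) (linΛ-0 n a b)

linΛ-cancel : ∀ a (s : Λ n) → linΛ a s -1ℤ (linΛ a s -1ℤ 0Λ) ≡ 0Λ
linΛ-cancel {zero} a s = eq a s
  where
  eq : ∀ a s → a ℤ.* s ℤ.+ -1ℤ ℤ.* (a ℤ.* s ℤ.+ -1ℤ ℤ.* 0ℤ) ≡ 0ℤ
  eq = ℤ-Solver.solve-∀
linΛ-cancel {suc n} a (s , t) = cong₂ _,_ (linΛ-cancel a s) (linΛ-cancel a t)

linΛ-interchange : ∀ a b c (s s′ t t′ : Λ n) →
  linΛ c (linΛ a s b s′) -1ℤ (linΛ a t b t′) ≡ linΛ a (linΛ c s -1ℤ t) b (linΛ c s′ -1ℤ t′)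
linΛ-interchange {zero} a b c s s′ t t′ = eq a b c s s′ t t′
  where
  eq : ∀ a b c s s′ t t′ → c ℤ.* (a ℤ.* s ℤ.+ b ℤ.* s′) ℤ.+ -1ℤ ℤ.* (a ℤ.* t ℤ.+ b ℤ.* t′)
    ≡ a ℤ.* (c ℤ.* s ℤ.+ -1ℤ ℤ.* t) ℤ.+ b ℤ.* (c ℤ.* s′ ℤ.+ -1ℤ ℤ.* t′)
  eq = ℤ-Solver.solve-∀
linΛ-interchange {suc n} a b c (s , p) (s′ , p′) (t , q) (t′ , q′) =
  cong₂ _,_ (linΛ-interchange a b c s s′ t t′) (linΛ-interchange a b c p p′ q q′)

wedge-lin : (x : Vector ℤ n) → ∀ a s b t → wedge x (linΛ a s b t) ≡ linΛ a (wedge x s) b (wedge x t)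
wedge-lin {zero}  x a s       b t         = sym (linΛ-0 0 a b)
wedge-lin {suc n} x a (s , p) b (t , q) = cong₂ _,_ (wedge-lin (x ∘ suc) a s b t)
  (trans (cong (linΛ (x zero) (linΛ a s b t) -1ℤ) (wedge-lin (x ∘ suc) a p b q)) (linΛ-interchange a b (x zero) s t _ _))

wedge-wedge : (x : Vector ℤ n) (s : Λ n) → wedge x (wedge x s) ≡ 0Λ
wedge-wedge {zero}  x s       = refl
wedge-wedge {suc n} x (s , t) = cong₂ _,_ (wedge-wedge x′ s)
  (trans (cong (linΛ (x zero) (wedge x′ s) -1ℤ)
    (trans (wedge-lin x′ (x zero) s -1ℤ (wedge x′ t)) (cong (linΛ (x zero) (wedge x′ s) -1ℤ) (wedge-wedge x′ t))))
    (linΛ-cancel (x zero) (wedge x′ s)))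
  where x′ = x ∘ suc

wedge-anticomm : (x y : Vector ℤ n) (s : Λ n) → wedge x (wedge y s) ≡ linΛ -1ℤ (wedge y (wedge x s)) 0ℤ 0Λ
wedge-anticomm {zero}  x y s       = refl
wedge-anticomm {suc n} x y (s , t) = cong₂ _,_ (wedge-anticomm x′ y′ s)
  (trans (cong (linΛ (x zero) (wedge y′ s) -1ℤ)
      (trans (wedge-lin x′ (y zero) s -1ℤ (wedge y′ t)) (cong (linΛ (y zero) (wedge x′ s) -1ℤ) (wedge-anticomm x′ y′ t))))
    (trans (antisymmetry (x zero) (y zero) (wedge y′ s) (wedge x′ s) (wedge y′ (wedge x′ t)))
      (cong (λ w → linΛ -1ℤ (linΛ (y zero) (wedge x′ s) -1ℤ w) 0ℤ 0Λ) (sym (wedge-lin y′ (x zero) s -1ℤ (wedge x′ t))))))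
  where
  x′ = x ∘ suc
  y′ = y ∘ suc
  antisymmetry : ∀ {n} a b (s t u : Λ n) → linΛ a s -1ℤ (linΛ b t -1ℤ (linΛ -1ℤ u 0ℤ 0Λ))
    ≡ linΛ -1ℤ (linΛ b t -1ℤ (linΛ a s -1ℤ u)) 0ℤ 0Λ
  antisymmetry {zero} a b s t u = eq a b s t u
    where
    eq : ∀ a b s t u → a ℤ.* s ℤ.+ -1ℤ ℤ.* (b ℤ.* t ℤ.+ -1ℤ ℤ.* (-1ℤ ℤ.* u ℤ.+ 0ℤ ℤ.* 0ℤ))
      ≡ -1ℤ ℤ.* (b ℤ.* t ℤ.+ -1ℤ ℤ.* (a ℤ.* s ℤ.+ -1ℤ ℤ.* u)) ℤ.+ 0ℤ ℤ.* 0ℤ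
    eq = ℤ-Solver.solve-∀
  antisymmetry {suc n} a b (s , s′) (t , t′) (u , u′) = cong₂ _,_ (antisymmetry a b s t u) (antisymmetry a b s′ t′ u′)

wedge-0 : (x : Vector ℤ n) → wedge x 0Λ ≡ 0Λ
wedge-0 {zero}  x = refl
wedge-0 {suc n} x = cong₂ _,_ (wedge-0 (x ∘ suc)) (trans (cong (linΛ (x zero) 0Λ -1ℤ) (wedge-0 (x ∘ suc))) (linΛ-0 n (x zero) -1ℤ))

wedges : ∀ {k} → Vector (Vector ℤ n) k → Λ n
wedges {k = zero}  A = 1Λ
wedges {k = suc k} A = wedge (A zero) (wedges (A ∘ suc))

-- A repeated factor makes a product vanish. This is why the signed minors along the first row are
-- orthogonal to every later row.
wedge-row-wedges : ∀ {k} (A : Vector (Vector ℤ n) k) i → wedge (A i) (wedges A) ≡ 0Λ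
wedge-row-wedges A zero    = wedge-wedge (A zero) _
wedge-row-wedges {n = n} A (suc i) = trans (wedge-anticomm (A (suc i)) (A zero) _)
  (trans (cong (λ w → linΛ -1ℤ w 0ℤ 0Λ) (trans (cong (wedge (A zero)) (wedge-row-wedges (A ∘ suc) i)) (wedge-0 (A zero)))) (linΛ-0 n -1ℤ 0ℤ))

del-lin : ∀ (j : Fin (suc n)) a s b t → del j (linΛ a s b t) ≡ linΛ a (del j s) b (del j t)
del-lin             zero    a s b t = refl
del-lin {n = suc n} (suc j) a (s , p) b (t , q) = cong₂ _,_ (del-lin j a s b t) (del-lin j a p b q)

del-wedge : ∀ (j : Fin (suc n)) (x : Vector ℤ (suc n)) s → del j (wedge x s) ≡ wedge (x ∘ punchIn j) (del j s)
del-wedge             zero    x (s , t) = refl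
del-wedge {n = suc n} (suc j) x (s , t) = cong₂ _,_ (del-wedge j (x ∘ suc) s)
  (trans (del-lin j (x zero) s -1ℤ (wedge (x ∘ suc) t)) (cong (linΛ (x zero) (del j s) -1ℤ) (del-wedge j (x ∘ suc) t)))

del-0 : ∀ (j : Fin (suc n)) → del j 0Λ ≡ 0Λ
del-0             zero    = refl
del-0 {n = suc n} (suc j) = cong₂ _,_ (del-0 j) (del-0 j)

del-1 : ∀ (j : Fin (suc n)) → del j 1Λ ≡ 1Λ
del-1             zero    = refl
del-1 {n = suc n} (suc j) = cong₂ _,_ (del-1 j) (del-0 j)

del-wedges : ∀ {k} (j : Fin (suc n)) (A : Vector (Vector ℤ (suc n)) k) → del j (wedges A) ≡ wedges (λ r c → A r (punchIn j c))
del-wedges {k = zero}  j A = del-1 j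
del-wedges {k = suc k} j A = trans (del-wedge j (A zero) _) (cong (wedge (A zero ∘ punchIn j)) (del-wedges j (A ∘ suc)))

∑ℤ : Vector ℤ n → ℤ
∑ℤ {zero}  f = 0ℤ
∑ℤ {suc n} f = f zero ℤ.+ ∑ℤ (f ∘ suc)

∑ℤ-cong : {f g : Vector ℤ n} → (∀ i → f i ≡ g i) → ∑ℤ f ≡ ∑ℤ g
∑ℤ-cong {zero}  e = refl
∑ℤ-cong {suc n} e = cong₂ ℤ._+_ (e zero) (∑ℤ-cong (e ∘ suc))

∑ℤ-lin : ∀ a (f : Vector ℤ n) b g → ∑ℤ (λ i → a ℤ.* f i ℤ.+ b ℤ.* g i) ≡ a ℤ.* ∑ℤ f ℤ.+ b ℤ.* ∑ℤ g
∑ℤ-lin {zero}  a f b g = sym (linΛ-0 0 a b)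
∑ℤ-lin {suc n} a f b g = trans (+ℤ-congʳ (a ℤ.* f zero ℤ.+ b ℤ.* g zero) (∑ℤ-lin a (f ∘ suc) b (g ∘ suc))) (eq a b (f zero) (g zero) (∑ℤ (f ∘ suc)) (∑ℤ (g ∘ suc)))
  where
  eq : ∀ a b x y u v → a ℤ.* x ℤ.+ b ℤ.* y ℤ.+ (a ℤ.* u ℤ.+ b ℤ.* v) ≡ a ℤ.* (x ℤ.+ u) ℤ.+ b ℤ.* (y ℤ.+ v)
  eq = ℤ-Solver.solve-∀

foldr-allFin : (f : Vector ℤ n) → foldr ℤ._+_ 0ℤ (map f (allFin n)) ≡ ∑ℤ f
foldr-allFin f = trans (cong (foldr ℤ._+_ 0ℤ) (map-tabulate id f)) (go f)
  where
  go : ∀ {n} (f : Vector ℤ n) → foldr ℤ._+_ 0ℤ (List.tabulate f) ≡ ∑ℤ f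
  go {zero}  f = refl
  go {suc n} f = +ℤ-congʳ (f zero) (go (f ∘ suc))

sign : Fin n → ℤ
sign j = (ℤ.- 1ℤ) ℤ.^ toℕ j

top-lin : ∀ a (s : Λ n) b t → top (linΛ a s b t) ≡ a ℤ.* top s ℤ.+ b ℤ.* top t
top-lin {zero}  a s       b t       = refl
top-lin {suc n} a (_ , s) b (_ , t) = top-lin a s b t

top-wedge : (x : Vector ℤ (suc n)) (ω : Λ (suc n)) → top (wedge x ω) ≡ ∑ℤ (λ j → sign j ℤ.* (x j ℤ.* top (del j ω)))
top-wedge {zero} x (s , t) = eq (x zero) s
  where
  eq : ∀ x s → x ℤ.* s ℤ.+ -1ℤ ℤ.* 0ℤ ≡ 1ℤ ℤ.* (x ℤ.* s) ℤ.+ 0ℤ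
  eq = ℤ-Solver.solve-∀
top-wedge {suc n} x (s , t) = begin
  top (linΛ (x zero) s -1ℤ (wedge (x ∘ suc) t))          ≡⟨ top-lin (x zero) s -1ℤ (wedge (x ∘ suc) t) ⟩
  x zero ℤ.* top s ℤ.+ -1ℤ ℤ.* top (wedge (x ∘ suc) t)    ≡⟨ cong (λ k → x zero ℤ.* top s ℤ.+ -1ℤ ℤ.* k) (top-wedge (x ∘ suc) t) ⟩
  x zero ℤ.* top s ℤ.+ -1ℤ ℤ.* ∑ℤ f                      ≡⟨ eq₁ (x zero ℤ.* top s) (∑ℤ f) ⟩
  1ℤ ℤ.* (x zero ℤ.* top s) ℤ.+ (-1ℤ ℤ.* ∑ℤ f ℤ.+ 0ℤ ℤ.* ∑ℤ f)  ≡⟨ +ℤ-congʳ (1ℤ ℤ.* (x zero ℤ.* top s)) (∑ℤ-lin -1ℤ f 0ℤ f) ⟨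
  1ℤ ℤ.* (x zero ℤ.* top s) ℤ.+ ∑ℤ (λ j → -1ℤ ℤ.* f j ℤ.+ 0ℤ ℤ.* f j)
    ≡⟨ +ℤ-congʳ (1ℤ ℤ.* (x zero ℤ.* top s)) (∑ℤ-cong (λ j → eq₂ (sign j) (x (suc j) ℤ.* top (del j t)))) ⟩
  ∑ℤ (λ j → sign j ℤ.* (x j ℤ.* top (del j (s , t)))) ∎
  where
  open ≡-Reasoning
  f : Vector ℤ (suc n)
  f j = sign j ℤ.* (x (suc j) ℤ.* top (del j t))
  eq₁ : ∀ p q → p ℤ.+ -1ℤ ℤ.* q ≡ 1ℤ ℤ.* p ℤ.+ (-1ℤ ℤ.* q ℤ.+ 0ℤ ℤ.* q)
  eq₁ = ℤ-Solver.solve-∀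
  eq₂ : ∀ p q → -1ℤ ℤ.* (p ℤ.* q) ℤ.+ 0ℤ ℤ.* (p ℤ.* q) ≡ -1ℤ ℤ.* p ℤ.* q
  eq₂ = ℤ-Solver.solve-∀

det≡top : (A : Matrix n) → det A ≡ top (wedges A)
-- An arbitrary vector x replaces the first row, because the kernel argument pairs the same minors
-- with the other rows too.
laplace : (A : Matrix (suc n)) (x : Vector ℤ (suc n)) →
  ∑ℤ (λ j → sign j ℤ.* (x j ℤ.* det (minor A j))) ≡ top (wedge x (wedges (A ∘ suc)))

det≡top {zero}  A = refl
det≡top {suc n} A = trans (foldr-allFin (λ j → sign j ℤ.* (A zero j ℤ.* det (minor A j)))) (laplace A (A zero))

laplace A x = trans (∑ℤ-cong (λ j → cong (λ k → sign j ℤ.* (x j ℤ.* k))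
  (trans (det≡top (minor A j)) (cong top (sym (del-wedges j (A ∘ suc))))))) (sym (top-wedge x _))

top-0 : ∀ n → top (0Λ {n}) ≡ 0ℤ
top-0 zero    = refl
top-0 (suc n) = top-0 n

dot : Vector ℤ n → Vector ℤ n → ℤ
dot x v = ∑ℤ (λ i → x i ℤ.* v i)

dot-insertAt : (x : Vector ℤ (suc n)) (v : Vector ℤ n) (p : Fin (suc n)) → dot x (Vector.insertAt v p 0ℤ) ≡ dot (x ∘ punchIn p) v
dot-insertAt x v zero = trans (cong (ℤ._+ dot (x ∘ suc) v) (ℤₚ.*-zeroʳ (x zero))) (ℤₚ.+-identityˡ (dot (x ∘ suc) v))
dot-insertAt {n = suc n} x v (suc p) = +ℤ-congʳ (x zero ℤ.* v zero) (dot-insertAt (x ∘ suc) (v ∘ suc) p)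

dot-lin : ∀ (x : Vector ℤ n) a u b v → dot x (λ i → a ℤ.* u i ℤ.+ b ℤ.* v i) ≡ a ℤ.* dot x u ℤ.+ b ℤ.* dot x v
dot-lin x a u b v = trans (∑ℤ-cong (λ i → eq (x i) a (u i) b (v i))) (∑ℤ-lin a (λ i → x i ℤ.* u i) b (λ i → x i ℤ.* v i))
  where
  eq : ∀ x a u b v → x ℤ.* (a ℤ.* u ℤ.+ b ℤ.* v) ≡ a ℤ.* (x ℤ.* u) ℤ.+ b ℤ.* (x ℤ.* v)
  eq = ℤ-Solver.solve-∀

-- If some minor along the first row is nonzero, the signed minors form a kernel vector. Otherwise the
-- induction hypothesis for two different minors gives two independent vectors killed by the other rows.
det≡0⇒kernel : (A : Matrix n) → det A ≡ 0ℤ → Σ (Vector ℤ n) λ v → (∃ λ p → v p ≢ 0ℤ) × (∀ i → dot (A i) v ≡ 0ℤ)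
det≡0⇒kernel {zero} A ()
det≡0⇒kernel {suc n} A detA≡0 with any? (λ j → ¬? (sign j ℤ.* det (minor A j) ℤ.≟ 0ℤ))
... | yes (p , w≢0) = w , (p , w≢0) , kills
  where
  w : Vector ℤ (suc n)
  w j = sign j ℤ.* det (minor A j)
  dot-w : ∀ x → dot x w ≡ top (wedge x (wedges (A ∘ suc)))
  dot-w x = trans (∑ℤ-cong (λ j → eq (x j) (sign j) (det (minor A j)))) (laplace A x)
    where
    eq : ∀ x s d → x ℤ.* (s ℤ.* d) ≡ s ℤ.* (x ℤ.* d)
    eq = ℤ-Solver.solve-∀
  kills : ∀ i → dot (A i) w ≡ 0ℤ
  kills zero    = trans (dot-w (A zero)) (trans (sym (det≡top A)) detA≡0)
  kills (suc i) = trans (dot-w (A (suc i))) (trans (cong top (wedge-row-wedges (A ∘ suc) i)) (top-0 (suc n)))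
... | no ¬w = result (det≡0⇒kernel (minor A zero) (minor≡0 zero))
  where
  sign≢0 : ∀ k → (ℤ.- 1ℤ) ℤ.^ k ≢ 0ℤ
  sign≢0 zero    ()
  sign≢0 (suc k) e with ℤₚ.i*j≡0⇒i≡0∨j≡0 (ℤ.- 1ℤ) {(ℤ.- 1ℤ) ℤ.^ k} e
  ... | inj₂ e′ = sign≢0 k e′
  minor≡0 : ∀ j → det (minor A j) ≡ 0ℤ
  minor≡0 j with ℤₚ.i*j≡0⇒i≡0∨j≡0 (sign j) (decidable-stable (_ ℤ.≟ 0ℤ) (λ ne → ¬w (j , ne)))
  ... | inj₁ e = ⊥-elim (sign≢0 (toℕ j) e)
  ... | inj₂ e = e
  Kernel : Set
  Kernel = Σ (Vector ℤ (suc n)) λ v → (∃ λ p → v p ≢ 0ℤ) × (∀ i → dot (A i) v ≡ 0ℤ)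
  result : Σ (Vector ℤ n) (λ v → (∃ λ p → v p ≢ 0ℤ) × (∀ i → dot (minor A zero i) v ≡ 0ℤ)) → Kernel
  result (v′ , (p′ , v′p≢0) , kills′) with det≡0⇒kernel (minor A (suc p′)) (minor≡0 (suc p′))
  ... | v″ , (p″ , v″p≢0) , kills″ = combine (dot (A zero) v₂ ℤ.≟ 0ℤ)
    where
    -- The second minor deletes a column where `v₁` is nonzero. So `v₂` vanishes at p while `v₁`
    -- does not, and a combination with nonzero coefficient α at `v₁` cannot vanish at p.
    p = suc p′
    v₁ = Vector.insertAt v′ zero 0ℤ
    v₂ = Vector.insertAt v″ p 0ℤ
    kills₁ : ∀ i → dot (A (suc i)) v₁ ≡ 0ℤ
    kills₁ i = trans (dot-insertAt (A (suc i)) v′ zero) (kills′ i)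
    kills₂ : ∀ i → dot (A (suc i)) v₂ ≡ 0ℤ
    kills₂ i = trans (dot-insertAt (A (suc i)) v″ p) (kills″ i)
    α = dot (A zero) v₂
    β = dot (A zero) v₁
    v : Vector ℤ (suc n)
    v j = α ℤ.* v₁ j ℤ.+ (ℤ.- β) ℤ.* v₂ j
    combine : Dec (α ≡ 0ℤ) → Kernel
    combine (yes α≡0) = v₂ , (punchIn p p″ , λ e → v″p≢0 (trans (sym (insertAt-punchIn v″ p 0ℤ p″)) e)) , λ { zero → α≡0 ; (suc i) → kills₂ i }
    combine (no α≢0)  = v , (p , v-p≢0) , λ { zero → trans (dot-lin (A zero) α v₁ (ℤ.- β) v₂) (eq₀ α β) ;
        (suc i) → trans (dot-lin (A (suc i)) α v₁ (ℤ.- β) v₂) (trans (cong₂ (λ x y → α ℤ.* x ℤ.+ (ℤ.- β) ℤ.* y) (kills₁ i) (kills₂ i)) (linΛ-0 0 α (ℤ.- β))) }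
      where
      eq₀ : ∀ α β → α ℤ.* β ℤ.+ (ℤ.- β) ℤ.* α ≡ 0ℤ
      eq₀ = ℤ-Solver.solve-∀
      eq₁ : ∀ α x b → α ℤ.* x ≡ α ℤ.* x ℤ.+ b ℤ.* 0ℤ
      eq₁ = ℤ-Solver.solve-∀
      v-p≢0 : v p ≢ 0ℤ
      v-p≢0 e with ℤₚ.i*j≡0⇒i≡0∨j≡0 α (trans (eq₁ α (v₁ p) (ℤ.- β)) (trans (cong (λ k → α ℤ.* v₁ p ℤ.+ (ℤ.- β) ℤ.* k) (sym (Vector.insertAt-lookup v″ p 0ℤ))) e))
      ... | inj₁ α≡0 = α≢0 α≡0
      ... | inj₂ x≡0 = v′p≢0 x≡0

dotᵥ : Vec ℤ n → Vector ℤ n → ℤ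
dotᵥ []       v = 0ℤ
dotᵥ (x ∷ xs) v = x ℤ.* v zero ℤ.+ dotᵥ xs (v ∘ suc)

dotᵥ-lookup : (x : Vec ℤ n) (v : Vector ℤ n) → dotᵥ x v ≡ dot (lookup x) v
dotᵥ-lookup []       v = refl
dotᵥ-lookup (x ∷ xs) v = +ℤ-congʳ (x ℤ.* v zero) (dotᵥ-lookup xs (v ∘ suc))

dotᵥ-lin : ∀ a (x : Vec ℤ n) b y v → dotᵥ (lin a x b y) v ≡ a ℤ.* dotᵥ x v ℤ.+ b ℤ.* dotᵥ y v
dotᵥ-lin a []       b []       v = sym (linΛ-0 0 a b)
dotᵥ-lin a (x ∷ xs) b (y ∷ ys) v = trans (+ℤ-congʳ ((a ℤ.* x ℤ.+ b ℤ.* y) ℤ.* v zero) (dotᵥ-lin a xs b ys (v ∘ suc))) (eq a x b y (v zero) (dotᵥ xs (v ∘ suc)) (dotᵥ ys (v ∘ suc)))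
  where
  eq : ∀ a x b y v p q → (a ℤ.* x ℤ.+ b ℤ.* y) ℤ.* v ℤ.+ (a ℤ.* p ℤ.+ b ℤ.* q) ≡ a ℤ.* (x ℤ.* v ℤ.+ p) ℤ.+ b ℤ.* (y ℤ.* v ℤ.+ q)
  eq = ℤ-Solver.solve-∀

dotᵥ-0ᵥ : (v : Vector ℤ n) → dotᵥ 0ᵥ v ≡ 0ℤ
dotᵥ-0ᵥ {zero}  v = refl
dotᵥ-0ᵥ {suc n} v = cong₂ ℤ._+_ (ℤₚ.*-zeroˡ (v zero)) (dotᵥ-0ᵥ (v ∘ suc))

dotᵥ-unit : (p : Fin (suc n)) (v : Vector ℤ (suc n)) → dotᵥ (unit p) v ≡ v p
dotᵥ-unit zero v = trans (cong₂ ℤ._+_ (ℤₚ.*-identityˡ (v zero)) (dotᵥ-0ᵥ (v ∘ suc))) (ℤₚ.+-identityʳ _)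
dotᵥ-unit {n = suc n} (suc p) v = trans (cong₂ ℤ._+_ (ℤₚ.*-zeroˡ (v zero)) (dotᵥ-unit p (v ∘ suc))) (ℤₚ.+-identityˡ _)

span-⟂ : ∀ {k} (W : Subspace n) (xs : Vec (Vec ℤ n) k) (v : Vector ℤ n) →
  (∀ y → y ∈ W → dotᵥ y v ≡ 0ℤ) → (∀ i → dotᵥ (lookup xs i) v ≡ 0ℤ) → ∀ y → y ∈ span W xs → dotᵥ y v ≡ 0ℤ
span-⟂ W []       v W⟂ xs⟂ = W⟂
span-⟂ W (x ∷ xs) v W⟂ xs⟂ = span-⟂ (insert W x) xs v insert⟂ (xs⟂ ∘ suc)
  where
  insert⟂ : ∀ y → y ∈ insert W x → dotᵥ y v ≡ 0ℤ
  insert⟂ y y∈ with insert-elim W x y y∈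
  ... | c , α , c≢0 , r with ℤₚ.i*j≡0⇒i≡0∨j≡0 c (trans (eq c (dotᵥ y v) α) (trans (cong (λ k → c ℤ.* dotᵥ y v ℤ.+ α ℤ.* k) (sym (xs⟂ zero)))
                               (trans (sym (dotᵥ-lin c y α x v)) (W⟂ _ r))))
    where
    eq : ∀ c d α → c ℤ.* d ≡ c ℤ.* d ℤ.+ α ℤ.* 0ℤ
    eq = ℤ-Solver.solve-∀
  ...   | inj₁ e = ⊥-elim (c≢0 e)
  ...   | inj₂ e = e

zeroSubspace-⟂ : (v : Vector ℤ n) → ∀ y → y ∈ zeroSubspace n → dotᵥ y v ≡ 0ℤ
zeroSubspace-⟂ {zero}  v [] p = refl
zeroSubspace-⟂ {suc n} v (y ∷ ys) p with ∷-injective p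
... | refl , q = cong₂ ℤ._+_ (ℤₚ.*-zeroˡ (v zero)) (zeroSubspace-⟂ (v ∘ suc) ys q)

-- A kernel vector is orthogonal to the whole row span. If the span were everything, it would
-- contain all unit vectors and the kernel vector would be 0.
singular⇒dependent : (M : Vec (Vec ℤ n) n) → det (toMatrix M) ≡ 0ℤ → dim (span (zeroSubspace n) M) < n
singular⇒dependent {n} M e = ≤∧≢⇒< (≤-trans (m≤m+n _ _) (≤-reflexive (dim+codim (span (zeroSubspace n) M)))) full-absurd
  where
  kernel = det≡0⇒kernel (toMatrix M) e
  v = proj₁ kernel
  absurd : ∀ {n} (W : Subspace n) (v : Vector ℤ n) → (∀ y → y ∈ W → dotᵥ y v ≡ 0ℤ) → ∀ p → v p ≢ 0ℤ → dim W ≢ n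
  absurd {suc n} W v W⟂ p vp≢0 full = vp≢0 (trans (sym (dotᵥ-unit p v)) (W⟂ (unit p) (∈-full W full (unit p))))
  full-absurd : dim (span (zeroSubspace n) M) ≢ n
  full-absurd = absurd (span (zeroSubspace n) M) v (span-⟂ (zeroSubspace n) M v (zeroSubspace-⟂ v)
    (λ i → trans (dotᵥ-lookup (lookup M i) v) (proj₂ (proj₂ kernel) i))) (proj₁ (proj₁ (proj₂ kernel))) (proj₂ (proj₁ (proj₂ kernel)))

-- Counting tuples by their span

∑< : ℕ → (ℕ → ℕ) → ℕ
∑< zero    f = 0
∑< (suc l) f = f 0 + ∑< l (f ∘ suc)

∑<-mono : ∀ l {f g : ℕ → ℕ} → (∀ i → i < l → f i ≤ g i) → ∑< l f ≤ ∑< l g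
∑<-mono zero    le = z≤n
∑<-mono (suc l) le = +-mono-≤ (le 0 (s≤s z≤n)) (∑<-mono l (λ i i<l → le (suc i) (s≤s i<l)))

∑<-*ˡ : ∀ c l f → ∑< l (λ i → c * f i) ≡ c * ∑< l f
∑<-*ˡ c zero    f = sym (*-zeroʳ c)
∑<-*ˡ c (suc l) f = trans (cong (c * f 0 +_) (∑<-*ˡ c l (f ∘ suc))) (sym (*-distribˡ-+ c (f 0) _))

∑<-*ʳ : ∀ l f c → ∑< l (λ i → f i * c) ≡ ∑< l f * c
∑<-*ʳ zero    f c = refl
∑<-*ʳ (suc l) f c = trans (cong (f 0 * c +_) (∑<-*ʳ l (f ∘ suc) c)) (sym (*-distribʳ-+ c (f 0) _))

∑<-const : ∀ l c → ∑< l (λ _ → c) ≡ l * c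
∑<-const zero    c = refl
∑<-const (suc l) c = cong (c +_) (∑<-const l c)

∑-∑< : (xs : List A₁) → ∀ l (f : A₁ → ℕ → ℕ) → ∑ xs (λ x → ∑< l (f x)) ≡ ∑< l (λ i → ∑ xs (λ x → f x i))
∑-∑< xs zero    f = ∑-zero xs
∑-∑< xs (suc l) f = trans (∑-distrib-+ xs _ _) (cong (∑ xs (λ x → f x 0) +_) (∑-∑< xs l (λ x → f x ∘ suc)))

∑-∸ : (xs : List A₁) (f g : A₁ → ℕ) → ∑ xs f ∸ ∑ xs g ≤ ∑ xs (λ x → f x ∸ g x)
∑-∸ xs f g = m≤n+o⇒m∸n≤o (∑ xs f) (∑ xs g) (≤-trans (∑-mono xs (λ x → m≤n+m∸n (f x) (g x))) (≤-reflexive (∑-distrib-+ xs g _)))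

-- Makes inverse counts integral: w c plays the role of 1/c, scaled by D.
common-multiple : ∀ T → Σ ℕ λ D → Σ (ℕ → ℕ) λ w → 0 < D × (∀ c → 0 < c → c ≤ T → w c * c ≡ D)
common-multiple zero = 1 , (λ _ → 0) , s≤s z≤n , λ c 0<c c≤0 → ⊥-elim (<-irrefl refl (<-≤-trans 0<c c≤0))
common-multiple (suc T) with common-multiple T
... | D , w , 0<D , wc≡D = D * suc T , w′ , *-mono-< 0<D (s≤s z≤n) , prop
  where
  w′ : ℕ → ℕ
  w′ c with c ≤? T
  ... | yes _ = w c * suc T
  ... | no _  = D
  shuffle : ∀ x y z → x * y * z ≡ x * z * y
  shuffle = solve-∀
  prop : ∀ c → 0 < c → c ≤ suc T → w′ c * c ≡ D * suc T
  prop c 0<c c≤1+T with c ≤? T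
  ... | yes c≤T = trans (shuffle (w c) (suc T) c) (cong (_* suc T) (wc≡D c 0<c c≤T))
  ... | no c≰T  = cong (D *_) (≤-antisym c≤1+T (≰⇒> c≰T))

span-mono : ∀ {k} (W U : Subspace n) (xs : Vec (Vec ℤ n) k) → W ⊆ U → span W xs ⊆ span U xs
span-mono W U []       W⊆U = W⊆U
span-mono W U (x ∷ xs) W⊆U = span-mono (insert W x) (insert U x) xs
  (insert-least W (insert U x) x (λ y p → ⊆-insert U x y (W⊆U y p)) (∈-insert U x))

span-least : ∀ {k} (W U : Subspace n) (xs : Vec (Vec ℤ n) k) → W ⊆ U → (∀ i → lookup xs i ∈ U) → span W xs ⊆ U
span-least W U []       W⊆U xs∈ = W⊆U
span-least W U (x ∷ xs) W⊆U xs∈ = span-least (insert W x) U xs (insert-least W U x W⊆U (xs∈ zero)) (xs∈ ∘ suc)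

∈-span : ∀ {k} (W : Subspace n) (xs : Vec (Vec ℤ n) k) → ∀ i → lookup xs i ∈ span W xs
∈-span W (x ∷ xs) zero    = ⊆-span (insert W x) xs x (∈-insert W x)
∈-span W (x ∷ xs) (suc i) = ∈-span (insert W x) xs i

independent : ∀ {l} → Subspace n → Vec (Vec ℤ n) l → ℕ
independent {l = l} W xs = 𝟙 (dim (span W xs) ℕ.≟ dim W + l)

module _ {n : ℕ} (L : List (Vec ℤ n)) where

  count : Subspace n → ℕ
  count W = ∑ L (λ x → 𝟙 (x ∈? W))

  count-mono : (W U : Subspace n) → W ⊆ U → count W ≤ count U
  count-mono W U W⊆U = ∑-mono L (λ x → 𝟙-mono (x ∈? W) (x ∈? U) (W⊆U x))

  count-≤ : (W : Subspace n) → count W ≤ length L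
  count-≤ W = ≤-trans (∑-≤-length L _ (λ x → 𝟙≤1 (x ∈? W))) (≤-reflexive (*-identityʳ _))

  dependents : Subspace n → ℕ → ℕ
  dependents W l = ∑ (allVecs L l) (λ xs → 𝟙 (dim (span W xs) <? dim W + l))

  extensions : Subspace n → ℕ → ℕ
  extensions W i = ∑ (allVecs L i) (λ xs → independent W xs * count (span W xs))

  -- Dependent tuples are split at the first row that lies in the span of W and the rows before it.
  -- The `l ∸ suc i` rows after it are unrestricted.
  dependents-≤ : ∀ W l → dependents W l ≤ ∑< l (λ i → extensions W i * length L ^ (l ∸ suc i))
  dependents-≤ W zero = ≤-reflexive (trans (+-identityʳ _) (𝟙-no (dim W <? dim W + 0) (λ lt → <-irrefl (sym (+-identityʳ (dim W))) lt)))
  dependents-≤ W (suc l) = begin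
    dependents W (suc l)
      ≡⟨ ∑-allVecs L l _ ⟩
    ∑ L (λ x → ∑ (allVecs L l) (λ xs → 𝟙 (dim (span (insert W x) xs) <? dim W + suc l)))
      ≤⟨ ∑-mono L split ⟩
    ∑ L (λ x → 𝟙 (x ∈? W) * T ^ l + 𝟙 (¬? (x ∈? W)) * ∑< l (λ i → extensions (insert W x) i * T ^ (l ∸ suc i)))
      ≡⟨ ∑-distrib-+ L _ _ ⟩
    ∑ L (λ x → 𝟙 (x ∈? W) * T ^ l) + ∑ L (λ x → 𝟙 (¬? (x ∈? W)) * ∑< l (λ i → extensions (insert W x) i * T ^ (l ∸ suc i)))
      ≡⟨ cong₂ _+_ (trans (∑-*ʳ L _ (T ^ l)) (cong (_* T ^ l) head-term)) (trans (∑-cong L (λ x → sym (∑<-*ˡ (𝟙 (¬? (x ∈? W))) l _))) (∑-∑< L l _)) ⟩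
    extensions W 0 * T ^ l + ∑< l (λ i → ∑ L (λ x → 𝟙 (¬? (x ∈? W)) * (extensions (insert W x) i * T ^ (l ∸ suc i))))
      ≤⟨ +-monoʳ-≤ (extensions W 0 * T ^ l) (∑<-mono l (λ i _ → tail-term i)) ⟩
    extensions W 0 * T ^ l + ∑< l (λ i → extensions W (suc i) * T ^ (l ∸ suc i)) ∎
    where
    open ≤-Reasoning
    T = length L
    head-term : ∑ L (λ x → 𝟙 (x ∈? W)) ≡ extensions W 0
    head-term = sym (trans (+-identityʳ _) (trans (cong (_* count W) (𝟙-yes (dim W ℕ.≟ dim W + 0) (sym (+-identityʳ _)))) (*-identityˡ _)))
    split : ∀ x → ∑ (allVecs L l) (λ xs → 𝟙 (dim (span (insert W x) xs) <? dim W + suc l))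
      ≤ 𝟙 (x ∈? W) * T ^ l + 𝟙 (¬? (x ∈? W)) * ∑< l (λ i → extensions (insert W x) i * T ^ (l ∸ suc i))
    split x with x ∈? W
    ... | yes _ = ≤-trans (∑-≤-length (allVecs L l) _ (λ xs → 𝟙≤1 (dim (span (insert W x) xs) <? dim W + suc l)))
                    (≤-trans (≤-reflexive (trans (*-identityʳ _) (trans (length-allVecs L l) (sym (*-identityˡ _))))) (m≤m+n (1 * T ^ l) _))
    ... | no ∉  = ≤-trans (≤-reflexive (cong (λ d → ∑ (allVecs L l) (λ xs → 𝟙 (dim (span (insert W x) xs) <? d)))
                    (trans (+-suc (dim W) l) (cong (_+ l) (sym (dim-insert-∉ W x ∉))))))
                    (≤-trans (dependents-≤ (insert W x) l) (≤-reflexive (sym (*-identityˡ _))))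
    tail-term : ∀ i → ∑ L (λ x → 𝟙 (¬? (x ∈? W)) * (extensions (insert W x) i * T ^ (l ∸ suc i))) ≤ extensions W (suc i) * T ^ (l ∸ suc i)
    tail-term i = ≤-trans (≤-reflexive (trans (∑-cong L (λ x → sym (*-assoc (𝟙 (¬? (x ∈? W))) _ _))) (∑-*ʳ L _ _)))
      (*-monoˡ-≤ (T ^ (l ∸ suc i)) (≤-trans (∑-mono L step) (≤-reflexive (sym (∑-allVecs L i _)))))
      where
      step : ∀ x → 𝟙 (¬? (x ∈? W)) * extensions (insert W x) i
        ≤ ∑ (allVecs L i) (λ xs → independent W (x ∷ xs) * count (span (insert W x) xs))
      step x with x ∈? W
      ... | yes _ = z≤n
      ... | no ∉  = ≤-reflexive (trans (*-identityˡ _) (cong (λ d → ∑ (allVecs L i) (λ xs → 𝟙 (dim (span (insert W x) xs) ℕ.≟ d) * count (span (insert W x) xs)))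
                      (trans (cong (_+ i) (dim-insert-∉ W x ∉)) (sym (+-suc (dim W) i)))))

  dependents-bound : ∀ W l K (M : ℕ → ℕ) → (∀ i → i < l → K * extensions W i ≤ M i * length L ^ suc i) →
    K * dependents W l ≤ ∑< l M * length L ^ l
  dependents-bound W l K M h = ≤-trans (*-monoʳ-≤ K (dependents-≤ W l)) (≤-trans (≤-reflexive (sym (∑<-*ˡ K l _)))
    (≤-trans (∑<-mono l step) (≤-reflexive (∑<-*ʳ l M _))))
    where
    step : ∀ i → i < l → K * (extensions W i * length L ^ (l ∸ suc i)) ≤ M i * length L ^ l
    step i i<l = ≤-trans (≤-reflexive (sym (*-assoc K _ _))) (≤-trans (*-monoˡ-≤ _ (h i i<l)) (≤-reflexive
      (trans (*-assoc (M i) _ _) (cong (M i *_) (trans (sym (^-distribˡ-+-* (length L) (suc i) (l ∸ suc i))) (cong (length L ^_) (m+[n∸m]≡n i<l)))))))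

  -- Weights w stand for D / count, so that (number of x in W) * (weight of any larger subspace) ≤ D.
  module _ (u D : ℕ) (w : ℕ → ℕ) (w*c≤D : ∀ c → c ≤ length L → w c * c ≤ D) where

    weight : Subspace n → ℕ
    weight W = w (count W)

    -- Reading xs in order, e vectors enlarge the current span, with at most T choices each, and s
    -- vectors lie in it. A vector of the second kind has `count` of the current span many choices,
    -- and this times the weight of the larger final span is at most D. The binomial number of
    -- patterns satisfies C(l,e) u^s ≤ (u + 1)^l; this bound is built into the induction as Pascal's
    -- rule.
    swap-bound : ∀ l s e U → s + e ≡ l →
      u ^ l * ∑ (allVecs L l) (λ xs → 𝟙 (dim (span U xs) ℕ.≟ dim U + e) * weight (span U xs) ^ s)
        ≤ u ^ e * suc u ^ l * (D ^ s * length L ^ e)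
    swap-bound zero zero zero U refl = ≤-trans (≤-reflexive (trans (*-identityˡ _) (trans (+-identityʳ _) (*-identityʳ _)))) (𝟙≤1 (dim U ℕ.≟ dim U + 0))
    swap-bound (suc l) s e U s+e≡ = begin
      u * u ^ l * ∑ (allVecs L (suc l)) (λ xs → 𝟙 (dim (span U xs) ℕ.≟ dim U + e) * weight (span U xs) ^ s)
        ≡⟨ cong (u * u ^ l *_) (∑-allVecs L l _) ⟩
      u * u ^ l * ∑ L (λ x → rest (insert U x))
        ≤⟨ *-monoʳ-≤ (u * u ^ l) (∑-mono L split) ⟩
      u * u ^ l * ∑ L (λ x → 𝟙 (x ∈? U) * rest U + 𝟙 (¬? (x ∈? U)) * rest (insert U x))
        ≡⟨ cong (u * u ^ l *_) (trans (∑-distrib-+ L _ _) (cong (_+ out) (∑-*ʳ L _ (rest U)))) ⟩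
      u * u ^ l * (count U * rest U + out)
        ≡⟨ regroup u (u ^ l) (count U * rest U) out ⟩
      u * (u ^ l * (count U * rest U)) + u * (u ^ l * out)
        ≤⟨ +-mono-≤ (*-monoʳ-≤ u (in-bound s e s+e≡)) (out-bound e s+e≡) ⟩
      u * (u ^ e * suc u ^ l * (D ^ s * T ^ e)) + u ^ e * suc u ^ l * (D ^ s * T ^ e)
        ≡⟨ collect u (u ^ e) (suc u ^ l) (D ^ s * T ^ e) ⟩
      u ^ e * (suc u * suc u ^ l) * (D ^ s * T ^ e) ∎
      where
      open ≤-Reasoning
      T = length L
      rest : Subspace n → ℕ
      rest U′ = ∑ (allVecs L l) (λ xs → 𝟙 (dim (span U′ xs) ℕ.≟ dim U + e) * weight (span U′ xs) ^ s)
      out = ∑ L (λ x → 𝟙 (¬? (x ∈? U)) * rest (insert U x))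
      regroup : ∀ a b c d → a * b * (c + d) ≡ a * (b * c) + a * (b * d)
      regroup = solve-∀
      collect : ∀ u p q r → u * (p * q * r) + p * q * r ≡ p * (suc u * q) * r
      collect = solve-∀
      split : ∀ x → rest (insert U x) ≤ 𝟙 (x ∈? U) * rest U + 𝟙 (¬? (x ∈? U)) * rest (insert U x)
      split x with x ∈? U
      ... | yes p = ≤-reflexive (trans (cong rest (insert-∈ U x p)) (sym (trans (+-identityʳ _) (*-identityˡ _))))
      ... | no _  = ≤-reflexive (sym (*-identityˡ _))
      in-bound : ∀ s e → s + e ≡ suc l → u ^ l * (count U * ∑ (allVecs L l) (λ xs → 𝟙 (dim (span U xs) ℕ.≟ dim U + e) * weight (span U xs) ^ s))
        ≤ u ^ e * suc u ^ l * (D ^ s * T ^ e)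
      -- With s = 0 every vector has to enlarge the span, but the first one did not, and the
      -- remaining l cannot raise the dimension by l + 1.
      in-bound zero e refl = subst (λ k → u ^ l * (count U * k) ≤ u ^ e * suc u ^ l * (D ^ 0 * T ^ e))
        (sym (trans (∑-cong (allVecs L l) (λ xs → cong (_* 1) (𝟙-no (dim (span U xs) ℕ.≟ dim U + suc l)
           (λ eq → <-irrefl eq (≤-<-trans (dim-span-≤ U xs) (+-monoʳ-< (dim U) (n<1+n l))))))) (∑-zero (allVecs L l))))
        (≤-trans (≤-reflexive (trans (cong (u ^ l *_) (*-zeroʳ (count U))) (*-zeroʳ (u ^ l)))) z≤n)
      in-bound (suc s) e refl = begin
        u ^ l * (count U * ∑ (allVecs L l) (λ xs → f xs * (weight (span U xs) * weight (span U xs) ^ s)))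
          ≡⟨ cong (u ^ l *_) (sym (∑-*ˡ (count U) (allVecs L l) _)) ⟩
        u ^ l * ∑ (allVecs L l) (λ xs → count U * (f xs * (weight (span U xs) * weight (span U xs) ^ s)))
          ≤⟨ *-monoʳ-≤ (u ^ l) (∑-mono (allVecs L l) absorb) ⟩
        u ^ l * ∑ (allVecs L l) (λ xs → D * (f xs * weight (span U xs) ^ s))
          ≡⟨ trans (cong (u ^ l *_) (∑-*ˡ D (allVecs L l) _)) (rot (u ^ l) D _) ⟩
        D * (u ^ l * ∑ (allVecs L l) (λ xs → f xs * weight (span U xs) ^ s))
          ≤⟨ *-monoʳ-≤ D (swap-bound l s e U refl) ⟩
        D * (u ^ e * suc u ^ l * (D ^ s * T ^ e))
          ≡⟨ inside D (u ^ e * suc u ^ l) (D ^ s) (T ^ e) ⟩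
        u ^ e * suc u ^ l * (D * D ^ s * T ^ e) ∎
        where
        f : Vec (Vec ℤ n) l → ℕ
        f xs = 𝟙 (dim (span U xs) ℕ.≟ dim U + e)
        rot : ∀ a b c → a * (b * c) ≡ b * (a * c)
        rot = solve-∀
        inside : ∀ d p q r → d * (p * (q * r)) ≡ p * (d * q * r)
        inside = solve-∀
        shuffle : ∀ c g x y → c * (g * (x * y)) ≡ x * c * (g * y)
        shuffle = solve-∀
        absorb : ∀ xs → count U * (f xs * (weight (span U xs) * weight (span U xs) ^ s)) ≤ D * (f xs * weight (span U xs) ^ s)
        absorb xs = ≤-trans (≤-reflexive (shuffle (count U) (f xs) (weight (span U xs)) _)) (*-monoˡ-≤ _
          (≤-trans (*-monoʳ-≤ (weight (span U xs)) (count-mono U (span U xs) (⊆-span U xs))) (w*c≤D _ (count-≤ (span U xs)))))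
      out-bound : ∀ e′ → s + e′ ≡ suc l → u * (u ^ l * ∑ L (λ x → 𝟙 (¬? (x ∈? U)) * ∑ (allVecs L l) (λ xs → 𝟙 (dim (span (insert U x) xs) ℕ.≟ dim U + e′) * weight (span (insert U x) xs) ^ s)))
        ≤ u ^ e′ * suc u ^ l * (D ^ s * T ^ e′)
      out-bound zero _ = subst (λ k → u * (u ^ l * k) ≤ 1 * suc u ^ l * (D ^ s * 1)) (sym (trans (∑-cong L none) (∑-zero L)))
        (≤-trans (≤-reflexive (trans (cong (u *_) (*-zeroʳ (u ^ l))) (*-zeroʳ u))) z≤n)
        where
        none : ∀ x → 𝟙 (¬? (x ∈? U)) * ∑ (allVecs L l) (λ xs → 𝟙 (dim (span (insert U x) xs) ℕ.≟ dim U + 0) * weight (span (insert U x) xs) ^ s) ≡ 0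
        none x with x ∈? U
        ... | yes _ = refl
        ... | no ∉  = trans (*-identityˡ _) (trans (∑-cong (allVecs L l) (λ xs → cong (_* weight (span (insert U x) xs) ^ s)
            (𝟙-no (dim (span (insert U x) xs) ℕ.≟ dim U + 0) (λ eq → <-irrefl (sym (trans eq (+-identityʳ (dim U))))
              (≤-trans (≤-reflexive (sym (dim-insert-∉ U x ∉))) (dim-mono (insert U x) (span (insert U x) xs) (⊆-span (insert U x) xs))))))) (∑-zero (allVecs L l)))
      out-bound (suc e′) eq = begin
        u * (u ^ l * ∑ L (λ x → 𝟙 (¬? (x ∈? U)) * g x))
          ≡⟨ cong (u *_) (sym (∑-*ˡ (u ^ l) L _)) ⟩
        u * ∑ L (λ x → u ^ l * (𝟙 (¬? (x ∈? U)) * g x))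
          ≤⟨ *-monoʳ-≤ u (∑-≤-length L _ each) ⟩
        u * (T * (u ^ e′ * suc u ^ l * (D ^ s * T ^ e′)))
          ≡⟨ inside u T (u ^ e′) (suc u ^ l) (D ^ s) (T ^ e′) ⟩
        u * u ^ e′ * suc u ^ l * (D ^ s * (T * T ^ e′)) ∎
        where
        g : Vec ℤ n → ℕ
        g x = ∑ (allVecs L l) (λ xs → 𝟙 (dim (span (insert U x) xs) ℕ.≟ dim U + suc e′) * weight (span (insert U x) xs) ^ s)
        inside : ∀ u t p q r v → u * (t * (p * q * (r * v))) ≡ u * p * q * (r * (t * v))
        inside = solve-∀
        each : ∀ x → u ^ l * (𝟙 (¬? (x ∈? U)) * g x) ≤ u ^ e′ * suc u ^ l * (D ^ s * T ^ e′)
        each x with x ∈? U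
        ... | yes _ = ≤-trans (≤-reflexive (*-zeroʳ (u ^ l))) z≤n
        ... | no ∉  = ≤-trans (≤-reflexive (cong (u ^ l *_) (trans (*-identityˡ (g x)) (cong (λ d → ∑ (allVecs L l) (λ xs → 𝟙 (dim (span (insert U x) xs) ℕ.≟ d) * weight (span (insert U x) xs) ^ s))
                        (trans (+-suc (dim U) e′) (cong (_+ e′) (sym (dim-insert-∉ U x ∉))))))))
                        (swap-bound l s e′ (insert U x) (suc-injective (trans (sym (+-suc s e′)) eq)))

-- The exchange of rows

inside : ∀ {l} → Subspace n → Vec (Vec ℤ n) l → ℕ
inside V []       = 1
inside V (y ∷ ys) = 𝟙 (y ∈? V) * inside V ys

inside≤1 : ∀ {l} (V : Subspace n) (ys : Vec (Vec ℤ n) l) → inside V ys ≤ 1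
inside≤1 V []       = ≤-refl
inside≤1 V (y ∷ ys) = *-mono-≤ (𝟙≤1 (y ∈? V)) (inside≤1 V ys)

inside-dec : ∀ {l} (V : Subspace n) (ys : Vec (Vec ℤ n) l) → inside V ys ≡ 0 ⊎ (∀ i → lookup ys i ∈ V)
inside-dec V [] = inj₂ λ ()
inside-dec V (y ∷ ys) with y ∈? V | inside-dec V ys
... | no _  | _       = inj₁ refl
... | yes p | inj₁ e  = inj₁ (trans (*-identityˡ _) e)
... | yes p | inj₂ ps = inj₂ λ { zero → p ; (suc i) → ps i }

module _ {n : ℕ} (L L′ : List (Vec ℤ n)) where

  private
    T  = length L
    T′ = length L′
    Z  = zeroSubspace n

  frames : Subspace n → Subspace n → ℕ → ℕ
  frames V W l = ∑ (allVecs L′ l) (λ ys → independent W ys * inside V ys)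

  -- The rows are chosen greedily in V outside the span of W and the rows already chosen. That span
  -- has dimension below s, so it excludes at most M/K entries of `L′` at each choice.
  frames-lower : ∀ K M V s → (∀ W → dim W < s → K * count L′ W ≤ M) →
    ∀ l W → dim W + l ≤ s → (K * count L′ V ∸ M) ^ l ≤ K ^ l * frames V W l
  frames-lower K M V s hM zero W _ = ≤-reflexive (sym (trans (*-identityˡ _) (trans (+-identityʳ _)
    (trans (*-identityʳ _) (𝟙-yes (dim W ℕ.≟ dim W + 0) (sym (+-identityʳ _)))))))
  frames-lower K M V s hM (suc l) W le = begin
    c * c ^ l                                       ≤⟨ *-monoˡ-≤ (c ^ l) c≤ ⟩
    K * ∑ L′ d * c ^ l                              ≡⟨ *-assoc K (∑ L′ d) (c ^ l) ⟩
    K * (∑ L′ d * c ^ l)                            ≡⟨ cong (K *_) (∑-*ʳ L′ d (c ^ l)) ⟨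
    K * ∑ L′ (λ y → d y * c ^ l)                     ≤⟨ *-monoʳ-≤ K (∑-mono L′ step) ⟩
    K * ∑ L′ (λ y → K ^ l * tails y)                 ≡⟨ cong (K *_) (∑-*ˡ (K ^ l) L′ tails) ⟩
    K * (K ^ l * ∑ L′ tails)                         ≡⟨ *-assoc K (K ^ l) _ ⟨
    K * K ^ l * ∑ L′ tails                           ≡⟨ cong (K * K ^ l *_) (∑-allVecs L′ l _) ⟨
    K * K ^ l * frames V W (suc l)                   ∎
    where
    open ≤-Reasoning
    c = K * count L′ V ∸ M
    d : Vec ℤ n → ℕ
    d y = 𝟙 (y ∈? V) ∸ 𝟙 (y ∈? W)
    tails : Vec ℤ n → ℕ
    tails y = ∑ (allVecs L′ l) (λ ys → independent W (y ∷ ys) * inside V (y ∷ ys))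
    c≤ : c ≤ K * ∑ L′ d
    c≤ = ≤-trans (∸-monoʳ-≤ (K * count L′ V) (hM W (≤-trans (≤-trans (m≤m+n (suc (dim W)) l) (≤-reflexive (sym (+-suc (dim W) l)))) le)))
      (≤-trans (≤-reflexive (sym (*-distribˡ-∸ K (count L′ V) (count L′ W)))) (*-monoʳ-≤ K (∑-∸ L′ _ _)))
    step : ∀ y → d y * c ^ l ≤ K ^ l * tails y
    step y with y ∈? V | y ∈? W
    ... | no _  | yes _ = z≤n
    ... | no _  | no _  = z≤n
    ... | yes _ | yes _ = z≤n
    ... | yes p | no ∉  = ≤-trans (≤-reflexive (*-identityˡ _)) (≤-trans
      (frames-lower K M V s hM l (insert W y) (≤-trans (≤-reflexive (trans (cong (_+ l) (dim-insert-∉ W y ∉)) (sym (+-suc (dim W) l)))) le))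
      (≤-reflexive (cong (K ^ l *_) (∑-cong (allVecs L′ l) (λ ys → cong₂ _*_
        (cong (λ k → 𝟙 (dim (span (insert W y) ys) ℕ.≟ k)) (trans (cong (_+ l) (dim-insert-∉ W y ∉)) (sym (+-suc (dim W) l))))
        (sym (*-identityˡ _)))))))

  -- The rows ys span a subspace U of V = span xs, and then xs completes U to V.
  exchange : ∀ s e (f : ℕ → ℕ) (xs : Vec (Vec ℤ n) (s + e)) (ys : Vec (Vec ℤ n) s) →
    independent Z xs * (independent Z ys * inside (span Z xs) ys) * f (count L (span Z xs))
      ≤ 𝟙 (dim (span (span Z ys) xs) ℕ.≟ dim (span Z ys) + e) * f (count L (span (span Z ys) xs))
  exchange s e f xs ys with dim (span Z xs) ℕ.≟ dim Z + (s + e) | dim (span Z ys) ℕ.≟ dim Z + s | inside-dec (span Z xs) ys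
  ... | no _   | _      | _      = z≤n
  ... | yes _  | no _   | _      = z≤n
  ... | yes _  | yes _  | inj₁ e₀ = ≤-trans (≤-reflexive (cong (λ k → 1 * (1 * k) * f (count L (span Z xs))) e₀)) z≤n
  ... | yes dx | yes dy | inj₂ ys∈ = *-mono-≤
      (≤-trans (≤-trans (≤-reflexive (trans (*-identityˡ _) (*-identityˡ _))) (inside≤1 V ys))
        (≤-reflexive (sym (𝟙-yes (dim (span U xs) ℕ.≟ dim U + e) dims))))
      (≤-reflexive (cong f (≤-antisym (count-mono L V (span U xs) V⊆) (count-mono L (span U xs) V ⊆V))))
    where
    V = span Z xs
    U = span Z ys
    V⊆ : V ⊆ span U xs
    V⊆ = span-mono Z U xs (zeroSubspace-least U)
    ⊆V : span U xs ⊆ V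
    ⊆V = span-least U V xs (span-least Z V ys (zeroSubspace-least V) ys∈) (∈-span Z xs)
    dims : dim (span U xs) ≡ dim U + e
    dims = trans (≤-antisym (dim-mono (span U xs) V ⊆V) (dim-mono V (span U xs) V⊆))
      (trans dx (trans (sym (+-assoc (dim Z) s e)) (cong (_+ e) (sym dy))))

  module _ (u a b K M s e : ℕ) (P : Subspace n → Set) (P? : ∀ V → Dec (P V))
    (0<K : 0 < K) (0<T′ : 0 < length L′)
    (few : ∀ W → dim W < s → K * count L′ W ≤ M)
    (many : ∀ V → dim V ≡ s + e → P V → b * count L V * length L′ * K ≤ a * length L * (K * count L′ V ∸ M))
    (pos : ∀ V → P V → 0 < count L V) where

    heavies : ℕ
    heavies = ∑ (allVecs L (s + e)) (λ xs → independent Z xs * 𝟙 (P? (span Z xs)))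

    -- Double counting of pairs (xs, ys), with ys independent in the span V of xs. By `many` and
    -- `frames-lower` the number of ys is at least a constant times `count L V` to the power s, and
    -- the weight cancels exactly this dependence on V. Then `exchange` lets ys be summed first, and
    -- `swap-bound` is applied over the span of ys.
    heavies-bound : b ^ s * u ^ (s + e) * heavies ≤ a ^ s * (u ^ e * suc u ^ (s + e)) * T ^ (s + e)
    heavies-bound = cancel-≤ (D ^ s * T′ ^ s * K ^ s) (*-mono-< (*-mono-< (0<^ s 0<D) (0<^ s 0<T′)) (0<^ s 0<K)) (begin
      D ^ s * T′ ^ s * K ^ s * (b ^ s * u ^ i * heavies)
        ≡⟨ shuffle₁ (D ^ s) (T′ ^ s) (K ^ s) (b ^ s) (u ^ i) heavies ⟩
      u ^ i * (b ^ s * D ^ s * T′ ^ s * K ^ s * heavies)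
        ≡⟨ cong (λ k → u ^ i * (k * heavies)) (sym (^-* b D T′ K)) ⟩
      u ^ i * (C * heavies)
        ≡⟨ cong (u ^ i *_) (∑-*ˡ C (allVecs L i) _) ⟨
      u ^ i * ∑ (allVecs L i) (λ xs → C * (independent Z xs * 𝟙 (P? (span Z xs))))
        ≤⟨ *-monoʳ-≤ (u ^ i) (∑-mono (allVecs L i) per-tuple) ⟩
      u ^ i * ∑ (allVecs L i) (λ xs → E * (independent Z xs * frames (span Z xs) Z s * wt (span Z xs) ^ s))
        ≡⟨ cong (u ^ i *_) (trans (∑-*ˡ E (allVecs L i) _) (cong (E *_) (∑-cong (allVecs L i) expand))) ⟩
      u ^ i * (E * ∑ (allVecs L i) (λ xs → ∑ (allVecs L′ s) (λ ys → independent Z xs * (independent Z ys * inside (span Z xs) ys) * wt (span Z xs) ^ s)))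
        ≤⟨ *-monoʳ-≤ (u ^ i) (*-monoʳ-≤ E (∑-mono (allVecs L i) (λ xs → ∑-mono (allVecs L′ s) (λ ys → exchange s e (λ c → w c ^ s) xs ys)))) ⟩
      u ^ i * (E * ∑ (allVecs L i) (λ xs → ∑ (allVecs L′ s) (λ ys → h ys xs)))
        ≡⟨ cong (λ k → u ^ i * (E * k)) (∑-swap (allVecs L i) (allVecs L′ s) _) ⟩
      u ^ i * (E * ∑ (allVecs L′ s) (λ ys → ∑ (allVecs L i) (h ys)))
        ≡⟨ trans (rot (u ^ i) E _) (cong (E *_) (sym (∑-*ˡ (u ^ i) (allVecs L′ s) _))) ⟩
      E * ∑ (allVecs L′ s) (λ ys → u ^ i * ∑ (allVecs L i) (h ys))
        ≤⟨ *-monoʳ-≤ E (∑-≤-length (allVecs L′ s) _ (λ ys → swap-bound L u D w w*c≤D i s e (span Z ys) refl)) ⟩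
      E * (length (allVecs L′ s) * (u ^ e * suc u ^ i * (D ^ s * T ^ e)))
        ≡⟨ cong₂ (λ p q → p * (q * (u ^ e * suc u ^ i * (D ^ s * T ^ e)))) (trans (^-distribʳ-* s (a * T) K) (cong (_* K ^ s) (^-distribʳ-* s a T))) (length-allVecs L′ s) ⟩
      a ^ s * T ^ s * K ^ s * (T′ ^ s * (u ^ e * suc u ^ i * (D ^ s * T ^ e)))
        ≡⟨ shuffle₂ (a ^ s) (T ^ s) (K ^ s) (T′ ^ s) (u ^ e * suc u ^ i) (D ^ s) (T ^ e) ⟩
      D ^ s * T′ ^ s * K ^ s * (a ^ s * (u ^ e * suc u ^ i) * (T ^ s * T ^ e))
        ≡⟨ cong (λ k → D ^ s * T′ ^ s * K ^ s * (a ^ s * (u ^ e * suc u ^ i) * k)) (^-distribˡ-+-* T s e) ⟨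
      D ^ s * T′ ^ s * K ^ s * (a ^ s * (u ^ e * suc u ^ i) * T ^ i) ∎)
      where
      open ≤-Reasoning
      i = s + e
      cm = common-multiple T
      D = proj₁ cm
      w = proj₁ (proj₂ cm)
      0<D = proj₁ (proj₂ (proj₂ cm))
      wc≡D = proj₂ (proj₂ (proj₂ cm))
      w*c≤D : ∀ c → c ≤ T → w c * c ≤ D
      w*c≤D zero    _   = ≤-trans (≤-reflexive (*-zeroʳ (w 0))) z≤n
      w*c≤D (suc c) c≤T = ≤-reflexive (wc≡D (suc c) (s≤s z≤n) c≤T)
      C = (b * D * T′ * K) ^ s
      E = (a * T * K) ^ s
      wt : Subspace n → ℕ
      wt V = w (count L V)
      h : Vec (Vec ℤ n) s → Vec (Vec ℤ n) i → ℕ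
      h ys xs = 𝟙 (dim (span (span Z ys) xs) ℕ.≟ dim (span Z ys) + e) * wt (span (span Z ys) xs) ^ s
      rot : ∀ a b c → a * (b * c) ≡ b * (a * c)
      rot = solve-∀
      shuffle₁ : ∀ d t k b u h → d * t * k * (b * u * h) ≡ u * (b * d * t * k * h)
      shuffle₁ = solve-∀
      shuffle₂ : ∀ a t k t′ q d te → a * t * k * (t′ * (q * (d * te))) ≡ d * t′ * k * (a * q * (t * te))
      shuffle₂ = solve-∀
      ^-* : ∀ p q r t → (p * q * r * t) ^ s ≡ p ^ s * q ^ s * r ^ s * t ^ s
      ^-* p q r t = trans (^-distribʳ-* s (p * q * r) t) (cong (_* t ^ s) (trans (^-distribʳ-* s (p * q) r) (cong (_* r ^ s) (^-distribʳ-* s p q))))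
      expand : ∀ (xs : Vec (Vec ℤ n) i) → independent Z xs * frames (span Z xs) Z s * wt (span Z xs) ^ s
        ≡ ∑ (allVecs L′ s) (λ ys → independent Z xs * (independent Z ys * inside (span Z xs) ys) * wt (span Z xs) ^ s)
      expand xs = trans (cong (_* wt (span Z xs) ^ s) (sym (∑-*ˡ (independent Z xs) (allVecs L′ s) _))) (sym (∑-*ʳ (allVecs L′ s) _ _))
      key : ∀ V → dim V ≡ i → P V → C ≤ E * (frames V Z s * wt V ^ s)
      key V dV pV = begin
        (b * D * T′ * K) ^ s                               ≡⟨ cong (λ k → (b * k * T′ * K) ^ s) (sym (wc≡D (count L V) (pos V pV) (count-≤ L V))) ⟩
        (b * (wt V * count L V) * T′ * K) ^ s              ≡⟨ cong (_^ s) (sh b (wt V) (count L V) T′ K) ⟩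
        (b * count L V * T′ * K * wt V) ^ s                ≡⟨ ^-distribʳ-* s (b * count L V * T′ * K) (wt V) ⟩
        (b * count L V * T′ * K) ^ s * wt V ^ s            ≤⟨ *-monoˡ-≤ (wt V ^ s) (^-monoˡ-≤ s (many V dV pV)) ⟩
        (a * T * (K * count L′ V ∸ M)) ^ s * wt V ^ s      ≡⟨ cong (_* wt V ^ s) (^-distribʳ-* s (a * T) _) ⟩
        (a * T) ^ s * (K * count L′ V ∸ M) ^ s * wt V ^ s  ≤⟨ *-monoˡ-≤ (wt V ^ s) (*-monoʳ-≤ ((a * T) ^ s) (frames-lower K M V s few s Z (≤-reflexive (cong (_+ s) (dim-zeroSubspace n))))) ⟩
        (a * T) ^ s * (K ^ s * frames V Z s) * wt V ^ s    ≡⟨ sh₂ ((a * T) ^ s) (K ^ s) (frames V Z s) (wt V ^ s) ⟩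
        (a * T) ^ s * K ^ s * (frames V Z s * wt V ^ s)    ≡⟨ cong (_* (frames V Z s * wt V ^ s)) (^-distribʳ-* s (a * T) K) ⟨
        E * (frames V Z s * wt V ^ s)                      ∎
        where
        sh : ∀ b w c t k → b * (w * c) * t * k ≡ b * c * t * k * w
        sh = solve-∀
        sh₂ : ∀ x y z v → x * (y * z) * v ≡ x * y * (z * v)
        sh₂ = solve-∀
      per-tuple : ∀ (xs : Vec (Vec ℤ n) i) → C * (independent Z xs * 𝟙 (P? (span Z xs))) ≤ E * (independent Z xs * frames (span Z xs) Z s * wt (span Z xs) ^ s)
      per-tuple xs with dim (span Z xs) ℕ.≟ dim Z + i | P? (span Z xs)
      ... | no _   | _      = ≤-trans (≤-reflexive (*-zeroʳ C)) z≤n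
      ... | yes _  | no _   = ≤-trans (≤-reflexive (*-zeroʳ C)) z≤n
      ... | yes dx | yes pV = ≤-trans (≤-reflexive (*-identityʳ C)) (≤-trans (key (span Z xs) (trans dx (cong (_+ i) (dim-zeroSubspace n))) pV)
        (≤-reflexive (cong (λ k → E * (k * wt (span Z xs) ^ s)) (sym (*-identityˡ (frames (span Z xs) Z s))))))

-- Numerical trade-offs

^-3* : ∀ m t → m ^ (3 * t) ≡ m ^ t * (m ^ t * m ^ t)
^-3* m t = trans (^-distribˡ-+-* m t (t + (t + 0))) (cong (m ^ t *_) (trans (^-distribˡ-+-* m t (t + 0)) (cong (λ k → m ^ t * m ^ k) (+-identityʳ t))))

module Ratio (u a b : ℕ) (0<u : 0 < u) (0<a : 0 < a) (ratio : a * (suc u * suc u) ≤ b * (u * u)) where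

  a*v≤b*u : a * suc u ≤ b * u
  a*v≤b*u = cancel-≤ (suc u) (s≤s z≤n) (begin
    suc u * (a * suc u)   ≡⟨ e₁ (suc u) a ⟩
    a * (suc u * suc u)   ≤⟨ ratio ⟩
    b * (u * u)           ≤⟨ *-monoʳ-≤ b (*-monoˡ-≤ u (n≤1+n u)) ⟩
    b * (suc u * u)       ≡⟨ e₂ b (suc u) u ⟩
    suc u * (b * u)       ∎)
    where
    open ≤-Reasoning
    e₁ : ∀ v a → v * (a * v) ≡ a * (v * v)
    e₁ = solve-∀
    e₂ : ∀ b v u → b * (v * u) ≡ v * (b * u)
    e₂ = solve-∀

  a≤b : a ≤ b
  a≤b = cancel-≤ (suc u) (s≤s z≤n) (≤-trans (≤-reflexive (*-comm (suc u) a)) (≤-trans a*v≤b*u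
    (≤-trans (*-monoʳ-≤ b (n≤1+n u)) (≤-reflexive (*-comm b (suc u))))))

  0<b : 0 < b
  0<b = <-≤-trans 0<a a≤b

  ^-ratio : ∀ k → a ^ k * (suc u ^ k * suc u ^ k) ≤ b ^ k * (u ^ k * u ^ k)
  ^-ratio k = subst₂ _≤_ (expand a (suc u)) (expand b u) (^-monoˡ-≤ k ratio)
    where
    expand : ∀ a v → (a * (v * v)) ^ k ≡ a ^ k * (v ^ k * v ^ k)
    expand a v = trans (^-distribʳ-* k a (v * v)) (cong (a ^ k *_) (^-distribʳ-* k v v))

  power-decay : ∀ t c → c * u ^ t ≤ suc u ^ t → c * a ^ t ≤ b ^ t
  power-decay t c h = cancel-≤ (suc u ^ t) (0<^ t (s≤s z≤n)) (begin
    suc u ^ t * (c * a ^ t)       ≡⟨ e₁ (suc u ^ t) c (a ^ t) ⟩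
    c * (a ^ t * suc u ^ t)       ≤⟨ *-monoʳ-≤ c (subst₂ _≤_ (^-distribʳ-* t a (suc u)) (^-distribʳ-* t b u) (^-monoˡ-≤ t a*v≤b*u)) ⟩
    c * (b ^ t * u ^ t)           ≡⟨ e₂ c (b ^ t) (u ^ t) ⟩
    b ^ t * (c * u ^ t)           ≤⟨ *-monoʳ-≤ (b ^ t) h ⟩
    b ^ t * suc u ^ t             ≡⟨ *-comm (b ^ t) (suc u ^ t) ⟩
    suc u ^ t * b ^ t             ∎)
    where
    open ≤-Reasoning
    e₁ : ∀ v c a → v * (c * a) ≡ c * (a * v)
    e₁ = solve-∀
    e₂ : ∀ c b u → c * (b * u) ≡ b * (c * u)
    e₂ = solve-∀

  shorten : ∀ {k l} c T → k ≤ l → b ^ l * c ≤ a ^ l * T → b ^ k * c ≤ a ^ k * T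
  shorten {k} {l} c T k≤l h = cancel-≤ (b ^ (l ∸ k)) (0<^ (l ∸ k) 0<b) (begin
    b ^ (l ∸ k) * (b ^ k * c)   ≡⟨ *-assoc (b ^ (l ∸ k)) (b ^ k) c ⟨
    b ^ (l ∸ k) * b ^ k * c     ≡⟨ cong (_* c) (trans (sym (^-distribˡ-+-* b (l ∸ k) k)) (cong (b ^_) (m∸n+n≡m k≤l))) ⟩
    b ^ l * c                   ≤⟨ h ⟩
    a ^ l * T                   ≡⟨ cong (_* T) (trans (cong (a ^_) (sym (m∸n+n≡m k≤l))) (^-distribˡ-+-* a (l ∸ k) k)) ⟩
    a ^ (l ∸ k) * a ^ k * T     ≤⟨ *-monoˡ-≤ T (*-monoˡ-≤ (a ^ k) (^-monoˡ-≤ (l ∸ k) a≤b)) ⟩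
    b ^ (l ∸ k) * a ^ k * T     ≡⟨ *-assoc (b ^ (l ∸ k)) (a ^ k) T ⟩
    b ^ (l ∸ k) * (a ^ k * T)   ∎)
    where open ≤-Reasoning

  module _ (t λ₀ : ℕ) (λ₀-large : u ^ (3 + λ₀) ≤ suc u ^ λ₀) where

    absorb-u : ∀ r → u ^ (λ₀ * t + r) * u ^ (3 * t) ≤ suc u ^ (λ₀ * t + r)
    absorb-u r = begin
      u ^ (λ₀ * t + r) * u ^ (3 * t)            ≡⟨ cong (_* u ^ (3 * t)) (^-distribˡ-+-* u (λ₀ * t) r) ⟩
      u ^ (λ₀ * t) * u ^ r * u ^ (3 * t)        ≡⟨ e (u ^ (λ₀ * t)) (u ^ r) (u ^ (3 * t)) ⟩
      u ^ (3 * t) * u ^ (λ₀ * t) * u ^ r        ≡⟨ cong (_* u ^ r) (trans (sym (^-distribˡ-+-* u (3 * t) (λ₀ * t))) (trans (cong (u ^_) (sym (*-distribʳ-+ t 3 λ₀))) (sym (^-*-assoc u (3 + λ₀) t)))) ⟩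
      (u ^ (3 + λ₀)) ^ t * u ^ r                ≤⟨ *-mono-≤ (^-monoˡ-≤ t λ₀-large) (^-monoˡ-≤ r (n≤1+n u)) ⟩
      (suc u ^ λ₀) ^ t * suc u ^ r              ≡⟨ cong (_* suc u ^ r) (^-*-assoc (suc u) λ₀ t) ⟩
      suc u ^ (λ₀ * t) * suc u ^ r              ≡⟨ ^-distribˡ-+-* (suc u) (λ₀ * t) r ⟨
      suc u ^ (λ₀ * t + r)                      ∎
      where
      open ≤-Reasoning
      e : ∀ x y z → x * y * z ≡ z * x * y
      e = solve-∀

    -- Of the s exchanged rows, t keep their factor a/b as the final gain. The other s′ rows supply
    -- (b/a)^s′ ≥ (1 + 1/u)^(2s′). One half of this pays the binomial price of s′ rows. The other
    -- half pays the price of the remaining 4t rows and the factor u^(3t), which is what `absorb-u`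
    -- and the size of λ₀ are for.
    entropy : ∀ r → let s = λ₀ * t + r + 5 * t in
      b ^ t * (a ^ s * (u ^ (3 * t) * suc u ^ (s + 3 * t))) ≤ a ^ t * (b ^ s * u ^ (s + 3 * t))
    entropy r = begin
      b ^ t * (a ^ s * (u ^ (3 * t) * suc u ^ (s + 3 * t)))
        ≡⟨ cong₂ (λ p q → b ^ t * (p * (u ^ (3 * t) * q))) (split-s a) (split-i (suc u)) ⟩
      b ^ t * (a ^ t * p * (m₃ * (y * k₄)))
        ≡⟨ e₁ (b ^ t) (a ^ t) p m₃ (y * k₄) ⟩
      a ^ t * b ^ t * (p * m₃ * (y * k₄))
        ≤⟨ *-monoʳ-≤ (a ^ t * b ^ t) F₄ ⟩
      a ^ t * b ^ t * (q * (x * m₄))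
        ≡⟨ e₂ (a ^ t) (b ^ t) q (x * m₄) ⟩
      a ^ t * (b ^ t * q * (x * m₄))
        ≡⟨ cong₂ (λ p q → a ^ t * (p * q)) (split-s b) (split-i u) ⟨
      a ^ t * (b ^ s * u ^ (s + 3 * t)) ∎
      where
      open ≤-Reasoning
      r″ = λ₀ * t + r
      s = r″ + 5 * t
      s′ = r″ + 4 * t
      p = a ^ s′
      q = b ^ s′
      x = u ^ s′
      y = suc u ^ s′
      m₃ = u ^ (3 * t)
      m₄ = u ^ (4 * t)
      k₄ = suc u ^ (4 * t)
      split-s : ∀ m → m ^ s ≡ m ^ t * m ^ s′
      split-s m = trans (cong (m ^_) (eq r″ t)) (^-distribˡ-+-* m t s′)
        where
        eq : ∀ r t → r + 5 * t ≡ t + (r + 4 * t)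
        eq = solve-∀
      split-i : ∀ m → m ^ (s + 3 * t) ≡ m ^ s′ * m ^ (4 * t)
      split-i m = trans (cong (m ^_) (eq r″ t)) (^-distribˡ-+-* m s′ (4 * t))
        where
        eq : ∀ r t → r + 5 * t + 3 * t ≡ r + 4 * t + 4 * t
        eq = solve-∀
      e₁ : ∀ b a p m z → b * (a * p * (m * z)) ≡ a * b * (p * m * z)
      e₁ = solve-∀
      e₂ : ∀ a b q z → a * b * (q * z) ≡ a * (b * q * z)
      e₂ = solve-∀
      F₂ : x * m₃ * k₄ ≤ m₄ * y
      F₂ = begin
        u ^ s′ * m₃ * k₄            ≡⟨ cong (λ z → z * m₃ * k₄) (^-distribˡ-+-* u r″ (4 * t)) ⟩
        u ^ r″ * m₄ * m₃ * k₄       ≡⟨ e₃ (u ^ r″) m₄ m₃ k₄ ⟩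
        m₄ * (u ^ r″ * m₃ * k₄)     ≤⟨ *-monoʳ-≤ m₄ (*-monoˡ-≤ k₄ (absorb-u r)) ⟩
        m₄ * (suc u ^ r″ * k₄)      ≡⟨ cong (m₄ *_) (^-distribˡ-+-* (suc u) r″ (4 * t)) ⟨
        m₄ * y                      ∎
        where
        e₃ : ∀ x m n k → x * m * n * k ≡ m * (x * n * k)
        e₃ = solve-∀
      F₄ : p * m₃ * (y * k₄) ≤ q * (x * m₄)
      F₄ = cancel-≤ y (0<^ s′ (s≤s z≤n)) (begin
        y * (p * m₃ * (y * k₄))     ≡⟨ e₃ y p m₃ k₄ ⟩
        p * (y * y) * (m₃ * k₄)     ≤⟨ *-monoˡ-≤ (m₃ * k₄) (^-ratio s′) ⟩
        q * (x * x) * (m₃ * k₄)     ≡⟨ e₄ q x m₃ k₄ ⟩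
        q * x * (x * m₃ * k₄)       ≤⟨ *-monoʳ-≤ (q * x) F₂ ⟩
        q * x * (m₄ * y)            ≡⟨ e₅ q x m₄ y ⟩
        y * (q * (x * m₄))          ∎)
        where
        e₃ : ∀ y p m k → y * (p * m * (y * k)) ≡ p * (y * y) * (m * k)
        e₃ = solve-∀
        e₄ : ∀ q x m k → q * (x * x) * (m * k) ≡ q * x * (x * m * k)
        e₄ = solve-∀
        e₅ : ∀ q x m y → q * x * (m * y) ≡ y * (q * (x * m))
        e₅ = solve-∀

    module _ {n : ℕ} (L L′ : List (Vec ℤ n)) (0<T′ : 0 < length L′)
      (v*uᵗ≤vᵗ : suc u * u ^ t ≤ suc u ^ t) (n-large : (9 + λ₀) * t ≤ n)
      (anticonc : ∀ W → b ^ codim W * count L W ≤ a ^ codim W * length L)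
      (anticonc′ : ∀ W → b ^ codim W * count L′ W ≤ a ^ codim W * length L′)
      (compare : ∀ W → dim W < n → b * b * count L W * length L′ ≤ a * a * count L′ W * length L) where

      private
        T  = length L
        T′ = length L′
        Z  = zeroSubspace n
        α  = a ^ t
        β  = b ^ t

      -- The cutoff (a/b)^t is the bound aimed at, so a span that is not heavy satisfies it already.
      Heavy : Subspace n → Set
      Heavy V = α * T < β * count L V

      few : ∀ s → s + 3 * t ≤ n → ∀ W → dim W < s → b ^ (3 * t) * count L′ W ≤ a ^ (3 * t) * T′
      few s le W dW<s = shorten (count L′ W) T′ 3t≤codim (anticonc′ W)
        where
        3t≤codim : 3 * t ≤ codim W
        3t≤codim = +-cancelˡ-≤ (dim W) _ _ (≤-trans (+-monoˡ-≤ (3 * t) (<⇒≤ dW<s)) (≤-trans le (≤-reflexive (sym (dim+codim W)))))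

      -- After division by b²β² this reads (a/b)^(2t+2) + a/b ≤ 1, and it follows from (a/b)^t ≤
      -- 1/(u + 1) and a/b ≤ u/(u + 1).
      slack : α * α * (a * a) + a * b * (β * β) ≤ b * b * (β * β)
      slack = cancel-≤ (suc u) (s≤s z≤n) (begin
        suc u * (α * α * (a * a) + a * b * (β * β))                 ≡⟨ e₁ (suc u) α a b β ⟩
        suc u * α * (α * (a * a)) + a * suc u * (b * (β * β))        ≤⟨ +-mono-≤ (*-mono-≤ (power-decay t (suc u) v*uᵗ≤vᵗ) (*-mono-≤ (^-monoˡ-≤ t a≤b) (*-mono-≤ a≤b a≤b))) (*-monoˡ-≤ (b * (β * β)) a*v≤b*u) ⟩
        β * (β * (b * b)) + b * u * (b * (β * β))                   ≡⟨ e₂ u b β ⟩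
        suc u * (b * b * (β * β))                                   ∎)
        where
        open ≤-Reasoning
        e₁ : ∀ v α a b β → v * (α * α * (a * a) + a * b * (β * β)) ≡ v * α * (α * (a * a)) + a * v * (b * (β * β))
        e₁ = solve-∀
        e₂ : ∀ u b β → β * (β * (b * b)) + b * u * (b * (β * β)) ≡ suc u * (b * b * (β * β))
        e₂ = solve-∀

      -- `compare` offers two factors a/b. One is kept and the other pays for the subtracted term:
      -- as V is heavy, (a/b)^(3t) is at most (a/b)^(2t) Pr[X ∈ V], which `slack` absorbs.
      many : ∀ V → dim V < n → Heavy V → b * count L V * T′ * b ^ (3 * t) ≤ a * T * (b ^ (3 * t) * count L′ V ∸ a ^ (3 * t) * T′)
      many V dV<n heavy = ≤-trans (m+n≤o⇒m≤o∸n (b * X * T′ * K) core) (≤-reflexive (sym (*-distribˡ-∸ (a * T) (K * Y) (M * T′))))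
        where
        open ≤-Reasoning
        X = count L V
        Y = count L′ V
        K = b ^ (3 * t)
        M = a ^ (3 * t)
        core : b * X * T′ * K + a * T * (M * T′) ≤ a * T * (K * Y)
        core = cancel-≤ a 0<a (begin
          a * (b * X * T′ * K + a * T * (M * T′))
            ≡⟨ cong₂ (λ k m → a * (b * X * T′ * k + a * T * (m * T′))) (^-3* b t) (^-3* a t) ⟩
          a * (b * X * T′ * (β * (β * β)) + a * T * (α * (α * α) * T′))
            ≡⟨ e₁ a b X T′ β α T ⟩
          a * b * (β * β) * (X * T′ * β) + a * a * (α * α) * (α * T * T′)
            ≤⟨ +-monoʳ-≤ (a * b * (β * β) * (X * T′ * β)) (*-monoʳ-≤ (a * a * (α * α)) (*-monoˡ-≤ T′ (<⇒≤ heavy))) ⟩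
          a * b * (β * β) * (X * T′ * β) + a * a * (α * α) * (β * X * T′)
            ≡⟨ e₂ a b β X T′ α ⟩
          (α * α * (a * a) + a * b * (β * β)) * (X * T′ * β)
            ≤⟨ *-monoˡ-≤ (X * T′ * β) slack ⟩
          b * b * (β * β) * (X * T′ * β)
            ≡⟨ e₃ b β X T′ ⟩
          b * b * X * T′ * (β * (β * β))
            ≤⟨ *-monoˡ-≤ (β * (β * β)) (compare V dV<n) ⟩
          a * a * Y * T * (β * (β * β))
            ≡⟨ e₄ a Y T (β * (β * β)) ⟩
          a * (a * T * (β * (β * β) * Y))
            ≡⟨ cong (λ k → a * (a * T * (k * Y))) (^-3* b t) ⟨
          a * (a * T * (K * Y)) ∎)
          where
          e₁ : ∀ a b X T′ β α T → a * (b * X * T′ * (β * (β * β)) + a * T * (α * (α * α) * T′))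
            ≡ a * b * (β * β) * (X * T′ * β) + a * a * (α * α) * (α * T * T′)
          e₁ = solve-∀
          e₂ : ∀ a b β X T′ α → a * b * (β * β) * (X * T′ * β) + a * a * (α * α) * (β * X * T′)
            ≡ (α * α * (a * a) + a * b * (β * β)) * (X * T′ * β)
          e₂ = solve-∀
          e₃ : ∀ b β X T′ → b * b * (β * β) * (X * T′ * β) ≡ b * b * X * T′ * (β * (β * β))
          e₃ = solve-∀
          e₄ : ∀ a Y T k → a * a * Y * T * k ≡ a * (a * T * (k * Y))
          e₄ = solve-∀

      heavy-pos : ∀ V → Heavy V → 0 < count L V
      heavy-pos V h with count L V
      ... | suc _ = s≤s z≤n
      ... | zero  = ⊥-elim (<⇒≱ h (≤-trans (≤-reflexive (*-zeroʳ β)) z≤n))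

      -- With at least t missing dimensions, Odlyzko's bound gives (a/b)^t by itself. The exchange
      -- is reserved for spans of more than n - t rows.
      light-extension : ∀ i → i + t ≤ n → β * extensions L Z i ≤ 2 * α * T ^ suc i
      light-extension i le = begin
        β * extensions L Z i                                              ≡⟨ ∑-*ˡ β (allVecs L i) _ ⟨
        ∑ (allVecs L i) (λ xs → β * (independent Z xs * count L (span Z xs))) ≤⟨ ∑-≤-length (allVecs L i) _ each ⟩
        length (allVecs L i) * (α * T)                                    ≡⟨ cong (_* (α * T)) (length-allVecs L i) ⟩
        T ^ i * (α * T)                                                   ≡⟨ e₁ (T ^ i) α T ⟩
        α * (T * T ^ i)                                                   ≤⟨ *-monoˡ-≤ (T * T ^ i) (m≤m+n α (α + 0)) ⟩
        2 * α * (T * T ^ i)                                               ∎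
        where
        open ≤-Reasoning
        e₁ : ∀ x α T → x * (α * T) ≡ α * (T * x)
        e₁ = solve-∀
        each : ∀ (xs : Vec (Vec ℤ n) i) → β * (independent Z xs * count L (span Z xs)) ≤ α * T
        each xs with dim (span Z xs) ℕ.≟ dim Z + i
        ... | no _  = ≤-trans (≤-reflexive (*-zeroʳ β)) z≤n
        ... | yes d = ≤-trans (≤-reflexive (cong (β *_) (*-identityˡ _))) (shorten (count L (span Z xs)) T t≤codim (anticonc (span Z xs)))
          where
          t≤codim : t ≤ codim (span Z xs)
          t≤codim = +-cancelˡ-≤ i _ _ (≤-trans le (≤-reflexive (trans (sym (dim+codim (span Z xs)))
            (cong (_+ codim (span Z xs)) (trans d (cong (_+ i) (dim-zeroSubspace n)))))))

      heavy-extension : ∀ r → let i = λ₀ * t + r + 5 * t + 3 * t in i < n → β * extensions L Z i ≤ 2 * α * T ^ suc i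
      heavy-extension r i<n = begin
        β * extensions L Z i
          ≡⟨ ∑-*ˡ β (allVecs L i) _ ⟨
        ∑ (allVecs L i) (λ xs → β * (independent Z xs * count L (span Z xs)))
          ≤⟨ ∑-mono (allVecs L i) each ⟩
        ∑ (allVecs L i) (λ xs → α * T + β * T * (independent Z xs * 𝟙 (Heavy? (span Z xs))))
          ≡⟨ trans (∑-distrib-+ (allVecs L i) _ _) (cong₂ _+_ (trans (∑-const (allVecs L i) _) (cong (_* (α * T)) (length-allVecs L i))) (∑-*ˡ (β * T) (allVecs L i) _)) ⟩
        T ^ i * (α * T) + β * T * A
          ≡⟨ e₁ (T ^ i) α T β A ⟩
        α * (T * T ^ i) + T * (β * A)
          ≤⟨ +-monoʳ-≤ (α * (T * T ^ i)) (*-monoʳ-≤ T βA≤) ⟩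
        α * (T * T ^ i) + T * (α * T ^ i)
          ≡⟨ e₂ α T (T ^ i) ⟩
        2 * α * (T * T ^ i) ∎
        where
        open ≤-Reasoning
        s = λ₀ * t + r + 5 * t
        i = s + 3 * t
        Heavy? : ∀ V → Dec (Heavy V)
        Heavy? V = α * T <? β * count L V
        few′ : ∀ W → dim W < s → b ^ (3 * t) * count L′ W ≤ a ^ (3 * t) * T′
        few′ = few s (<⇒≤ i<n)
        many′ : ∀ V → dim V ≡ i → Heavy V → b * count L V * T′ * b ^ (3 * t) ≤ a * T * (b ^ (3 * t) * count L′ V ∸ a ^ (3 * t) * T′)
        many′ V d = many V (≤-trans (≤-reflexive (cong suc d)) i<n)
        A = heavies L L′ u a b (b ^ (3 * t)) (a ^ (3 * t) * T′) s (3 * t) Heavy Heavy? (0<^ (3 * t) 0<b) 0<T′ few′ many′ heavy-pos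
        A≤ : b ^ s * u ^ i * A ≤ a ^ s * (u ^ (3 * t) * suc u ^ i) * T ^ i
        A≤ = heavies-bound L L′ u a b (b ^ (3 * t)) (a ^ (3 * t) * T′) s (3 * t) Heavy Heavy? (0<^ (3 * t) 0<b) 0<T′ few′ many′ heavy-pos
        e₁ : ∀ x α T β A → x * (α * T) + β * T * A ≡ α * (T * x) + T * (β * A)
        e₁ = solve-∀
        e₂ : ∀ α T x → α * (T * x) + T * (α * x) ≡ 2 * α * (T * x)
        e₂ = solve-∀
        βA≤ : β * A ≤ α * T ^ i
        βA≤ = cancel-≤ (b ^ s * u ^ i) (*-mono-< (0<^ s 0<b) (0<^ i 0<u)) (begin
          b ^ s * u ^ i * (β * A)                               ≡⟨ e₃ (b ^ s * u ^ i) β A ⟩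
          β * (b ^ s * u ^ i * A)                               ≤⟨ *-monoʳ-≤ β A≤ ⟩
          β * (a ^ s * (u ^ (3 * t) * suc u ^ i) * T ^ i)       ≡⟨ *-assoc β _ (T ^ i) ⟨
          β * (a ^ s * (u ^ (3 * t) * suc u ^ i)) * T ^ i       ≤⟨ *-monoˡ-≤ (T ^ i) (entropy r) ⟩
          α * (b ^ s * u ^ i) * T ^ i                           ≡⟨ e₄ α (b ^ s * u ^ i) (T ^ i) ⟩
          b ^ s * u ^ i * (α * T ^ i)                           ∎)
          where
          e₃ : ∀ x y z → x * (y * z) ≡ y * (x * z)
          e₃ = solve-∀
          e₄ : ∀ x y z → x * y * z ≡ y * (x * z)
          e₄ = solve-∀
        each : ∀ (xs : Vec (Vec ℤ n) i) → β * (independent Z xs * count L (span Z xs)) ≤ α * T + β * T * (independent Z xs * 𝟙 (Heavy? (span Z xs)))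
        each xs with dim (span Z xs) ℕ.≟ dim Z + i | Heavy? (span Z xs)
        ... | no _  | _      = ≤-trans (≤-reflexive (*-zeroʳ β)) z≤n
        ... | yes _ | no ¬h  = ≤-trans (≤-reflexive (cong (β *_) (*-identityˡ _))) (≤-trans (≮⇒≥ ¬h) (m≤m+n (α * T) _))
        ... | yes _ | yes _  = ≤-trans (≤-reflexive (cong (β *_) (*-identityˡ _))) (≤-trans (*-monoʳ-≤ β (count-≤ L (span Z xs)))
                                 (≤-trans (≤-reflexive (sym (*-identityʳ (β * T)))) (m≤n+m _ (α * T))))

      extension-bound : ∀ i → i < n → β * extensions L Z i ≤ 2 * α * T ^ suc i
      extension-bound i i<n with i + t ≤? n
      ... | yes le = light-extension i le
      ... | no ¬le = subst (λ k → β * extensions L Z k ≤ 2 * α * T ^ suc k) i≡ (heavy-extension r (subst (_< n) (sym i≡) i<n))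
        where
        -- Here i > n - t, so the bound on n leaves room for 3t rows that stay and for s ≥ (5 + λ₀)
        -- t rows to exchange.
        8+λ₀≤ : (8 + λ₀) * t ≤ i
        8+λ₀≤ = +-cancelʳ-≤ t _ _ (≤-trans (≤-reflexive (+-comm ((8 + λ₀) * t) t)) (≤-trans n-large (<⇒≤ (≰⇒> ¬le))))
        r = i ∸ (8 + λ₀) * t
        i≡ : λ₀ * t + r + 5 * t + 3 * t ≡ i
        i≡ = trans (eq λ₀ t r) (m+[n∸m]≡n 8+λ₀≤)
          where
          eq : ∀ l t r → l * t + r + 5 * t + 3 * t ≡ (8 + l) * t + r
          eq = solve-∀

      dependents-small : β * dependents L Z n ≤ n * (2 * α) * T ^ n
      dependents-small = ≤-trans (dependents-bound L Z n β (λ _ → 2 * α) extension-bound) (≤-reflexive (cong (_* T ^ n) (∑<-const n (2 * α))))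

-- Comparison of the uniform row with a masked difference row

∑-applyUpTo : (f : ℕ → A₁) → ∀ n (g : A₁ → ℕ) → ∑ (applyUpTo f n) g ≡ ∑< n (g ∘ f)
∑-applyUpTo f zero    g = refl
∑-applyUpTo f (suc n) g = cong (g (f 0) +_) (∑-applyUpTo (f ∘ suc) n g)

∑-upTo : ∀ n (g : ℕ → ℕ) → ∑ (upTo n) g ≡ ∑< n g
∑-upTo = ∑-applyUpTo id

∑<-+ : ∀ m n f → ∑< (m + n) f ≡ ∑< m f + ∑< n (λ i → f (m + i))
∑<-+ zero    n f = refl
∑<-+ (suc m) n f = trans (cong (f 0 +_) (∑<-+ m n (f ∘ suc))) (sym (+-assoc (f 0) _ _))

∑-upTo-+ : ∀ m n f → ∑ (upTo (m + n)) f ≡ ∑ (upTo m) f + ∑ (upTo n) (λ i → f (m + i))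
∑-upTo-+ m n f = trans (∑-upTo (m + n) f) (trans (∑<-+ m n f) (sym (cong₂ _+_ (∑-upTo m f) (∑-upTo n _))))

∑<-unique : ∀ n {P : ℕ → Set} (P? : ∀ i → Dec (P i)) → (∀ i j → P i → P j → i ≡ j) → ∑< n (λ i → 𝟙 (P? i)) ≤ 1
∑<-unique zero    P? uniq = z≤n
∑<-unique (suc n) {P} P? uniq with P? 0
... | yes p = ≤-reflexive (cong suc (none n))
  where
  none : ∀ n → ∑< n (λ i → 𝟙 (P? (suc i))) ≡ 0
  none n = ≤-antisym (≤-trans (∑<-mono n (λ i _ → ≤-reflexive (𝟙-no (P? (suc i)) (λ q → 1+n≢0 (uniq (suc i) 0 q p)))))
    (≤-reflexive (trans (∑<-const n 0) (*-zeroʳ n)))) z≤n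
... | no _  = ∑<-unique n (P? ∘ suc) (λ i j p q → suc-injective (uniq (suc i) (suc j) p q))

∑-upTo-unique : ∀ n {P : ℕ → Set} (P? : ∀ i → Dec (P i)) → (∀ i j → P i → P j → i ≡ j) → ∑ (upTo n) (λ i → 𝟙 (P? i)) ≤ 1
∑-upTo-unique n P? uniq = ≤-trans (≤-reflexive (∑-upTo n _)) (∑<-unique n P? uniq)

map-zip : (f : A₁ × A₂ → A₃) (xs : Vec A₁ n) (ys : Vec A₂ n) → Vec.map f (Vec.zip xs ys) ≡ zipWith (λ x y → f (x , y)) xs ys
map-zip f []       []       = refl
map-zip f (x ∷ xs) (y ∷ ys) = cong (_ ∷_) (map-zip f xs ys)

-- The law of a sum of 2ˡ independent uniform variables on {0,…,r₁}, as a list with multiplicities.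
sums : ℕ → ℕ → List ℕ
sums r₁ zero    = upTo (suc r₁)
sums r₁ (suc l) = map (λ p → proj₁ p + proj₂ p) (sums r₁ l ⊗ sums r₁ l)

All-⊗ : {P : A₁ → Set} {Q : A₂ → Set} {xs : List A₁} {ys : List A₂} → All P xs → All Q ys → All (λ p → P (proj₁ p) × Q (proj₂ p)) (xs ⊗ ys)
All-⊗ []       qs = []
All-⊗ (p ∷ ps) qs = ++⁺ (map⁺ (All.map (p ,_) qs)) (All-⊗ ps qs)

sums-≤ : ∀ r₁ l → All (_≤ 2 ^ l * r₁) (sums r₁ l)
sums-≤ r₁ zero = applyUpTo⁺₁ id (suc r₁) (λ { (s≤s i≤r) → ≤-trans i≤r (≤-reflexive (sym (*-identityˡ r₁))) })
sums-≤ r₁ (suc l) = map⁺ (All.map (λ { (p , q) → ≤-trans (+-mono-≤ p q) (≤-reflexive (eq (2 ^ l) r₁)) }) (All-⊗ (sums-≤ r₁ l) (sums-≤ r₁ l)))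
  where
  eq : ∀ p r → p * r + p * r ≡ 2 * p * r
  eq = solve-∀

length-sums-suc : ∀ r₁ l → length (sums r₁ (suc l)) ≡ length (sums r₁ l) * length (sums r₁ l)
length-sums-suc r₁ l = trans (length-map _ (sums r₁ l ⊗ sums r₁ l)) (length-⊗ (sums r₁ l) (sums r₁ l))

0<length-sums : ∀ r₁ l → 0 < length (sums r₁ l)
0<length-sums r₁ zero    = s≤s z≤n
0<length-sums r₁ (suc l) = ≤-trans (*-mono-< (0<length-sums r₁ l) (0<length-sums r₁ l)) (≤-reflexive (sym (length-sums-suc r₁ l)))

_⊞_ : Vec ℕ n → Vec ℕ n → Vec ℕ n
_⊞_ = zipWith _+_

∑-allVecs-sums : ∀ r₁ l n (F : Vec ℕ n → ℕ) →
  ∑ (allVecs (sums r₁ (suc l)) n) F ≡ ∑ (allVecs (sums r₁ l) n) (λ z → ∑ (allVecs (sums r₁ l) n) (λ z′ → F (z ⊞ z′)))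
∑-allVecs-sums r₁ l n F = trans (∑-allVecs-map _ (sums r₁ l ⊗ sums r₁ l) n F) (trans (∑-allVecs-⊗ (sums r₁ l) (sums r₁ l) n _)
  (∑-cong (allVecs (sums r₁ l) n) (λ z → ∑-cong (allVecs (sums r₁ l) n) (λ z′ → cong F (map-zip _ z z′)))))

-- An offset with a flag: under `true` a random sum is added to the offset, under `false` the entry
-- is the offset alone.
Slot : Set
Slot = ℤ × Bool

free blocked : Slot → ℕ
free (_ , true)  = 1
free (_ , false) = 0
blocked (_ , true)  = 0
blocked (_ , false) = 1

mask : Slot → ℤ → ℤ
mask (_ , true)  x = x
mask (_ , false) x = 0ℤ

masks : Vec Slot n → Vec ℕ n → Vec ℤ n
masks = zipWith (λ u z → mask u (ℤ.+ z))

place : Slot → ℕ → ℤ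
place u z = proj₁ u ℤ.+ mask u (ℤ.+ z)

mask-+ : ∀ u x y → mask u (ℤ.+ (x + y)) ≡ mask u (ℤ.+ x) ℤ.+ mask u (ℤ.+ y)
mask-+ (_ , true)  x y = ℤₚ.pos-+ x y
mask-+ (_ , false) x y = refl

masks-⊞ : (u : Vec Slot n) (z z′ : Vec ℕ n) → masks u (z ⊞ z′) ≡ masks u z +ᵥ masks u z′
masks-⊞ []       []       []        = refl
masks-⊞ (u ∷ us) (z ∷ zs) (z′ ∷ zs′) = cong₂ _∷_ (mask-+ u z z′) (masks-⊞ us zs zs′)

places-masks : (u : Vec Slot n) (z : Vec ℕ n) → zipWith place u z ≡ Vec.map proj₁ u +ᵥ masks u z
places-masks []       []       = refl
places-masks (u ∷ us) (z ∷ zs) = cong (place u z ∷_) (places-masks us zs)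

lin-1-1 : (x y : Vec ℤ n) → lin 1ℤ x 1ℤ y ≡ x +ᵥ y
lin-1-1 []       []       = refl
lin-1-1 (x ∷ xs) (y ∷ ys) = cong₂ _∷_ (cong₂ ℤ._+_ (ℤₚ.*-identityˡ x) (ℤₚ.*-identityˡ y)) (lin-1-1 xs ys)

residue-+ : (W : Subspace n) (x y : Vec ℤ n) → residue W (x +ᵥ y) ≡ residue W x +ᵥ residue W y
residue-+ W x y = trans (cong (residue W) (sym (lin-1-1 x y))) (trans (residue-lin W 1ℤ x 1ℤ y) (lin-1-1 _ _))

lin-difference≡0 : (x y : Vec ℤ n) → lin 1ℤ x -1ℤ y ≡ 0ᵥ → x ≡ y
lin-difference≡0 []       []       e = refl
lin-difference≡0 (x ∷ xs) (y ∷ ys) e with ∷-injective e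
... | e₀ , es = cong₂ _∷_ (ℤₚ.i-j≡0⇒i≡j x y (trans (eq x y) e₀)) (lin-difference≡0 xs ys es)
  where
  eq : ∀ x y → x ℤ.- y ≡ 1ℤ ℤ.* x ℤ.+ -1ℤ ℤ.* y
  eq = ℤ-Solver.solve-∀

difference : Slot × ℕ × ℕ → ℤ
difference (u , z , z′) = mask u (ℤ.+ z ℤ.- ℤ.+ z′)

differences-masks : (u : Vec Slot n) (z z′ : Vec ℕ n) →
  Vec.map difference (Vec.zip u (Vec.zip z z′)) ≡ lin 1ℤ (masks u z) -1ℤ (masks u z′)
differences-masks []       []       []        = refl
differences-masks (u ∷ us) (z ∷ zs) (z′ ∷ zs′) = cong₂ _∷_ (head u) (differences-masks us zs zs′)
  where
  eq : ∀ x y → x ℤ.- y ≡ 1ℤ ℤ.* x ℤ.+ -1ℤ ℤ.* y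
  eq = ℤ-Solver.solve-∀
  head : ∀ u → mask u (ℤ.+ z ℤ.- ℤ.+ z′) ≡ 1ℤ ℤ.* mask u (ℤ.+ z) ℤ.+ -1ℤ ℤ.* mask u (ℤ.+ z′)
  head (_ , true)  = eq (ℤ.+ z) (ℤ.+ z′)
  head (_ , false) = refl

masks-insertAt : (u : Vec Slot (suc n)) (z : Vec ℕ n) (i : Fin (suc n)) → ∀ x y → proj₂ (lookup u i) ≡ true →
  lin 1ℤ (masks u (insertAt z i x)) -1ℤ (masks u (insertAt z i y)) ≡ lin (ℤ.+ x ℤ.- ℤ.+ y) (unit i) 0ℤ (masks u (insertAt z i x))
masks-insertAt ((c , true) ∷ us) z zero x y refl = cong₂ _∷_ (eq (ℤ.+ x) (ℤ.+ y)) (tail (masks us z))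
  where
  eq : ∀ x y → 1ℤ ℤ.* x ℤ.+ -1ℤ ℤ.* y ≡ (x ℤ.- y) ℤ.* 1ℤ ℤ.+ 0ℤ ℤ.* x
  eq = ℤ-Solver.solve-∀
  eq₀ : ∀ k v → 1ℤ ℤ.* v ℤ.+ -1ℤ ℤ.* v ≡ k ℤ.* 0ℤ ℤ.+ 0ℤ ℤ.* v
  eq₀ = ℤ-Solver.solve-∀
  tail : ∀ {k} (v : Vec ℤ k) → lin 1ℤ v -1ℤ v ≡ lin (ℤ.+ x ℤ.- ℤ.+ y) 0ᵥ 0ℤ v
  tail []       = refl
  tail (v ∷ vs) = cong₂ _∷_ (eq₀ (ℤ.+ x ℤ.- ℤ.+ y) v) (tail vs)
masks-insertAt (u ∷ us) (z ∷ zs) (suc i) x y e = cong₂ _∷_ (eq₀ (ℤ.+ x ℤ.- ℤ.+ y) (mask u (ℤ.+ z))) (masks-insertAt us zs i x y e)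
  where
  eq₀ : ∀ k v → 1ℤ ℤ.* v ℤ.+ -1ℤ ℤ.* v ≡ k ℤ.* 0ℤ ℤ.+ 0ℤ ℤ.* v
  eq₀ = ℤ-Solver.solve-∀

module _ (r₁ : ℕ) where

  private
    r : ℕ
    r = suc r₁

  module Image {n : ℕ} (V : Subspace n) (u : Vec Slot n) where

    open Energy (lexGroup (codim V))

    φ : Vec ℕ n → Vec ℤ (codim V)
    φ z = residue V (masks u z)

    φ-⊞ : ∀ z z′ → φ (z ⊞ z′) ≡ φ z +ᵥ φ z′
    φ-⊞ z z′ = trans (cong (residue V) (masks-⊞ u z z′)) (residue-+ V (masks u z) (masks u z′))

    image : ℕ → List (Vec ℤ (codim V))
    image l = map φ (allVecs (sums r₁ l) n)

    collisions : ℕ → ℕ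
    collisions l = coinc (image l) (image l)

    ∑-image : ∀ l f → ∑ (image l) f ≡ ∑ (allVecs (sums r₁ l) n) (f ∘ φ)
    ∑-image l f = ∑-map φ (allVecs (sums r₁ l) n) f

    -- A sum of 2^(l+1) pieces is the sum of two independent sums of 2^l pieces, and φ is additive.
    -- Agreement of all sums expresses equality as multisets, whatever the order of the lists.
    ∑-image-suc : ∀ l f → ∑ (image (suc l)) f ≡ ∑ (sumset (image l)) f
    ∑-image-suc l f = begin
      ∑ (image (suc l)) f
        ≡⟨ ∑-image (suc l) f ⟩
      ∑ (allVecs (sums r₁ (suc l)) n) (f ∘ φ)
        ≡⟨ ∑-allVecs-sums r₁ l n (f ∘ φ) ⟩
      ∑ (allVecs (sums r₁ l) n) (λ z → ∑ (allVecs (sums r₁ l) n) (λ z′ → f (φ (z ⊞ z′))))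
        ≡⟨ ∑-cong (allVecs (sums r₁ l) n) (λ z → ∑-cong (allVecs (sums r₁ l) n) (λ z′ → cong f (φ-⊞ z z′))) ⟩
      ∑ (allVecs (sums r₁ l) n) (λ z → ∑ (allVecs (sums r₁ l) n) (λ z′ → f (φ z +ᵥ φ z′)))
        ≡⟨ ∑-cong (allVecs (sums r₁ l) n) (λ z → ∑-image l _) ⟨
      ∑ (allVecs (sums r₁ l) n) (λ z → ∑ (image l) (λ y → f (φ z +ᵥ y)))
        ≡⟨ ∑-image l _ ⟨
      ∑ (image l) (λ x → ∑ (image l) (λ y → f (x +ᵥ y)))
        ≡⟨ ∑-sumset (image l) f ⟨
      ∑ (sumset (image l)) f ∎
      where open ≡-Reasoning

    collisions-suc : ∀ l → collisions (suc l) ≡ coinc (sumset (image l)) (sumset (image l))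
    collisions-suc l = trans (∑-image-suc l _) (∑-cong (sumset (image l)) (λ x → ∑-image-suc l _))

    size : ℕ → ℕ
    size l = length (image l)

    size-sums : ∀ l → size l ≡ length (sums r₁ l) ^ n
    size-sums l = trans (length-map φ (allVecs (sums r₁ l) n)) (length-allVecs (sums r₁ l) n)

    size-suc : ∀ l → size (suc l) ≡ size l * size l
    size-suc l = trans (size-sums (suc l)) (trans (cong (_^ n) (length-sums-suc r₁ l))
      (trans (^-distribʳ-* n _ _) (sym (cong₂ _*_ (size-sums l) (size-sums l)))))

    collisions-step : ∀ l → collisions (suc l) ≤ size l * size l * collisions l
    collisions-step l = ≤-trans (≤-reflexive (collisions-suc l)) (energy-≤ (image l))

    -- The collision probability `collisions l` / `size l`² does not increase under doubling. This
    -- covers the rows that are blocked at the chosen coordinate.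
    chain-weak : ∀ l → collisions l * (size 0 * size 0) ≤ size l * size l * collisions 0
    chain-weak zero    = ≤-reflexive (*-comm (collisions 0) _)
    chain-weak (suc l) = begin
      collisions (suc l) * (size 0 * size 0)                  ≤⟨ *-monoˡ-≤ (size 0 * size 0) (collisions-step l) ⟩
      size l * size l * collisions l * (size 0 * size 0)      ≡⟨ *-assoc (size l * size l) (collisions l) (size 0 * size 0) ⟩
      size l * size l * (collisions l * (size 0 * size 0))    ≤⟨ *-monoʳ-≤ (size l * size l) (chain-weak l) ⟩
      size l * size l * (size l * size l * collisions 0)      ≡⟨ *-assoc (size l * size l) (size l * size l) (collisions 0) ⟨
      size l * size l * (size l * size l) * collisions 0      ≡⟨ cong (λ k → k * k * collisions 0) (size-suc l) ⟨
      size (suc l) * size (suc l) * collisions 0              ∎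
      where open ≤-Reasoning

    module _ (2c≤ : 2 * collisions 0 ≤ size 0 * size 0) where

      -- Keeps the hypothesis of `energy-gain` available at every doubling.
      2*collisions≤ : ∀ l → 2 * collisions l ≤ size l * size l
      2*collisions≤ zero    = 2c≤
      2*collisions≤ (suc l) = begin
        2 * collisions (suc l)                     ≤⟨ *-monoʳ-≤ 2 (collisions-step l) ⟩
        2 * (size l * size l * collisions l)       ≡⟨ eq (size l * size l) (collisions l) ⟩
        size l * size l * (2 * collisions l)       ≤⟨ *-monoʳ-≤ (size l * size l) (2*collisions≤ l) ⟩
        size l * size l * (size l * size l)        ≡⟨ cong (λ k → k * k) (size-suc l) ⟨
        size (suc l) * size (suc l)                ∎
        where
        open ≤-Reasoning
        eq : ∀ a c → 2 * (a * c) ≡ a * (2 * c)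
        eq = solve-∀

      chain-strong : ∀ l → 90 ^ l * (collisions l * (size 0 * size 0)) ≤ 89 ^ l * (size l * size l * collisions 0)
      chain-strong zero    = *-monoʳ-≤ 1 (chain-weak 0)
      chain-strong (suc l) = begin
        90 * 90 ^ l * (collisions (suc l) * k₀)              ≡⟨ e₁ (90 ^ l) (collisions (suc l)) k₀ ⟩
        90 ^ l * k₀ * (90 * collisions (suc l))              ≤⟨ *-monoʳ-≤ (90 ^ l * k₀) (≤-trans (≤-reflexive (cong (90 *_) (collisions-suc l))) (energy-gain (image l) (2*collisions≤ l))) ⟩
        90 ^ l * k₀ * (89 * (kₗ * collisions l))             ≡⟨ e₂ (90 ^ l) k₀ kₗ (collisions l) ⟩
        89 * kₗ * (90 ^ l * (collisions l * k₀))             ≤⟨ *-monoʳ-≤ (89 * kₗ) (chain-strong l) ⟩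
        89 * kₗ * (89 ^ l * (kₗ * collisions 0))             ≡⟨ e₃ kₗ (89 ^ l) (collisions 0) ⟩
        89 * 89 ^ l * (kₗ * kₗ * collisions 0)               ≡⟨ cong (λ k → 89 * 89 ^ l * (k * k * collisions 0)) (size-suc l) ⟨
        89 * 89 ^ l * (size (suc l) * size (suc l) * collisions 0) ∎
        where
        open ≤-Reasoning
        k₀ = size 0 * size 0
        kₗ = size l * size l
        e₁ : ∀ p c k → 90 * p * (c * k) ≡ p * k * (90 * c)
        e₁ = solve-∀
        e₂ : ∀ p k s c → p * k * (89 * (s * c)) ≡ 89 * s * (p * (c * k))
        e₂ = solve-∀
        e₃ : ∀ s p c → 89 * s * (p * (s * c)) ≡ 89 * p * (s * s * c)
        e₃ = solve-∀

    -- Membership in V prescribes the value of φ, and the probability of a single value after one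
    -- more doubling is at most the collision probability before it. This last doubling is the
    -- reason for 2^(l+1) pieces with only l energy gains.
    ∑-places≤collisions : ∀ l → ∑ (allVecs (sums r₁ (suc l)) n) (λ a → 𝟙 (zipWith place u a ∈? V)) ≤ collisions l
    ∑-places≤collisions l = begin
      ∑ (allVecs (sums r₁ (suc l)) n) (λ a → 𝟙 (zipWith place u a ∈? V))
        ≤⟨ ∑-mono (allVecs (sums r₁ (suc l)) n) (λ a → 𝟙-mono (zipWith place u a ∈? V) (φ a ≟ᵥ t) (solve a)) ⟩
      ∑ (allVecs (sums r₁ (suc l)) n) (λ a → 𝟙 (φ a ≟ᵥ t))
        ≡⟨ trans (sym (∑-image (suc l) (λ x → 𝟙 (x ≟ᵥ t)))) (trans (∑-image-suc l _) (∑-sumset (image l) _)) ⟩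
      ∑ (image l) (λ x → ∑ (image l) (λ y → 𝟙 (x +ᵥ y ≟ᵥ t)))
        ≤⟨ ∑-sum≤coinc (image l) t ⟩
      collisions l ∎
      where
      open ≤-Reasoning
      base = residue V (Vec.map proj₁ u)
      t = 0ᵥ +ᵥ negᵥ base
      solve : ∀ a → zipWith place u a ∈ V → φ a ≡ t
      solve a p = trans (sym (⊕-⊝-cancel (φ a) base)) (cong (_+ᵥ negᵥ base)
        (trans (zipWith-comm ℤₚ.+-comm (φ a) base)
          (trans (sym (residue-+ V (Vec.map proj₁ u) (masks u a))) (trans (cong (residue V) (sym (places-masks u a))) p))))

    -- Two single pieces agree modulo V exactly when their masked difference lies in V. The second
    -- row law Y is chosen for this identity.
    collisions-0 : collisions 0 ≡ ∑ (allVecs (upTo r) n) (λ z → ∑ (allVecs (upTo r) n) (λ z′ →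
      𝟙 (Vec.map difference (Vec.zip u (Vec.zip z z′)) ∈? V)))
    collisions-0 = trans (∑-image 0 _) (∑-cong (allVecs (upTo r) n) (λ z → trans (∑-image 0 _) (∑-cong (allVecs (upTo r) n) (λ z′ →
      𝟙-cong (φ z ≟ᵥ φ z′) (Vec.map difference (Vec.zip u (Vec.zip z z′)) ∈? V)
        (λ e → trans (resid z z′) (trans (cong (λ k → lin 1ℤ k -1ℤ (φ z′)) e) (lin-self 1ℤ (φ z′))))
        (λ e → lin-difference≡0 (φ z) (φ z′) (trans (sym (resid z z′)) e))))))
      where
      resid : ∀ z z′ → residue V (Vec.map difference (Vec.zip u (Vec.zip z z′))) ≡ lin 1ℤ (φ z) -1ℤ (φ z′)
      resid z z′ = trans (cong (residue V) (differences-masks u z z′)) (residue-lin V 1ℤ (masks u z) -1ℤ (masks u z′))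

  -- If all coordinates but i are fixed and slot i is free, at most one value there gives a
  -- prescribed image, because the unit vector is outside V. So the collision probability is at most
  -- 1/r, and r ≥ 2.
  few-collisions : ∀ {n} (V : Subspace (suc n)) (u : Vec Slot (suc n)) i → ¬ unit i ∈ V → proj₂ (lookup u i) ≡ true → 1 ≤ r₁ →
    2 * Image.collisions V u 0 ≤ Image.size V u 0 * Image.size V u 0
  few-collisions {n} V u i unit∉V isFree 1≤r₁ = begin
    2 * collisions 0
      ≤⟨ *-monoˡ-≤ (collisions 0) (s≤s 1≤r₁) ⟩
    r * collisions 0
      ≡⟨ cong (r *_) (trans (∑-image 0 _) (∑-cong (allVecs (upTo r) (suc n)) (λ z → ∑-image 0 _))) ⟩
    r * ∑ (allVecs (upTo r) (suc n)) (λ z → ∑ (allVecs (upTo r) (suc n)) (λ z′ → 𝟙 (φ z ≟ᵥ φ z′)))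
      ≤⟨ *-monoʳ-≤ r (∑-≤-length (allVecs (upTo r) (suc n)) _ at-most) ⟩
    r * (length (allVecs (upTo r) (suc n)) * r ^ n)
      ≡⟨ trans (cong (λ k → r * (k * r ^ n)) len) (shuffle r (r ^ n)) ⟩
    r ^ suc n * r ^ suc n
      ≡⟨ cong (λ k → k * k) (trans (length-map φ (allVecs (upTo r) (suc n))) len) ⟨
    size 0 * size 0 ∎
    where
    open ≤-Reasoning
    open Image V u
    len : length (allVecs (upTo r) (suc n)) ≡ r ^ suc n
    len = trans (length-allVecs (upTo r) (suc n)) (cong (_^ suc n) (length-upTo r))
    shuffle : ∀ r p → r * (r * p * p) ≡ r * p * (r * p)
    shuffle = solve-∀
    uniq : ∀ z w x y → φ w ≡ φ (insertAt z i x) → φ w ≡ φ (insertAt z i y) → x ≡ y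
    uniq z w x y p q with ℤ.+ x ℤ.- ℤ.+ y ℤ.≟ 0ℤ
    ... | yes e = ℤₚ.+-injective (ℤₚ.i-j≡0⇒i≡j (ℤ.+ x) (ℤ.+ y) e)
    ... | no ne = ⊥-elim (unit∉V (∈-saturated V ne (unit i) (masks u (insertAt z i x)) (trans (cong (residue V) (sym (masks-insertAt u z i x y isFree)))
        (trans (residue-lin V 1ℤ (masks u (insertAt z i x)) -1ℤ (masks u (insertAt z i y))) (trans (cong (λ k → lin 1ℤ k -1ℤ (φ (insertAt z i y))) (trans (sym p) q)) (lin-self 1ℤ (φ (insertAt z i y))))))))
    at-most : ∀ w → ∑ (allVecs (upTo r) (suc n)) (λ z′ → 𝟙 (φ w ≟ᵥ φ z′)) ≤ r ^ n
    at-most w = begin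
      ∑ (allVecs (upTo r) (suc n)) (λ z′ → 𝟙 (φ w ≟ᵥ φ z′))
        ≡⟨ trans (∑-allVecs-insertAt (upTo r) n i _) (∑-swap (upTo r) (allVecs (upTo r) n) _) ⟩
      ∑ (allVecs (upTo r) n) (λ z → ∑ (upTo r) (λ x → 𝟙 (φ w ≟ᵥ φ (insertAt z i x))))
        ≤⟨ ∑-≤-length (allVecs (upTo r) n) _ (λ z → ∑-upTo-unique r (λ x → φ w ≟ᵥ φ (insertAt z i x)) (uniq z w)) ⟩
      length (allVecs (upTo r) n) * 1
        ≡⟨ trans (*-identityʳ _) (trans (length-allVecs (upTo r) n) (cong (_^ n) (length-upTo r))) ⟩
      r ^ n ∎

∑-diagonal : (xs : List A₁) (f : A₁ → A₁ → ℕ) → ∑ xs (λ x → f x x) ≤ ∑ xs (λ x → ∑ xs (f x))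
∑-diagonal []       f = z≤n
∑-diagonal (x ∷ xs) f = +-mono-≤ (m≤m+n (f x x) _) (≤-trans (∑-diagonal xs f) (∑-mono xs (λ y → m≤n+m _ (f y x))))

free+blocked : ∀ u → free u + blocked u ≡ 1
free+blocked (_ , true)  = refl
free+blocked (_ , false) = refl

-- A uniform entry as a mixture of free and blocked slots

module Mixture (r₁ l d m : ℕ) (total : d + 2 ^ suc l * r₁ ≡ suc (2 * m)) where

  private
    r h N R : ℕ
    r = suc r₁
    h = 2 ^ suc l * r₁
    N = d + h
    S : List ℕ
    S = sums r₁ (suc l)
    R = length S

  centre : ℕ → ℤ
  centre k = ℤ.+ k ℤ.- ℤ.+ m

  -- What is left of {0,...,N - 1} once the window of length d starting at a is removed.
  remainder : ℕ → List ℕ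
  remainder a = upTo a ++ map (λ v → a + (d + v)) (upTo (h ∸ a))

  ∑-interval : ∀ {a} → a ≤ h → ∀ g → ∑ (upTo N) g ≡ ∑ (upTo d) (λ w → g (a + w)) + ∑ (remainder a) g
  ∑-interval {a} a≤h g = begin
    ∑ (upTo (d + h)) g
      ≡⟨ cong (λ k → ∑ (upTo k) g) (trans (cong (d +_) (sym (m+[n∸m]≡n a≤h))) (eq d a (h ∸ a))) ⟩
    ∑ (upTo (a + (d + (h ∸ a)))) g
      ≡⟨ trans (∑-upTo-+ a (d + (h ∸ a)) g) (cong (∑ (upTo a) g +_) (∑-upTo-+ d (h ∸ a) (λ i → g (a + i)))) ⟩
    ∑ (upTo a) g + (∑ (upTo d) (λ w → g (a + w)) + ∑ (upTo (h ∸ a)) (λ v → g (a + (d + v))))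
      ≡⟨ rot (∑ (upTo a) g) (∑ (upTo d) (λ w → g (a + w))) (∑ (upTo (h ∸ a)) (λ v → g (a + (d + v)))) ⟩
    ∑ (upTo d) (λ w → g (a + w)) + (∑ (upTo a) g + ∑ (upTo (h ∸ a)) (λ v → g (a + (d + v))))
      ≡⟨ cong (∑ (upTo d) (λ w → g (a + w)) +_) (trans (∑-++ (upTo a) _ g) (cong (∑ (upTo a) g +_) (∑-map _ (upTo (h ∸ a)) g))) ⟨
    ∑ (upTo d) (λ w → g (a + w)) + ∑ (remainder a) g ∎
    where
    open ≡-Reasoning
    eq : ∀ d a b → d + (a + b) ≡ a + (d + b)
    eq = solve-∀
    rot : ∀ x y z → x + (y + z) ≡ y + (x + z)
    rot = solve-∀

  length-remainder : ∀ {a} → a ≤ h → length (remainder a) ≡ h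
  length-remainder {a} a≤h = +-cancelˡ-≡ d _ _ (trans (sym (begin
    N                                          ≡⟨ length-upTo N ⟨
    length (upTo N)                            ≡⟨ length-∑ (upTo N) ⟩
    ∑ (upTo N) (λ _ → 1)                        ≡⟨ ∑-interval a≤h (λ _ → 1) ⟩
    ∑ (upTo d) (λ _ → 1) + ∑ (remainder a) (λ _ → 1)  ≡⟨ cong₂ _+_ (trans (sym (length-∑ (upTo d))) (length-upTo d)) (sym (length-∑ (remainder a))) ⟩
    d + length (remainder a)                   ∎)) refl)
    where open ≡-Reasoning

  -- A uniform entry in {-m,…,m}: with probability d/N it is a uniform offset plus an independent
  -- sum of 2^(l+1) uniform variables on {0,…,r₁}, and otherwise its slot is blocked.
  slots : ℕ → List Slot
  slots a = map (λ w → centre w , true) (upTo d) ++ map (λ v → centre v , false) (remainder a)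

  U : List Slot
  U = concatMap slots S

  ∑-U : ∀ f → ∑ U f ≡ ∑ S (λ a → ∑ (upTo d) (λ w → f (centre w , true)) + ∑ (remainder a) (λ v → f (centre v , false)))
  ∑-U f = trans (∑-concatMap slots S f) (∑-cong S (λ a → trans (∑-++ (map _ (upTo d)) _ f) (cong₂ _+_ (∑-map _ (upTo d) f) (∑-map _ (remainder a) f))))

  S≤h : All (_≤ h) S
  S≤h = sums-≤ r₁ (suc l)

  ∑-free : ∑ U free ≡ R * d
  ∑-free = trans (∑-U free) (trans (∑-cong S (λ a → trans (cong₂ _+_ (trans (sym (length-∑ (upTo d))) (length-upTo d)) (∑-zero (remainder a))) (+-identityʳ d))) (∑-const S d))

  ∑-blocked : ∑ U blocked ≡ R * h
  ∑-blocked = trans (∑-U blocked) (trans (∑-cong-All S≤h (λ a a≤h → cong₂ _+_ (∑-zero (upTo d)) (trans (sym (length-∑ (remainder a))) (length-remainder a≤h)))) (∑-const S h))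

  length-U : length U ≡ R * N
  length-U = trans (length-∑ U) (trans (∑-cong U (λ u → sym (free+blocked u))) (trans (∑-distrib-+ U free blocked)
    (trans (cong₂ _+_ ∑-free ∑-blocked) (sym (*-distribˡ-+ R d h)))))

  ∑-range : ∀ g → ∑ (range m) g ≡ ∑ (upTo N) (g ∘ centre)
  ∑-range g = trans (∑-map centre (upTo (suc (2 * m))) g) (cong (λ k → ∑ (upTo k) (g ∘ centre)) (sym total))

  length-range : length (range m) ≡ N
  length-range = trans (length-map _ (upTo (suc (2 * m)))) (trans (length-upTo (suc (2 * m))) (sym total))

  -- The sum a has to be independent of the slot, so a free slot receives a fresh a, while the
  -- blocked slots come from the remainders of another a′. Since both have the same law, free and
  -- blocked contributions can be recombined over one common a, whose window and remainder tile the
  -- range.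
  ∑-mixture : ∀ g → ∑ U (λ u → ∑ S (λ a → g (place u a))) ≡ R * (R * ∑ (range m) g)
  ∑-mixture g = begin
    ∑ U (λ u → ∑ S (λ a → g (place u a)))
      ≡⟨ ∑-U _ ⟩
    ∑ S (λ a′ → X + ∑ (remainder a′) (λ v → ∑ S (λ a → g (centre v ℤ.+ 0ℤ))))
      ≡⟨ ∑-distrib-+ S _ _ ⟩
    ∑ S (λ _ → X) + ∑ S (λ a′ → ∑ (remainder a′) (λ v → ∑ S (λ a → g (centre v ℤ.+ 0ℤ))))
      ≡⟨ cong₂ _+_ (trans (∑-const S X) (cong (R *_) X≡)) (trans (∑-cong S (λ a → trans (∑-cong (remainder a) (λ v → trans (∑-const S _) (cong (λ k → R * g k) (ℤₚ.+-identityʳ (centre v))))) (∑-*ˡ R (remainder a) _))) (∑-*ˡ R S _)) ⟩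
    R * ∑ S (λ a → ∑ (upTo d) (λ w → g (centre (a + w)))) + R * ∑ S (λ a → ∑ (remainder a) (g ∘ centre))
      ≡⟨ trans (sym (*-distribˡ-+ R _ _)) (cong (R *_) (sym (∑-distrib-+ S _ _))) ⟩
    R * ∑ S (λ a → ∑ (upTo d) (λ w → g (centre (a + w))) + ∑ (remainder a) (g ∘ centre))
      ≡⟨ cong (R *_) (∑-cong-All S≤h (λ a a≤h → sym (trans (∑-range g) (∑-interval a≤h (g ∘ centre))))) ⟩
    R * ∑ S (λ a → ∑ (range m) g)
      ≡⟨ cong (R *_) (∑-const S _) ⟩
    R * (R * ∑ (range m) g) ∎
    where
    open ≡-Reasoning
    X = ∑ (upTo d) (λ w → ∑ S (λ a → g (centre w ℤ.+ ℤ.+ a)))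
    X≡ : X ≡ ∑ S (λ a → ∑ (upTo d) (λ w → g (centre (a + w))))
    X≡ = trans (∑-swap (upTo d) S _) (∑-cong S (λ a → ∑-cong (upTo d) (λ w → cong g (trans (eq (ℤ.+ w) (ℤ.+ m) (ℤ.+ a)) (cong (ℤ._- ℤ.+ m) (sym (ℤₚ.pos-+ a w)))))))
      where
      eq : ∀ w m a → (w ℤ.- m) ℤ.+ a ≡ (a ℤ.+ w) ℤ.- m
      eq = ℤ-Solver.solve-∀

  ∑-allVecs-mixture : ∀ n (F : Vec ℤ n → ℕ) →
    ∑ (allVecs U n) (λ u → ∑ (allVecs S n) (λ a → F (zipWith place u a))) ≡ (R * R) ^ n * ∑ (allVecs (range m) n) F
  ∑-allVecs-mixture zero    F = trans (+-identityʳ _) (sym (*-identityˡ _))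
  ∑-allVecs-mixture (suc n) F = begin
    ∑ (allVecs U (suc n)) (λ u → ∑ (allVecs S (suc n)) (λ a → F (zipWith place u a)))
      ≡⟨ ∑-allVecs U n _ ⟩
    ∑ U (λ u₀ → ∑ (allVecs U n) (λ u → ∑ (allVecs S (suc n)) (λ a → F (zipWith place (u₀ ∷ u) a))))
      ≡⟨ ∑-cong U (λ u₀ → trans (∑-cong (allVecs U n) (λ u → ∑-allVecs S n _)) (∑-swap (allVecs U n) S _)) ⟩
    ∑ U (λ u₀ → ∑ S (λ a₀ → ∑ (allVecs U n) (λ u → ∑ (allVecs S n) (λ a → F (place u₀ a₀ ∷ zipWith place u a)))))
      ≡⟨ ∑-cong U (λ u₀ → ∑-cong S (λ a₀ → ∑-allVecs-mixture n _)) ⟩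
    ∑ U (λ u₀ → ∑ S (λ a₀ → (R * R) ^ n * ∑ (allVecs (range m) n) (λ x → F (place u₀ a₀ ∷ x))))
      ≡⟨ ∑-mixture (λ x₀ → (R * R) ^ n * ∑ (allVecs (range m) n) (λ x → F (x₀ ∷ x))) ⟩
    R * (R * ∑ (range m) (λ x₀ → (R * R) ^ n * ∑ (allVecs (range m) n) (λ x → F (x₀ ∷ x))))
      ≡⟨ cong (λ k → R * (R * k)) (trans (∑-*ˡ ((R * R) ^ n) (range m) _) (cong ((R * R) ^ n *_) (sym (∑-allVecs (range m) n F)))) ⟩
    R * (R * ((R * R) ^ n * ∑ (allVecs (range m) (suc n)) F))
      ≡⟨ eq R ((R * R) ^ n) _ ⟩
    R * R * (R * R) ^ n * ∑ (allVecs (range m) (suc n)) F ∎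
    where
    open ≡-Reasoning
    eq : ∀ R p x → R * (R * (p * x)) ≡ R * R * p * x
    eq = solve-∀

  UZZ : List (Slot × ℕ × ℕ)
  UZZ = U ⊗ (upTo r ⊗ upTo r)

  E′ : List ℤ
  E′ = map difference UZZ

  length-E′ : length E′ ≡ R * N * (r * r)
  length-E′ = trans (length-map difference UZZ) (trans (length-⊗ U (upTo r ⊗ upTo r))
    (cong₂ _*_ length-U (trans (length-⊗ (upTo r) (upTo r)) (cong (λ k → k * k) (length-upTo r)))))

  0<R : 0 < R
  0<R = 0<length-sums r₁ (suc l)

  atom-range : ∀ a b → b ≤ a * N → ∀ v → b * ∑ (range m) (λ y → 𝟙 (y ℤ.≟ v)) ≤ a * length (range m)
  atom-range a b le v = ≤-trans (*-monoʳ-≤ b (≤-trans (≤-reflexive (∑-range _)) (∑-upTo-unique N (λ k → centre k ℤ.≟ v)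
      (λ i j p q → ℤₚ.+-injective (∙-cancelʳ ℤₚ.+-0-abelianGroup (ℤ.- ℤ.+ m) (ℤ.+ i) (ℤ.+ j) (trans p (sym q)))))))
    (≤-trans (≤-reflexive (*-identityʳ b)) (≤-trans le (≤-reflexive (cong (a *_) (sym length-range)))))

  -- A free slot takes a given value with probability at most 1/r, since z determines z′; for a
  -- blocked slot only the trivial bound 1 is used. Together this is (d/N)(1/r) + h/N.
  atom-E′ : ∀ a b → b * (h * r + d) ≤ a * N * r → ∀ v → b * ∑ E′ (λ y → 𝟙 (y ℤ.≟ v)) ≤ a * length E′
  atom-E′ a b le v = begin
    b * ∑ E′ (λ y → 𝟙 (y ℤ.≟ v))
      ≡⟨ cong (b *_) (trans (∑-map difference UZZ _) (trans (∑-⊗ U (upTo r ⊗ upTo r) _) (∑-cong U (λ u → ∑-⊗ (upTo r) (upTo r) _)))) ⟩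
    b * ∑ U (λ u → ∑ (upTo r) (λ z → ∑ (upTo r) (λ z′ → 𝟙 (difference (u , z , z′) ℤ.≟ v))))
      ≤⟨ *-monoʳ-≤ b (∑-mono U each) ⟩
    b * ∑ U (λ u → free u * r + blocked u * (r * r))
      ≡⟨ cong (b *_) (trans (∑-distrib-+ U _ _) (cong₂ _+_ (trans (∑-*ʳ U free r) (cong (_* r) ∑-free)) (trans (∑-*ʳ U blocked (r * r)) (cong (_* (r * r)) ∑-blocked)))) ⟩
    b * (R * d * r + R * h * (r * r))
      ≡⟨ e₁ b R d r h ⟩
    R * r * (b * (h * r + d))
      ≤⟨ *-monoʳ-≤ (R * r) le ⟩
    R * r * (a * N * r)
      ≡⟨ e₂ R r a N ⟩
    a * (R * N * (r * r))
      ≡⟨ cong (a *_) length-E′ ⟨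
    a * length E′ ∎
    where
    open ≤-Reasoning
    e₁ : ∀ b R d r h → b * (R * d * r + R * h * (r * r)) ≡ R * r * (b * (h * r + d))
    e₁ = solve-∀
    e₂ : ∀ R r a N → R * r * (a * N * r) ≡ a * (R * N * (r * r))
    e₂ = solve-∀
    each : ∀ u → ∑ (upTo r) (λ z → ∑ (upTo r) (λ z′ → 𝟙 (difference (u , z , z′) ℤ.≟ v))) ≤ free u * r + blocked u * (r * r)
    each (_ , true) = ≤-trans (∑-≤-length (upTo r) _ (λ z → ∑-upTo-unique r (λ z′ → ℤ.+ z ℤ.- ℤ.+ z′ ℤ.≟ v)
        (λ i j p q → ℤₚ.+-injective (ℤₚ.neg-injective (∙-cancelˡ ℤₚ.+-0-abelianGroup (ℤ.+ z) (ℤ.- ℤ.+ i) (ℤ.- ℤ.+ j) (trans p (sym q)))))))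
      (≤-reflexive (trans (*-identityʳ _) (trans (length-upTo r) (eq r))))
      where
      eq : ∀ r → r ≡ 1 * r + 0
      eq = solve-∀
    each (_ , false) = ≤-trans (∑-≤-length (upTo r) _ (λ z → ≤-trans (∑-≤-length (upTo r) _ (λ z′ → 𝟙≤1 (0ℤ ℤ.≟ v))) (≤-reflexive (trans (*-identityʳ _) (length-upTo r)))))
      (≤-reflexive (trans (cong (_* r) (length-upTo r)) (sym (*-identityˡ (r * r)))))

  module _ {n : ℕ} (V : Subspace (suc n)) (i : Fin (suc n)) (unit∉V : ¬ unit i ∈ V) (1≤r₁ : 1 ≤ r₁) where

    private
      n′ : ℕ
      n′ = suc n
      coll : ℕ → Vec Slot n′ → ℕ
      coll l u = Image.collisions r₁ V u l

    weighted : (Slot → ℕ) → ℕ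
    weighted c = ∑ (allVecs U n′) (λ u → c (lookup u i) * coll 0 u)

    weighted-triples : ∀ c → weighted c ≡ ∑ (allVecs UZZ n′) (λ τ → c (proj₁ (lookup τ i)) * 𝟙 (Vec.map difference τ ∈? V))
    weighted-triples c = sym (begin
      ∑ (allVecs UZZ n′) F
        ≡⟨ ∑-allVecs-⊗ U (upTo r ⊗ upTo r) n′ F ⟩
      ∑ (allVecs U n′) (λ u → ∑ (allVecs (upTo r ⊗ upTo r) n′) (λ p → F (Vec.zip u p)))
        ≡⟨ ∑-cong (allVecs U n′) (λ u → ∑-allVecs-⊗ (upTo r) (upTo r) n′ _) ⟩
      ∑ (allVecs U n′) (λ u → ∑ (allVecs (upTo r) n′) (λ z → ∑ (allVecs (upTo r) n′) (λ z′ → F (Vec.zip u (Vec.zip z z′)))))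
        ≡⟨ ∑-cong (allVecs U n′) (λ u → trans (∑-cong (allVecs (upTo r) n′) (λ z → trans (∑-cong (allVecs (upTo r) n′) (λ z′ →
             cong (λ k → c (proj₁ k) * 𝟙 (Vec.map difference (Vec.zip u (Vec.zip z z′)) ∈? V)) (lookup-zip i u (Vec.zip z z′)))) (∑-*ˡ (c (lookup u i)) (allVecs (upTo r) n′) _)))
             (trans (∑-*ˡ (c (lookup u i)) (allVecs (upTo r) n′) _) (cong (c (lookup u i) *_) (sym (Image.collisions-0 r₁ V u))))) ⟩
      weighted c ∎)
      where
      open ≡-Reasoning
      F : Vec (Slot × ℕ × ℕ) n′ → ℕ
      F τ = c (proj₁ (lookup τ i)) * 𝟙 (Vec.map difference τ ∈? V)

    count-split : count (allVecs E′ n′) V ≡ weighted free + weighted blocked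
    count-split = trans (∑-allVecs-map difference UZZ n′ _) (trans (∑-cong (allVecs UZZ n′) (λ τ → split (proj₁ (lookup τ i)) (𝟙 (Vec.map difference τ ∈? V))))
      (trans (∑-distrib-+ (allVecs UZZ n′) _ _) (sym (cong₂ _+_ (weighted-triples free) (weighted-triples blocked)))))
      where
      split : ∀ u x → x ≡ free u * x + blocked u * x
      split (_ , true)  x = eq x
        where
        eq : ∀ x → x ≡ 1 * x + 0 * x
        eq = solve-∀
      split (_ , false) x = eq x
        where
        eq : ∀ x → x ≡ 0 * x + 1 * x
        eq = solve-∀

    -- Depends on the slot and the pieces at coordinate i only through the value x there, so blocked
    -- and free slots can be compared at the common value 0.
    slice : ℤ → ℕ
    slice x = ∑ (allVecs UZZ n) (λ τ → 𝟙 (insertAt (Vec.map difference τ) i x ∈? V))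

    weighted-slice : ∀ c → weighted c ≡ ∑ U (λ u → ∑ (upTo r) (λ z → ∑ (upTo r) (λ z′ → c u * slice (difference (u , z , z′)))))
    weighted-slice c = begin
      weighted c
        ≡⟨ trans (weighted-triples c) (∑-allVecs-insertAt UZZ n i _) ⟩
      ∑ UZZ (λ p → ∑ (allVecs UZZ n) (λ τ → c (proj₁ (lookup (insertAt τ i p) i)) * 𝟙 (Vec.map difference (insertAt τ i p) ∈? V)))
        ≡⟨ ∑-cong UZZ (λ p → trans (∑-cong (allVecs UZZ n) (λ τ → cong₂ (λ k v → c (proj₁ k) * 𝟙 (v ∈? V)) (insertAt-lookup τ i p) (map-insertAt difference p τ i))) (∑-*ˡ (c (proj₁ p)) (allVecs UZZ n) _)) ⟩
      ∑ UZZ (λ p → c (proj₁ p) * slice (difference p))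
        ≡⟨ trans (∑-⊗ U (upTo r ⊗ upTo r) _) (∑-cong U (λ u → ∑-⊗ (upTo r) (upTo r) _)) ⟩
      ∑ U (λ u → ∑ (upTo r) (λ z → ∑ (upTo r) (λ z′ → c u * slice (difference (u , z , z′))))) ∎
      where open ≡-Reasoning

    -- A blocked slot always contributes the value 0 at i, while a free slot does so on the diagonal
    -- z = z′, a proportion 1/r of its pairs. Slots are blocked and free in the ratio h : d, hence
    -- the constant h r / d.
    blocked≤free : d * weighted blocked ≤ h * r * weighted free
    blocked≤free = begin
      d * weighted blocked
        ≡⟨ cong (d *_) (trans (weighted-slice blocked) (∑-cong U (λ u → trans (∑-cong (upTo r) (λ z → trans (∑-cong (upTo r) (λ z′ → at-blocked u z z′)) (const-r _))) (const-r _)))) ⟩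
      d * ∑ U (λ u → r * (r * (blocked u * slice 0ℤ)))
        ≡⟨ cong (d *_) (trans (∑-*ˡ r U _) (cong (r *_) (trans (∑-*ˡ r U _) (cong (r *_) (trans (∑-*ʳ U blocked _) (cong (_* slice 0ℤ) ∑-blocked)))))) ⟩
      d * (r * (r * (R * h * slice 0ℤ)))
        ≡⟨ e₁ d r R h (slice 0ℤ) ⟩
      h * r * (r * (R * d * slice 0ℤ))
        ≡⟨ cong (h * r *_) (trans (∑-*ˡ r U _) (cong (r *_) (trans (∑-*ʳ U free _) (cong (_* slice 0ℤ) ∑-free)))) ⟨
      h * r * ∑ U (λ u → r * (free u * slice 0ℤ))
        ≡⟨ cong (h * r *_) (∑-cong U (λ u → trans (sym (const-r _)) (∑-cong (upTo r) (λ z → sym (at-free u z))))) ⟩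
      h * r * ∑ U (λ u → ∑ (upTo r) (λ z → free u * slice (difference (u , z , z))))
        ≤⟨ *-monoʳ-≤ (h * r) (∑-mono U (λ u → ∑-diagonal (upTo r) (λ z z′ → free u * slice (difference (u , z , z′))))) ⟩
      h * r * ∑ U (λ u → ∑ (upTo r) (λ z → ∑ (upTo r) (λ z′ → free u * slice (difference (u , z , z′)))))
        ≡⟨ cong (h * r *_) (weighted-slice free) ⟨
      h * r * weighted free ∎
      where
      open ≤-Reasoning
      const-r : ∀ c → ∑ (upTo r) (λ _ → c) ≡ r * c
      const-r c = trans (∑-const (upTo r) c) (cong (_* c) (length-upTo r))
      at-blocked : ∀ u z z′ → blocked u * slice (difference (u , z , z′)) ≡ blocked u * slice 0ℤ
      at-blocked (_ , true)  z z′ = refl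
      at-blocked (_ , false) z z′ = refl
      at-free : ∀ u z → free u * slice (difference (u , z , z)) ≡ free u * slice 0ℤ
      at-free (_ , true)  z = cong (λ k → 1 * slice k) (ℤₚ.+-inverseʳ (ℤ.+ z))
      at-free (_ , false) z = refl
      e₁ : ∀ d r R h s → d * (r * (r * (R * h * s))) ≡ h * r * (r * (R * d * s))
      e₁ = solve-∀

    -- Conditioning on the slots, each vector of slots free at i gains 89/90 at every doubling
    -- through `few-collisions` and `chain-strong`; one blocked at i has only `chain-weak`.
    comparison : 90 ^ l * (length (allVecs E′ n′) * count (allVecs (range m) n′) V)
      ≤ length (allVecs (range m) n′) * (89 ^ l * weighted free + 90 ^ l * weighted blocked)
    comparison = cancel-≤ (R ^ n′) (0<^ n′ 0<R) (begin
      R ^ n′ * (90 ^ l * (length (allVecs E′ n′) * X))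
        ≡⟨ cong (λ k → R ^ n′ * (90 ^ l * (k * X))) (trans (length-allVecs E′ n′) (trans (cong (_^ n′) length-E′) pow)) ⟩
      R ^ n′ * (90 ^ l * (R ^ n′ * N ^ n′ * (r ^ n′ * r ^ n′) * X))
        ≡⟨ e₁ (R ^ n′) (90 ^ l) (N ^ n′) (r ^ n′) X ⟩
      N ^ n′ * (90 ^ l * (R ^ n′ * R ^ n′ * X * (r ^ n′ * r ^ n′)))
        ≤⟨ *-monoʳ-≤ (N ^ n′) bound ⟩
      N ^ n′ * (R ^ n′ * (89 ^ l * weighted free + 90 ^ l * weighted blocked))
        ≡⟨ e₂ (N ^ n′) (R ^ n′) _ ⟩
      R ^ n′ * (N ^ n′ * (89 ^ l * weighted free + 90 ^ l * weighted blocked))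
        ≡⟨ cong (λ k → R ^ n′ * (k * (89 ^ l * weighted free + 90 ^ l * weighted blocked))) (sym (trans (length-allVecs (range m) n′) (cong (_^ n′) length-range))) ⟩
      R ^ n′ * (length (allVecs (range m) n′) * (89 ^ l * weighted free + 90 ^ l * weighted blocked)) ∎)
      where
      open ≤-Reasoning
      X = count (allVecs (range m) n′) V
      pow : (R * N * (r * r)) ^ n′ ≡ R ^ n′ * N ^ n′ * (r ^ n′ * r ^ n′)
      pow = trans (^-distribʳ-* n′ (R * N) (r * r)) (cong₂ _*_ (^-distribʳ-* n′ R N) (^-distribʳ-* n′ r r))
      e₁ : ∀ R p N s x → R * (p * (R * N * (s * s) * x)) ≡ N * (p * (R * R * x * (s * s)))
      e₁ = solve-∀
      e₂ : ∀ x y z → x * (y * z) ≡ y * (x * z)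
      e₂ = solve-∀
      size₀ : ∀ u → Image.size r₁ V u 0 ≡ r ^ n′
      size₀ u = trans (Image.size-sums r₁ V u 0) (cong (_^ n′) (length-upTo r))
      sizeₗ : ∀ u → Image.size r₁ V u l * Image.size r₁ V u l ≡ R ^ n′
      sizeₗ u = trans (sym (Image.size-suc r₁ V u l)) (Image.size-sums r₁ V u (suc l))
      per-slot : ∀ u → 90 ^ l * (coll l u * (r ^ n′ * r ^ n′)) ≤ R ^ n′ * (89 ^ l * (free (lookup u i) * coll 0 u) + 90 ^ l * (blocked (lookup u i) * coll 0 u))
      per-slot u with lookup u i in eq
      ... | _ , true = begin
        90 ^ l * (coll l u * (r ^ n′ * r ^ n′))        ≡⟨ cong (λ k → 90 ^ l * (coll l u * (k * k))) (size₀ u) ⟨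
        90 ^ l * (coll l u * (Image.size r₁ V u 0 * Image.size r₁ V u 0))
          ≤⟨ Image.chain-strong r₁ V u (few-collisions r₁ V u i unit∉V (cong proj₂ eq) 1≤r₁) l ⟩
        89 ^ l * (Image.size r₁ V u l * Image.size r₁ V u l * coll 0 u)  ≡⟨ cong (λ k → 89 ^ l * (k * coll 0 u)) (sizeₗ u) ⟩
        89 ^ l * (R ^ n′ * coll 0 u)                   ≡⟨ e₃ (89 ^ l) (R ^ n′) (coll 0 u) (90 ^ l) ⟩
        R ^ n′ * (89 ^ l * (1 * coll 0 u) + 90 ^ l * (0 * coll 0 u)) ∎
        where
        e₃ : ∀ p R c q → p * (R * c) ≡ R * (p * (1 * c) + q * (0 * c))
        e₃ = solve-∀
      ... | _ , false = begin
        90 ^ l * (coll l u * (r ^ n′ * r ^ n′))        ≡⟨ cong (λ k → 90 ^ l * (coll l u * (k * k))) (size₀ u) ⟨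
        90 ^ l * (coll l u * (Image.size r₁ V u 0 * Image.size r₁ V u 0))
          ≤⟨ *-monoʳ-≤ (90 ^ l) (Image.chain-weak r₁ V u l) ⟩
        90 ^ l * (Image.size r₁ V u l * Image.size r₁ V u l * coll 0 u)  ≡⟨ cong (λ k → 90 ^ l * (k * coll 0 u)) (sizeₗ u) ⟩
        90 ^ l * (R ^ n′ * coll 0 u)                   ≡⟨ e₃ (90 ^ l) (R ^ n′) (coll 0 u) (89 ^ l) ⟩
        R ^ n′ * (89 ^ l * (0 * coll 0 u) + 90 ^ l * (1 * coll 0 u)) ∎
        where
        e₃ : ∀ p R c q → p * (R * c) ≡ R * (q * (0 * c) + p * (1 * c))
        e₃ = solve-∀
      bound : 90 ^ l * (R ^ n′ * R ^ n′ * X * (r ^ n′ * r ^ n′)) ≤ R ^ n′ * (89 ^ l * weighted free + 90 ^ l * weighted blocked)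
      bound = begin
        90 ^ l * (R ^ n′ * R ^ n′ * X * (r ^ n′ * r ^ n′))
          ≡⟨ cong (λ k → 90 ^ l * (k * (r ^ n′ * r ^ n′))) (trans (cong (_* X) (sym (^-distribʳ-* n′ R R))) (sym (∑-allVecs-mixture n′ _))) ⟩
        90 ^ l * (∑ (allVecs U n′) (λ u → ∑ (allVecs S n′) (λ a → 𝟙 (zipWith place u a ∈? V))) * (r ^ n′ * r ^ n′))
          ≤⟨ *-monoʳ-≤ (90 ^ l) (*-monoˡ-≤ (r ^ n′ * r ^ n′) (∑-mono (allVecs U n′) (λ u → Image.∑-places≤collisions r₁ V u l))) ⟩
        90 ^ l * (∑ (allVecs U n′) (coll l) * (r ^ n′ * r ^ n′))
          ≡⟨ trans (cong (90 ^ l *_) (sym (∑-*ʳ (allVecs U n′) _ _))) (sym (∑-*ˡ (90 ^ l) (allVecs U n′) _)) ⟩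
        ∑ (allVecs U n′) (λ u → 90 ^ l * (coll l u * (r ^ n′ * r ^ n′)))
          ≤⟨ ∑-mono (allVecs U n′) per-slot ⟩
        ∑ (allVecs U n′) (λ u → R ^ n′ * (89 ^ l * (free (lookup u i) * coll 0 u) + 90 ^ l * (blocked (lookup u i) * coll 0 u)))
          ≡⟨ trans (∑-*ˡ (R ^ n′) (allVecs U n′) _) (cong (R ^ n′ *_) (trans (∑-distrib-+ (allVecs U n′) _ _) (cong₂ _+_ (∑-*ˡ (89 ^ l) (allVecs U n′) _) (∑-*ˡ (90 ^ l) (allVecs U n′) _)))) ⟩
        R ^ n′ * (89 ^ l * weighted free + 90 ^ l * weighted blocked) ∎

-- Exponential decay and choice of parameters

bernoulli : ∀ u k → u ^ k * (u + k) ≤ u * suc u ^ k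
bernoulli u zero    = ≤-reflexive (eq u)
  where
  eq : ∀ u → 1 * (u + 0) ≡ u * 1
  eq = solve-∀
bernoulli u (suc k) = begin
  u * u ^ k * (u + suc k)                ≤⟨ m≤m+n _ (u ^ k * k) ⟩
  u * u ^ k * (u + suc k) + u ^ k * k    ≡⟨ e₁ u k (u ^ k) ⟩
  suc u * (u ^ k * (u + k))              ≤⟨ *-monoʳ-≤ (suc u) (bernoulli u k) ⟩
  suc u * (u * suc u ^ k)                ≡⟨ e₂ u (suc u ^ k) ⟩
  u * (suc u * suc u ^ k)                ∎
  where
  open ≤-Reasoning
  e₁ : ∀ u k p → u * p * (u + suc k) + p * k ≡ suc u * (p * (u + k))
  e₁ = solve-∀
  e₂ : ∀ u p → suc u * (u * p) ≡ u * (suc u * p)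
  e₂ = solve-∀

exponential-growth : ∀ u c k → 0 < u → c * u ≤ k → c * u ^ k ≤ suc u ^ k
exponential-growth u c k 0<u cu≤k = cancel-≤ u 0<u (begin
  u * (c * u ^ k)      ≡⟨ eq u c (u ^ k) ⟩
  u ^ k * (c * u)      ≤⟨ *-monoʳ-≤ (u ^ k) (≤-trans cu≤k (m≤n+m k u)) ⟩
  u ^ k * (u + k)      ≤⟨ bernoulli u k ⟩
  u * suc u ^ k        ∎)
  where
  open ≤-Reasoning
  eq : ∀ u c p → u * (c * p) ≡ p * (c * u)
  eq = solve-∀

module _ (u : ℕ) (0<u : 0 < u) where

  private
    λ₀ K₀ τ₀ : ℕ
    -- `exponential-growth` with c = u³ makes this λ₀ large enough. K₀ = 2 (9 + λ₀) makes t = 2 (n /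
    -- K₀) satisfy (9 + λ₀) t ≤ n. τ₀ exceeds both 4K₀u², for `linear-decay`, and (u + 1) u, for
    -- `v*uᵗ≤vᵗ`.
    λ₀ = u ^ 3 * u
    K₀ = 18 + 2 * λ₀
    τ₀ = suc (4 * K₀ * u * u + suc u * u)

    λ₀-large : u ^ (3 + λ₀) ≤ suc u ^ λ₀
    λ₀-large = ≤-trans (≤-reflexive (^-distribˡ-+-* u 3 λ₀)) (exponential-growth u (u ^ 3) λ₀ 0<u ≤-refl)

    -- (b/a)^τ is at least the square of (1 + 1/u)^τ. By Bernoulli one factor is at least τ/u, and
    -- the other is at least 4K₀u.
    linear-decay : ∀ a b (0<a : 0 < a) (ratio : a * (suc u * suc u) ≤ b * (u * u)) τ → 4 * K₀ * u * u ≤ τ → 4 * K₀ * τ * a ^ τ ≤ b ^ τ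
    linear-decay a b 0<a ratio τ le = cancel-≤ (v * v) (*-mono-< (0<^ τ (s≤s z≤n)) (0<^ τ (s≤s z≤n))) (begin
      v * v * (4 * K₀ * τ * a ^ τ)             ≡⟨ e₁ (v * v) (4 * K₀) τ (a ^ τ) ⟩
      4 * K₀ * τ * (a ^ τ * (v * v))           ≤⟨ *-monoʳ-≤ (4 * K₀ * τ) (Ratio.^-ratio u a b 0<u 0<a ratio τ) ⟩
      4 * K₀ * τ * (b ^ τ * (x * x))           ≡⟨ e₂ (4 * K₀) τ (b ^ τ) x ⟩
      b ^ τ * (4 * K₀ * x) * (x * τ)           ≤⟨ *-monoʳ-≤ (b ^ τ * (4 * K₀ * x)) (≤-trans (*-monoʳ-≤ x (m≤n+m τ u)) (bernoulli u τ)) ⟩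
      b ^ τ * (4 * K₀ * x) * (u * v)           ≡⟨ e₃ (b ^ τ) (4 * K₀) x u v ⟩
      b ^ τ * v * (4 * K₀ * u * x)             ≤⟨ *-monoʳ-≤ (b ^ τ * v) (exponential-growth u (4 * K₀ * u) τ 0<u le) ⟩
      b ^ τ * v * v                            ≡⟨ e₄ (b ^ τ) v ⟩
      v * v * b ^ τ                            ∎)
      where
      open ≤-Reasoning
      v = suc u ^ τ
      x = u ^ τ
      e₁ : ∀ w k τ a → w * (k * τ * a) ≡ k * τ * (a * w)
      e₁ = solve-∀
      e₂ : ∀ k τ b x → k * τ * (b * (x * x)) ≡ b * (k * x) * (x * τ)
      e₂ = solve-∀
      e₃ : ∀ b k x u v → b * (k * x) * (u * v) ≡ b * v * (k * u * x)
      e₃ = solve-∀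
      e₄ : ∀ b v → b * v * v ≡ v * v * b
      e₄ = solve-∀

  exponent threshold : ℕ
  exponent  = 2 * K₀
  threshold = K₀ * τ₀

  0<threshold : 0 < threshold
  0<threshold = s≤s z≤n

  dependents-exponential : ∀ a b (0<a : 0 < a) (ratio : a * (suc u * suc u) ≤ b * (u * u)) →
    ∀ {n} (L L′ : List (Vec ℤ n)) → threshold ≤ n → 0 < length L′ →
    (∀ W → b ^ codim W * count L W ≤ a ^ codim W * length L) →
    (∀ W → b ^ codim W * count L′ W ≤ a ^ codim W * length L′) →
    (∀ W → dim W < n → b * b * count L W * length L′ ≤ a * a * count L′ W * length L) →
    b ^ n * dependents L (zeroSubspace n) n ^ exponent ≤ a ^ n * (length L ^ n) ^ exponent
  dependents-exponential a b 0<a ratio {n} L L′ n-large 0<T′ anticonc anticonc′ compare =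
    Ratio.shorten u a b 0<u 0<a ratio (D ^ exponent) (W ^ exponent) n≤ powers
    where
    open ≤-Reasoning
    τ = n / K₀
    -- One half of (a/b)^t absorbs the factor 2n, the other half is the bound (a/b)^τ. As n ≤ 2K₀τ,
    -- the power `exponent` = 2K₀ turns it into (a/b)^n.
    t = 2 * τ
    D = dependents L (zeroSubspace n) n
    W = length L ^ n
    n≡ : n ≡ n % K₀ + τ * K₀
    n≡ = m≡m%n+[m/n]*n n K₀
    n<K₀*[1+τ] : n < K₀ * suc τ
    n<K₀*[1+τ] = ≤-trans (s≤s (≤-reflexive n≡)) (≤-trans (+-monoˡ-≤ (τ * K₀) (m%n<n n K₀)) (≤-reflexive (eq K₀ τ)))
      where
      eq : ∀ k t → k + t * k ≡ k * suc t
      eq = solve-∀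
    τ₀≤τ : τ₀ ≤ τ
    τ₀≤τ = ≤-pred (*-cancelˡ-< K₀ τ₀ (suc τ) (≤-<-trans n-large n<K₀*[1+τ]))
    1≤τ : 1 ≤ τ
    1≤τ = ≤-trans (s≤s z≤n) τ₀≤τ
    n≤2K₀τ : n ≤ 2 * (K₀ * τ)
    n≤2K₀τ = ≤-trans (<⇒≤ n<K₀*[1+τ]) (≤-trans (*-monoʳ-≤ K₀ (+-monoˡ-≤ τ 1≤τ)) (≤-reflexive (eq K₀ τ)))
      where
      eq : ∀ k t → k * (t + t) ≡ 2 * (k * t)
      eq = solve-∀
    n≤ : n ≤ τ * exponent
    n≤ = ≤-trans n≤2K₀τ (≤-reflexive (eq K₀ τ))
      where
      eq : ∀ k t → 2 * (k * t) ≡ t * (2 * k)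
      eq = solve-∀
    v*uᵗ≤vᵗ : suc u * u ^ t ≤ suc u ^ t
    v*uᵗ≤vᵗ = exponential-growth u (suc u) t 0<u (≤-trans (≤-trans (≤-trans (m≤n+m (suc u * u) (4 * K₀ * u * u)) (n≤1+n _)) τ₀≤τ) (m≤m+n τ (τ + 0)))
    fits : (9 + λ₀) * t ≤ n
    fits = ≤-trans (≤-reflexive (eq λ₀ τ)) (≤-trans (m≤n+m (τ * K₀) (n % K₀)) (≤-reflexive (sym n≡)))
      where
      eq : ∀ l t → (9 + l) * (2 * t) ≡ t * (18 + 2 * l)
      eq = solve-∀
    small : b ^ t * D ≤ n * (2 * a ^ t) * W
    small = Ratio.dependents-small u a b 0<u 0<a ratio t λ₀ λ₀-large L L′ 0<T′ v*uᵗ≤vᵗ fits anticonc anticonc′ compare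
    2n*aᵗ≤bᵗ : 2 * n * a ^ τ ≤ b ^ τ
    2n*aᵗ≤bᵗ = ≤-trans (*-monoˡ-≤ (a ^ τ) (≤-trans (*-monoʳ-≤ 2 n≤2K₀τ) (≤-reflexive (eq K₀ τ))))
      (linear-decay a b 0<a ratio τ (≤-trans (≤-trans (m≤m+n (4 * K₀ * u * u) (suc u * u)) (n≤1+n _)) τ₀≤τ))
      where
      eq : ∀ k t → 2 * (2 * (k * t)) ≡ 4 * k * t
      eq = solve-∀
    double : ∀ m → m ^ t ≡ m ^ τ * m ^ τ
    double m = trans (^-distribˡ-+-* m τ (τ + 0)) (cong (λ k → m ^ τ * m ^ k) (+-identityʳ τ))
    smaller : b ^ τ * D ≤ a ^ τ * W
    smaller = cancel-≤ (b ^ τ) (0<^ τ (Ratio.0<b u a b 0<u 0<a ratio)) (begin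
      b ^ τ * (b ^ τ * D)              ≡⟨ *-assoc (b ^ τ) (b ^ τ) D ⟨
      b ^ τ * b ^ τ * D                ≡⟨ cong (_* D) (double b) ⟨
      b ^ t * D                        ≤⟨ small ⟩
      n * (2 * a ^ t) * W              ≡⟨ cong (λ k → n * (2 * k) * W) (double a) ⟩
      n * (2 * (a ^ τ * a ^ τ)) * W    ≡⟨ e₁ n (a ^ τ) W ⟩
      2 * n * a ^ τ * (a ^ τ * W)      ≤⟨ *-monoˡ-≤ (a ^ τ * W) 2n*aᵗ≤bᵗ ⟩
      b ^ τ * (a ^ τ * W)              ∎)
      where
      e₁ : ∀ n x w → n * (2 * (x * x)) * w ≡ 2 * n * x * (x * w)
      e₁ = solve-∀
    powers : b ^ (τ * exponent) * D ^ exponent ≤ a ^ (τ * exponent) * W ^ exponent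
    powers = subst₂ _≤_ (split b D) (split a W) (^-monoˡ-≤ exponent smaller)
      where
      split : ∀ m x → (m ^ τ * x) ^ exponent ≡ m ^ (τ * exponent) * x ^ exponent
      split m x = trans (^-distribʳ-* exponent (m ^ τ) x) (cong (_* x ^ exponent) (^-*-assoc m τ exponent))

-- A law of rows against which the uniform rows with entries in {-m,…,m} can be compared at ratio a/b.
record Comparison (m a b : ℕ) (n : ℕ) : Set where
  field
    L′        : List (Vec ℤ n)
    0<T′      : 0 < length L′
    anticonc  : ∀ W → b ^ codim W * count (allVecs (range m) n) W ≤ a ^ codim W * length (allVecs (range m) n)
    anticonc′ : ∀ W → b ^ codim W * count L′ W ≤ a ^ codim W * length L′
    compare   : ∀ W → dim W < n → b * b * count (allVecs (range m) n) W * length L′ ≤ a * a * count L′ W * length (allVecs (range m) n)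

comparison-from : ∀ r₁ l d m a b → (total : d + 2 ^ suc l * r₁ ≡ suc (2 * m)) → 1 ≤ r₁ →
  b ≤ a * suc (2 * m) →
  b * (2 ^ suc l * r₁ * suc r₁ + d) ≤ a * suc (2 * m) * suc r₁ →
  (∀ A B → d * B ≤ 2 ^ suc l * r₁ * suc r₁ * A → b * b * (89 ^ l * A + 90 ^ l * B) ≤ a * a * (90 ^ l * (A + B))) →
  ∀ n → Comparison m a b (suc n)
comparison-from r₁ l d m a b total 1≤r₁ atomˣ atomʸ gain n = record
  { L′        = allVecs E′ (suc n)
  ; 0<T′      = subst (0 <_) (sym (length-allVecs E′ (suc n))) (0<^ (suc n) (subst (0 <_) (sym length-E′)
      (*-mono-< (*-mono-< 0<R (subst (0 <_) (sym total) (s≤s z≤n))) (s≤s (z≤n {r₁ + r₁ * suc r₁})))))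
  ; anticonc  = λ W → ≤-trans (odlyzko a b (range m) (atom-range a b (subst (λ k → b ≤ a * k) (sym total) atomˣ)) W)
      (≤-reflexive (cong (a ^ codim W *_) (sym (length-allVecs (range m) (suc n)))))
  ; anticonc′ = λ W → ≤-trans (odlyzko a b E′ (atom-E′ a b (subst (λ k → b * (2 ^ suc l * r₁ * suc r₁ + d) ≤ a * k * suc r₁) (sym total) atomʸ)) W)
      (≤-reflexive (cong (a ^ codim W *_) (sym (length-allVecs E′ (suc n)))))
  ; compare   = compare
  }
  where
  open Mixture r₁ l d m total
  compare : ∀ W → dim W < suc n → b * b * count (allVecs (range m) (suc n)) W * length (allVecs E′ (suc n))
    ≤ a * a * count (allVecs E′ (suc n)) W * length (allVecs (range m) (suc n))
  compare W dW<n with unit-∉ W dW<n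
  ... | i , unit∉W = cancel-≤ (90 ^ l) (0<^ l (s≤s z≤n)) (begin
    90 ^ l * (b * b * X * T′)                     ≡⟨ e₁ (90 ^ l) (b * b) X T′ ⟩
    b * b * (90 ^ l * (T′ * X))                   ≤⟨ *-monoʳ-≤ (b * b) (comparison W i unit∉W 1≤r₁) ⟩
    b * b * (T * (89 ^ l * A + 90 ^ l * B))       ≡⟨ e₂ (b * b) T _ ⟩
    T * (b * b * (89 ^ l * A + 90 ^ l * B))       ≤⟨ *-monoʳ-≤ T (gain A B (blocked≤free W i unit∉W 1≤r₁)) ⟩
    T * (a * a * (90 ^ l * (A + B)))              ≡⟨ e₃ T (a * a) (90 ^ l) (A + B) ⟩
    90 ^ l * (a * a * (A + B) * T)                ≡⟨ cong (λ k → 90 ^ l * (a * a * k * T)) (count-split W i unit∉W 1≤r₁) ⟨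
    90 ^ l * (a * a * count (allVecs E′ (suc n)) W * T) ∎)
    where
    open ≤-Reasoning
    X = count (allVecs (range m) (suc n)) W
    T = length (allVecs (range m) (suc n))
    T′ = length (allVecs E′ (suc n))
    A = weighted W i unit∉W 1≤r₁ free
    B = weighted W i unit∉W 1≤r₁ blocked
    e₁ : ∀ p b x t → p * (b * x * t) ≡ b * (p * (t * x))
    e₁ = solve-∀
    e₂ : ∀ x y z → x * (y * z) ≡ y * (x * z)
    e₂ = solve-∀
    e₃ : ∀ t a p c → t * (a * (p * c)) ≡ p * (a * c * t)
    e₃ = solve-∀

-- Row laws for small and for large m

small-gain : ∀ P Q p q x y → Q * p + y ≡ P * q → P * q + x ≡ Q * q → 8 * x ≤ y → ∀ A B → B ≤ 8 * A →
  Q * (p * A + q * B) ≤ P * (q * (A + B))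
small-gain P Q p q x y e₁ e₂ 8x≤y A B B≤8A = begin
  Q * (p * A + q * B)                      ≡⟨ s₁ Q p A q B ⟩
  Q * p * A + Q * q * B                    ≡⟨ cong (λ k → Q * p * A + k * B) e₂ ⟨
  Q * p * A + (P * q + x) * B              ≡⟨ s₂ (Q * p * A) (P * q) x B ⟩
  Q * p * A + P * q * B + x * B            ≤⟨ +-monoʳ-≤ (Q * p * A + P * q * B) (≤-trans (*-monoʳ-≤ x B≤8A) (≤-trans (≤-reflexive (s₃ x A)) (*-monoˡ-≤ A 8x≤y))) ⟩
  Q * p * A + P * q * B + y * A            ≡⟨ s₄ (Q * p) A (P * q * B) y ⟩
  (Q * p + y) * A + P * q * B              ≡⟨ cong (λ k → k * A + P * q * B) e₁ ⟩
  P * q * A + P * q * B                    ≡⟨ s₅ P q A B ⟩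
  P * (q * (A + B))                        ∎
  where
  open ≤-Reasoning
  s₁ : ∀ Q p A q B → Q * (p * A + q * B) ≡ Q * p * A + Q * q * B
  s₁ = solve-∀
  s₂ : ∀ c r x B → c + (r + x) * B ≡ c + r * B + x * B
  s₂ = solve-∀
  s₃ : ∀ x A → x * (8 * A) ≡ 8 * x * A
  s₃ = solve-∀
  s₄ : ∀ c A r y → c * A + r + y * A ≡ (c + y) * A + r
  s₄ = solve-∀
  s₅ : ∀ P q A B → P * q * A + P * q * B ≡ P * (q * (A + B))
  s₅ = solve-∀

small-comparison : ∀ m → 2 ≤ m → ∀ n → Comparison m 1619 1620 (suc n)
-- Four pieces on {0,1} give h = 4, r = 2 and d = 2m - 3 ≥ 1, so B ≤ 8A. The free part is at least
-- 1/9 of the total, its gain of 1/90 amounts to 1/810 overall, and this allows two factors 1 -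
-- 1/1620. The numbers 291510 and 2332890 are the differences Qq - Pq and Pq - Qp.
small-comparison (suc (suc k)) (s≤s (s≤s z≤n)) = comparison-from 1 1 (suc (2 * k)) (suc (suc k)) 1619 1620 (eq k) (s≤s z≤n) atomˣ atomʸ
  (λ A B h → small-gain (1619 * 1619) (1620 * 1620) (89 ^ 1) (90 ^ 1) 291510 2332890 refl refl (from-yes (8 * 291510 ≤? 2332890)) A B
    (≤-trans (m≤m+n B (2 * k * B)) h))
  where
  eq : ∀ k → suc (2 * k) + 4 ≡ suc (2 * suc (suc k))
  eq = solve-∀
  five : 5 ≤ suc (2 * suc (suc k))
  five = s≤s (*-monoʳ-≤ 2 (s≤s (s≤s (z≤n {k}))))
  atomˣ : 1620 ≤ 1619 * suc (2 * suc (suc k))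
  atomˣ = ≤-trans (from-yes (1620 ≤? 1619 * 5)) (*-monoʳ-≤ 1619 five)
  atomʸ : 1620 * (8 + suc (2 * k)) ≤ 1619 * suc (2 * suc (suc k)) * 2
  atomʸ = lemma 1619 1620 (from-yes (1620 * 9 ≤? 1619 * 10)) (from-yes (1620 * 2 ≤? 1619 * 4))
    where
    lemma : ∀ a b → b * 9 ≤ a * 10 → b * 2 ≤ a * 4 → b * (8 + suc (2 * k)) ≤ a * suc (2 * suc (suc k)) * 2
    lemma a b h₁ h₂ = ≤-trans (≤-reflexive (l₁ b k)) (≤-trans (+-mono-≤ h₁ (*-monoˡ-≤ k h₂)) (≤-reflexive (l₂ a k)))
      where
      l₁ : ∀ b k → b * (8 + suc (2 * k)) ≡ b * 9 + b * 2 * k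
      l₁ = solve-∀
      l₂ : ∀ a k → a * 10 + a * 4 * k ≡ a * suc (2 * suc (suc k)) * 2
      l₂ = solve-∀

-- Put ρ = P/Q, so that p/q ≤ ρ². Then ρ²A + B ≤ ρ(A + B) amounts to (1 - ρ)B ≤ (1 - ρ)ρA, which is
-- where Q * B ≤ P * A enters. Half of the exponent of the gain is spent on the blocked part.
large-gain : ∀ P Q p q A B → 0 < Q → P ≤ Q → p * (Q * Q) ≤ q * (P * P) → Q * B ≤ P * A →
  Q * (p * A + q * B) ≤ P * (q * (A + B))
large-gain P Q p q A B 0<Q P≤Q pQ²≤qP² QB≤PA = cancel-≤ Q 0<Q (begin
  Q * (Q * (p * A + q * B))                      ≡⟨ s₁ Q p A q B ⟩
  p * (Q * Q) * A + q * (Q * Q * B)              ≤⟨ +-monoˡ-≤ (q * (Q * Q * B)) (*-monoˡ-≤ A pQ²≤qP²) ⟩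
  q * (P * P) * A + q * (Q * Q * B)              ≡⟨ s₂ q P A Q B ⟩
  q * (P * P * A + Q * Q * B)                    ≤⟨ *-monoʳ-≤ q (subst (λ k → P * P * A + k * k * B ≤ P * k * (A + B)) (m+[n∸m]≡n P≤Q) (mix (Q ∸ P) (subst (λ k → k * B ≤ P * A) (sym (m+[n∸m]≡n P≤Q)) QB≤PA))) ⟩
  q * (P * Q * (A + B))                          ≡⟨ s₃ q P Q (A + B) ⟩
  Q * (P * (q * (A + B)))                        ∎)
  where
  open ≤-Reasoning
  s₁ : ∀ Q p A q B → Q * (Q * (p * A + q * B)) ≡ p * (Q * Q) * A + q * (Q * Q * B)
  s₁ = solve-∀
  s₂ : ∀ q P A Q B → q * (P * P) * A + q * (Q * Q * B) ≡ q * (P * P * A + Q * Q * B)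
  s₂ = solve-∀
  s₃ : ∀ q P Q c → q * (P * Q * c) ≡ Q * (P * (q * c))
  s₃ = solve-∀
  mix : ∀ δ → (P + δ) * B ≤ P * A → P * P * A + (P + δ) * (P + δ) * B ≤ P * (P + δ) * (A + B)
  mix δ h = begin
    P * P * A + (P + δ) * (P + δ) * B                 ≡⟨ t₁ P A δ B ⟩
    P * P * A + P * (P + δ) * B + δ * ((P + δ) * B)   ≤⟨ +-monoʳ-≤ (P * P * A + P * (P + δ) * B) (*-monoʳ-≤ δ h) ⟩
    P * P * A + P * (P + δ) * B + δ * (P * A)         ≡⟨ t₂ P A δ B ⟩
    P * (P + δ) * (A + B)                             ∎
    where
    t₁ : ∀ P A δ B → P * P * A + (P + δ) * (P + δ) * B ≡ P * P * A + P * (P + δ) * B + δ * ((P + δ) * B)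
    t₁ = solve-∀
    t₂ : ∀ P A δ B → P * P * A + P * (P + δ) * B + δ * (P * A) ≡ P * (P + δ) * (A + B)
    t₂ = solve-∀

module Large (j m : ℕ) (1≤j : 1 ≤ j) (4*64ʲ≤N : 4 * 64 ^ j ≤ suc (2 * m)) where

  private
    N p c a b r₁ h d : ℕ
    N = suc (2 * m)
    -- The 2p pieces of range p² - 1 spread over h ≤ 2p³ = 2c, while N ≥ 4c² leaves d ≥ 2c². Hence h
    -- r / d is at most p²/c = 1/p, and the blocked part satisfies pB ≤ A.
    p = 2 ^ j
    c = p * p * p
    -- 360 = 4 · 90, so four factors 359/360 are still at least 89/90: the comparison asks for two,
    -- and `large-gain` doubles them.
    a = 359 ^ j
    b = 360 ^ j
    r₁ = p * p ∸ 1
    h = 2 ^ suc j * r₁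
    d = N ∸ h

    2≤p : 2 ≤ p
    2≤p = ^-monoʳ-≤ 2 1≤j

    0<p : 0 < p
    0<p = ≤-trans (s≤s z≤n) 2≤p

    0<c : 0 < c
    0<c = *-mono-< (*-mono-< 0<p 0<p) 0<p

    4≤p*p : 4 ≤ p * p
    4≤p*p = *-mono-≤ 2≤p 2≤p

    suc-r₁ : suc r₁ ≡ p * p
    suc-r₁ = m+[n∸m]≡n {1} {p * p} (≤-trans (s≤s z≤n) 4≤p*p)

    1≤r₁ : 1 ≤ r₁
    1≤r₁ = ≤-pred (≤-trans (≤-trans (s≤s (s≤s z≤n)) 4≤p*p) (≤-reflexive (sym suc-r₁)))

    64ʲ : 64 ^ j ≡ c * c
    64ʲ = trans (^-distribʳ-* j 8 8) (cong (λ k → k * k) (trans (^-distribʳ-* j 4 2) (cong (_* p) (^-distribʳ-* j 2 2))))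

    4cc≤N : 4 * (c * c) ≤ N
    4cc≤N = subst (λ k → 4 * k ≤ N) 64ʲ 4*64ʲ≤N

    h≤2c : h ≤ 2 * c
    h≤2c = ≤-trans (*-monoʳ-≤ (2 * p) (≤-trans (n≤1+n r₁) (≤-reflexive suc-r₁))) (≤-reflexive (eq p))
      where
      eq : ∀ p → 2 * p * (p * p) ≡ 2 * (p * p * p)
      eq = solve-∀

    2cc+h≤N : 2 * (c * c) + h ≤ N
    2cc+h≤N = ≤-trans (+-monoʳ-≤ (2 * (c * c)) (≤-trans h≤2c (*-monoʳ-≤ 2 (≤-trans (≤-reflexive (sym (*-identityˡ c))) (*-monoˡ-≤ c 0<c)))))
      (≤-trans (≤-reflexive (eq (c * c))) 4cc≤N)
      where
      eq : ∀ x → 2 * x + 2 * x ≡ 4 * x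
      eq = solve-∀

    total : d + h ≡ N
    total = m∸n+n≡m (m+n≤o⇒n≤o (2 * (c * c)) 2cc+h≤N)

    2cc≤d : 2 * (c * c) ≤ d
    2cc≤d = m+n≤o⇒m≤o∸n (2 * (c * c)) 2cc+h≤N

    hr≤ : h * suc r₁ ≤ 2 * c * (p * p)
    hr≤ = *-mono-≤ h≤2c (≤-reflexive suc-r₁)

    b≤a*p : b ≤ a * p
    b≤a*p = ≤-trans (^-monoˡ-≤ j (from-yes (360 ≤? 359 * 2))) (≤-reflexive (^-distribʳ-* j 359 2))

    p*p≤c : p * p ≤ c
    p*p≤c = ≤-trans (≤-reflexive (sym (*-identityʳ (p * p)))) (*-monoʳ-≤ (p * p) 0<p)

    p≤N : p ≤ N
    p≤N = ≤-trans (≤-trans (≤-reflexive (sym (*-identityˡ p))) (*-monoˡ-≤ p 0<p)) (≤-trans p*p≤c (≤-trans (≤-trans (≤-reflexive (sym (*-identityˡ c))) (*-monoˡ-≤ c 0<c))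
      (≤-trans (≤-trans (≤-reflexive (sym (*-identityˡ (c * c)))) (*-monoˡ-≤ (c * c) (s≤s (z≤n {3})))) 4cc≤N)))

    hr+d≤N*p : h * suc r₁ + d ≤ N * p
    hr+d≤N*p = ≤-trans (+-mono-≤ (≤-trans hr≤ (≤-trans (*-monoʳ-≤ (2 * c) p*p≤c) (≤-trans (≤-reflexive (*-assoc 2 c c)) (≤-trans 2cc≤d (m∸n≤m N h))))) (m∸n≤m N h))
      (≤-trans (≤-reflexive (eq N)) (*-monoʳ-≤ N 2≤p))
      where
      eq : ∀ x → x + x ≡ x * 2
      eq = solve-∀

    atomʸ : b * (h * suc r₁ + d) ≤ a * N * suc r₁
    atomʸ = ≤-trans (*-mono-≤ b≤a*p hr+d≤N*p) (≤-reflexive (trans (eq a p N) (cong (a * N *_) (sym suc-r₁))))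
      where
      eq : ∀ a p N → a * p * (N * p) ≡ a * N * (p * p)
      eq = solve-∀

    gain : ∀ A B → d * B ≤ h * suc r₁ * A → b * b * (89 ^ j * A + 90 ^ j * B) ≤ a * a * (90 ^ j * (A + B))
    gain A B dB≤ = large-gain (a * a) (b * b) (89 ^ j) (90 ^ j) A B (*-mono-< (0<^ j (s≤s z≤n)) (0<^ j (s≤s z≤n))) (*-mono-≤ a≤b a≤b) quartic QB≤PA
      where
      a≤b : a ≤ b
      a≤b = ^-monoˡ-≤ j (n≤1+n 359)
      pB≤A : p * B ≤ A
      pB≤A = cancel-≤ (2 * c * (p * p)) (*-mono-< (*-mono-< (s≤s (z≤n {1})) 0<c) (*-mono-< 0<p 0<p)) (begin
        2 * c * (p * p) * (p * B)      ≡⟨ eq c p B ⟩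
        2 * (c * (p * p * p)) * B      ≤⟨ *-monoˡ-≤ B 2cc≤d ⟩
        d * B                          ≤⟨ dB≤ ⟩
        h * suc r₁ * A                 ≤⟨ *-monoˡ-≤ A hr≤ ⟩
        2 * c * (p * p) * A            ∎)
        where
        open ≤-Reasoning
        eq : ∀ c p B → 2 * c * (p * p) * (p * B) ≡ 2 * (c * (p * p * p)) * B
        eq = solve-∀
      QB≤PA : b * b * B ≤ a * a * A
      QB≤PA = ≤-trans (*-monoˡ-≤ B bb≤aap) (≤-trans (≤-reflexive (*-assoc (a * a) p B)) (*-monoʳ-≤ (a * a) pB≤A))
        where
        bb≤aap : b * b ≤ a * a * p
        bb≤aap = subst₂ _≤_ (^-distribʳ-* j 360 360) (trans (^-distribʳ-* j (359 * 359) 2) (cong (_* p) (^-distribʳ-* j 359 359)))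
          (^-monoˡ-≤ j (from-yes (360 * 360 ≤? 359 * 359 * 2)))
      quartic : 89 ^ j * (b * b * (b * b)) ≤ 90 ^ j * (a * a * (a * a))
      quartic = subst₂ _≤_ (expand 89 360) (expand 90 359) (^-monoˡ-≤ j (from-yes (89 * (360 * 360 * (360 * 360)) ≤? 90 * (359 * 359 * (359 * 359)))))
        where
        expand : ∀ x y → (x * (y * y * (y * y))) ^ j ≡ x ^ j * (y ^ j * y ^ j * (y ^ j * y ^ j))
        expand x y = trans (^-distribʳ-* j x (y * y * (y * y))) (cong (x ^ j *_) (trans (^-distribʳ-* j (y * y) (y * y)) (cong (λ k → k * k) (^-distribʳ-* j y y))))

  large-comparison : ∀ n → Comparison m a b (suc n)
  large-comparison = comparison-from r₁ j d m a b total 1≤r₁ (≤-trans b≤a*p (*-monoʳ-≤ a p≤N)) atomʸ gain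

-- A discrete logarithm: c w + k is rounded down to c times a power of w. The recursion runs on the
-- excess k over the least admissible value.
scale : ∀ c w → 0 < c → 1 < w → ∀ k → Σ ℕ λ j → 1 ≤ j × c * w ^ j ≤ c * w + k × c * w + k < c * w ^ suc j
scale c w 0<c 1<w zero = 1 , ≤-refl , ≤-reflexive (trans (cong (c *_) (*-identityʳ w)) (sym (+-identityʳ (c * w)))) ,
  subst (_< c * w ^ 2) (trans (cong (c *_) (*-identityʳ w)) (sym (+-identityʳ (c * w)))) (*-monoʳ-< c {{ℕ.>-nonZero 0<c}} (^-monoʳ-< w 1<w (n<1+n 1)))
scale c w 0<c 1<w (suc k) with scale c w 0<c 1<w k
... | j , 1≤j , lo , hi with c * w + suc k <? c * w ^ suc j
...   | yes hi′ = j , 1≤j , ≤-trans lo (+-monoʳ-≤ (c * w) (n≤1+n k)) , hi′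
...   | no ¬hi  = suc j , s≤s z≤n , ≮⇒≥ ¬hi ,
          ≤-<-trans (≤-trans (≤-reflexive (+-suc (c * w) k)) hi) (*-monoʳ-< c {{ℕ.>-nonZero 0<c}} (^-monoʳ-< w 1<w (n<1+n (suc j))))

-- u and C are meant to be the same for all m. `size` makes a/b at most m^(-1/C), while `ratio` asks
-- only for the fixed gain (1 + 1/u)², so the threshold on n derived from u does not grow with m.
record Law (u C m : ℕ) : Set where
  field
    a b        : ℕ
    0<a        : 0 < a
    ratio      : a * (suc u * suc u) ≤ b * (u * u)
    size       : m * a ^ C ≤ b ^ C
    comparison : ∀ n → Comparison m a b (suc n)

ratio-power : ∀ x y p q → x * p ≤ y * q → x ≤ y → ∀ j → 1 ≤ j → x ^ j * p ≤ y ^ j * q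
ratio-power x y p q xp≤yq x≤y (suc k) _ = subst₂ _≤_ (shuffle x p (x ^ k)) (shuffle y q (y ^ k)) (*-mono-≤ xp≤yq (^-monoˡ-≤ k x≤y))
  where
  shuffle : ∀ x y z → x * y * z ≡ x * z * y
  shuffle = solve-∀

size-power : ∀ x y c C j {m} → m ≤ c ^ j → c * x ^ C ≤ y ^ C → m * (x ^ j) ^ C ≤ (y ^ j) ^ C
size-power x y c C j m≤ growth = ≤-trans (*-mono-≤ m≤ (≤-reflexive (swap-exponents x))) (≤-trans (≤-reflexive (sym (^-distribʳ-* j c (x ^ C))))
  (≤-trans (^-monoˡ-≤ j growth) (≤-reflexive (sym (swap-exponents y)))))
  where
  swap-exponents : ∀ x → (x ^ j) ^ C ≡ (x ^ C) ^ j
  swap-exponents x = trans (^-*-assoc x j C) (trans (cong (x ^_) (*-comm j C)) (sym (^-*-assoc x C j)))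

upper-power : ∀ c w j → 0 < c * w → 1 ≤ j → c * w ^ suc j ≤ (c * w * w) ^ j
upper-power c w j 0<cw 1≤j = ≤-trans (≤-reflexive (sym (*-assoc c w (w ^ j)))) (≤-trans
  (*-monoˡ-≤ (w ^ j) (≤-trans (≤-reflexive (sym (*-identityʳ (c * w)))) (^-monoʳ-≤ (c * w) {{ℕ.>-nonZero 0<cw}} 1≤j)))
  (≤-reflexive (sym (^-distribʳ-* j (c * w) w))))

m≤1+2m : ∀ m → m ≤ suc (2 * m)
m≤1+2m m = ≤-trans (m≤m+n m (m + 0)) (n≤1+n (2 * m))

law : ∀ C → 16384 * 359 ≤ C → 256 * 1619 ≤ C → ∀ m → 2 ≤ m → Law 3240 C m
law C C₁ C₂ m 2≤m with 256 ≤? ℕ.suc (2 * m)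
... | no N<256 = record
  { a = 1619 ; b = 1620 ; 0<a = s≤s z≤n
  ; ratio = from-yes (1619 * (3241 * 3241) ≤? 1620 * (3240 * 3240))
  ; size = growth 256 1619 1620 (≤-trans (m≤1+2m m) (<⇒≤ (≰⇒> N<256))) (exponential-growth 1619 256 C (s≤s z≤n) C₂)
  ; comparison = small-comparison m 2≤m }
  where
  growth : ∀ c x y → m ≤ c → c * x ^ C ≤ y ^ C → m * x ^ C ≤ y ^ C
  growth c x y m≤c le = ≤-trans (*-monoˡ-≤ (x ^ C) m≤c) le
... | yes 256≤N with scale 4 64 (s≤s z≤n) (s≤s (s≤s z≤n)) (ℕ.suc (2 * m) ∸ 256)
...   | j , 1≤j , lo , hi = record
  { a = 359 ^ j ; b = 360 ^ j ; 0<a = 0<^ j (s≤s z≤n)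
  ; ratio = ratio-power 359 360 (3241 * 3241) (3240 * 3240) (from-yes (359 * (3241 * 3241) ≤? 360 * (3240 * 3240))) (n≤1+n 359) j 1≤j
  -- 16384 = 4 · 64 · 64: since j ≥ 1, the bound m < 4 · 64^(j+1) is at most 16384^j.
  ; size = size-power 359 360 16384 C j
      (≤-trans (m≤1+2m m) (≤-trans (<⇒≤ (subst (_< 4 * 64 ^ ℕ.suc j) N≡ hi)) (upper-power 4 64 j (s≤s z≤n) 1≤j)))
      (exponential-growth 359 16384 C (s≤s z≤n) C₁)
  ; comparison = Large.large-comparison j m 1≤j (subst (4 * 64 ^ j ≤_) N≡ lo) }
  where
  N≡ : 256 + (ℕ.suc (2 * m) ∸ 256) ≡ ℕ.suc (2 * m)
  N≡ = m+[n∸m]≡n 256≤N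

-- Crude bound and conclusion

length-range : ∀ m → length (range m) ≡ suc (2 * m)
length-range m = trans (length-map _ (upTo (suc (2 * m)))) (length-upTo (suc (2 * m)))

-- Odlyzko's bound with atoms of probability 1/N bounds row i by N^(i-n), and the geometric series
-- is at most 1/(N - 1) = 1/(2m).
dependents-crude : ∀ n m → 2 * m * dependents (allVecs (range m) n) (zeroSubspace n) n ≤ length (allVecs (range m) n) ^ n
dependents-crude n m = cancel-≤ (N ^ n) (0<^ n (s≤s z≤n)) (begin
  N ^ n * (2 * m * D)               ≡⟨ e₁ (N ^ n) (2 * m) D ⟩
  2 * m * (N ^ n * D)               ≤⟨ *-monoʳ-≤ (2 * m) (dependents-bound L Z n (N ^ n) (N ^_) extension) ⟩
  2 * m * (∑< n (N ^_) * T ^ n)     ≡⟨ *-assoc (2 * m) _ (T ^ n) ⟨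
  2 * m * ∑< n (N ^_) * T ^ n       ≤⟨ *-monoˡ-≤ (T ^ n) (≤-trans (n≤1+n _) (≤-reflexive (geometric n))) ⟩
  N ^ n * T ^ n                     ∎)
  where
  open ≤-Reasoning
  N : ℕ
  N = suc (2 * m)
  L = allVecs (range m) n
  Z = zeroSubspace n
  T = length L
  D = dependents L Z n
  e₁ : ∀ x y z → x * (y * z) ≡ y * (x * z)
  e₁ = solve-∀
  geometric : ∀ n → suc (2 * m * ∑< n (N ^_)) ≡ N ^ n
  geometric zero    = cong suc (*-zeroʳ (2 * m))
  geometric (suc n) = trans (cong (λ k → suc (2 * m * suc k)) (∑<-*ˡ N n (N ^_))) (trans (e₂ (2 * m) (∑< n (N ^_))) (cong (N *_) (geometric n)))
    where
    e₂ : ∀ k s → suc (k * suc (suc k * s)) ≡ suc k * suc (k * s)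
    e₂ = solve-∀
  counts : ∀ W → N ^ codim W * count L W ≤ T
  counts W = ≤-trans (odlyzko 1 N (range m) atom W) (≤-reflexive (trans (cong₂ _*_ (^-zeroˡ (codim W)) (sym (length-allVecs (range m) n))) (*-identityˡ T)))
    where
    atom : ∀ v → N * ∑ (range m) (λ y → 𝟙 (y ℤ.≟ v)) ≤ 1 * length (range m)
    -- The degenerate mixture with h = 0 and d = N supplies the atom bound 1/N.
    atom v = Mixture.atom-range 0 0 N m (+-identityʳ N) 1 N (≤-reflexive (trans (sym (+-identityʳ N)) (sym (*-identityˡ (N + 0))))) v
  extension : ∀ i → i < n → N ^ n * extensions L Z i ≤ N ^ i * T ^ suc i
  extension i i<n = begin
    N ^ n * extensions L Z i                                                ≡⟨ ∑-*ˡ (N ^ n) (allVecs L i) _ ⟨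
    ∑ (allVecs L i) (λ xs → N ^ n * (independent Z xs * count L (span Z xs)))  ≤⟨ ∑-≤-length (allVecs L i) _ each ⟩
    length (allVecs L i) * (N ^ i * T)                                      ≡⟨ cong (_* (N ^ i * T)) (length-allVecs L i) ⟩
    T ^ i * (N ^ i * T)                                                     ≡⟨ e₃ (T ^ i) (N ^ i) T ⟩
    N ^ i * (T * T ^ i)                                                     ∎
    where
    e₃ : ∀ x y z → x * (y * z) ≡ y * (z * x)
    e₃ = solve-∀
    each : ∀ (xs : Vec (Vec ℤ n) i) → N ^ n * (independent Z xs * count L (span Z xs)) ≤ N ^ i * T
    each xs with dim (span Z xs) ℕ.≟ dim Z + i
    ... | no _  = ≤-trans (≤-reflexive (*-zeroʳ (N ^ n))) z≤n
    ... | yes e = begin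
      N ^ n * (1 * count L V)                ≡⟨ cong₂ _*_ (trans (cong (N ^_) n≡) (^-distribˡ-+-* N i (codim V))) (*-identityˡ (count L V)) ⟩
      N ^ i * N ^ codim V * count L V        ≡⟨ *-assoc (N ^ i) (N ^ codim V) (count L V) ⟩
      N ^ i * (N ^ codim V * count L V)      ≤⟨ *-monoʳ-≤ (N ^ i) (counts V) ⟩
      N ^ i * T                              ∎
      where
      V = span Z xs
      n≡ : n ≡ i + codim V
      n≡ = trans (sym (dim+codim V)) (cong (_+ codim V) (trans e (cong (_+ i) (dim-zeroSubspace n))))

singularCount-≤ : ∀ n m → singularCount n m ≤ dependents (allVecs (range m) n) (zeroSubspace n) n
singularCount-≤ n m = ≤-trans (≤-reflexive (length-filter-∑ _ (allMatrices n m))) (∑-mono (allMatrices n m) (λ M →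
  𝟙-mono (det (toMatrix M) ℤ.≟ 0ℤ) (dim (span (zeroSubspace n) M) <? dim (zeroSubspace n) + n)
    (λ e → <-≤-trans (singular⇒dependent M e) (m≤n+m n _))))

singularCount-≤-all : ∀ n m → singularCount n m ≤ length (allVecs (range m) n) ^ n
singularCount-≤-all n m = ≤-trans (≤-reflexive (length-filter-∑ _ (allMatrices n m))) (≤-trans (∑-≤-length (allMatrices n m) _ (λ M → 𝟙≤1 (det (toMatrix M) ℤ.≟ 0ℤ)))
  (≤-reflexive (trans (*-identityʳ _) (length-allVecs (allVecs (range m) n) n))))

-- For n below the threshold the crude bound 1/m suffices, because n is then bounded.
conclude : ∀ u (0<u : 0 < u) C → (∀ m → 2 ≤ m → Law u C m) → Σ ℕ λ p → Σ ℕ λ q → 0 < p × 0 < q ×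
  ((n m : ℕ) → 1 ≤ n → 1 ≤ m → singularCount n m ^ q * m ^ (p * n) ≤ (2 * m + 1) ^ (n * n * q))
conclude u 0<u C laws = 1 , Q , s≤s z≤n , ≤-trans (0<threshold u 0<u) (m≤n+m n₀ (e * C)) , bound
  where
  open ≤-Reasoning
  e = exponent u 0<u
  n₀ = threshold u 0<u
  -- The resulting c is 1/Q. The summand e * C serves n ≥ n₀ and the summand n₀ serves n < n₀; in
  -- each case the surplus power is bounded trivially by s ≤ W.
  Q = e * C + n₀
  final : ∀ n m → length (allVecs (range m) n) ^ n ≡ (2 * m + 1) ^ (n * n)
  final n m = trans (cong (_^ n) (trans (length-allVecs (range m) n) (cong (_^ n) (trans (length-range m) (+-comm 1 (2 * m)))))) (^-*-assoc (2 * m + 1) n n)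
  bound : (n m : ℕ) → 1 ≤ n → 1 ≤ m → singularCount n m ^ Q * m ^ (1 * n) ≤ (2 * m + 1) ^ (n * n * Q)
  bound n@(suc k) m _ 1≤m = begin
    s ^ Q * m ^ (1 * n)              ≡⟨ cong (λ i → s ^ Q * m ^ i) (*-identityˡ n) ⟩
    s ^ Q * m ^ n                    ≤⟨ main (2 ≤? m) (n₀ ≤? n) ⟩
    W ^ Q                            ≡⟨ trans (cong (_^ Q) (final n m)) (^-*-assoc (2 * m + 1) (n * n) Q) ⟩
    (2 * m + 1) ^ (n * n * Q)        ∎
    where
    s = singularCount n m
    L = allVecs (range m) n
    W = length L ^ n
    D = dependents L (zeroSubspace n) n
    s≤W : s ≤ W
    s≤W = singularCount-≤-all n m
    split : ∀ x → x ^ Q ≡ x ^ (e * C) * x ^ n₀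
    split x = ^-distribˡ-+-* x (e * C) n₀
    shuffle : ∀ x y z → x * y * z ≡ x * z * y
    shuffle = solve-∀
    main : Dec (2 ≤ m) → Dec (n₀ ≤ n) → s ^ Q * m ^ n ≤ W ^ Q
    main (no ¬2≤m) _ = begin
      s ^ Q * m ^ n    ≡⟨ cong (λ i → s ^ Q * i ^ n) (≤-antisym (≤-pred (≰⇒> ¬2≤m)) 1≤m) ⟩
      s ^ Q * 1 ^ n    ≡⟨ trans (cong (s ^ Q *_) (^-zeroˡ n)) (*-identityʳ (s ^ Q)) ⟩
      s ^ Q            ≤⟨ ^-monoˡ-≤ Q s≤W ⟩
      W ^ Q            ∎
    main (yes _) (no n<n₀) = begin
      s ^ Q * m ^ n                          ≡⟨ trans (cong (_* m ^ n) (split s)) (*-assoc (s ^ (e * C)) (s ^ n₀) (m ^ n)) ⟩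
      s ^ (e * C) * (s ^ n₀ * m ^ n)         ≤⟨ *-mono-≤ (^-monoˡ-≤ (e * C) s≤W) (*-monoʳ-≤ (s ^ n₀) (^-monoʳ-≤ m {{ℕ.>-nonZero 1≤m}} (<⇒≤ (≰⇒> n<n₀)))) ⟩
      W ^ (e * C) * (s ^ n₀ * m ^ n₀)        ≡⟨ cong (W ^ (e * C) *_) (^-distribʳ-* n₀ s m) ⟨
      W ^ (e * C) * (s * m) ^ n₀             ≤⟨ *-monoʳ-≤ (W ^ (e * C)) (^-monoˡ-≤ n₀ sm≤W) ⟩
      W ^ (e * C) * W ^ n₀                   ≡⟨ split W ⟨
      W ^ Q                                  ∎
      where
      sm≤W : s * m ≤ W
      sm≤W = ≤-trans (≤-reflexive (*-comm s m)) (≤-trans (*-mono-≤ (m≤m+n m (m + 0)) (singularCount-≤ n m)) (dependents-crude n m))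
    main (yes 2≤m) (yes n₀≤n) = begin
      s ^ Q * m ^ n                          ≡⟨ trans (cong (_* m ^ n) (split s)) (shuffle (s ^ (e * C)) (s ^ n₀) (m ^ n)) ⟩
      s ^ (e * C) * m ^ n * s ^ n₀           ≤⟨ *-mono-≤ core (^-monoˡ-≤ n₀ s≤W) ⟩
      W ^ (e * C) * W ^ n₀                   ≡⟨ split W ⟨
      W ^ Q                                  ∎
      where
      open Law (laws m 2≤m)
      open Comparison (comparison k)
      exponential : b ^ n * s ^ e ≤ a ^ n * W ^ e
      exponential = ≤-trans (*-monoʳ-≤ (b ^ n) (^-monoˡ-≤ e (singularCount-≤ n m)))
        (dependents-exponential u 0<u a b 0<a ratio L L′ n₀≤n 0<T′ anticonc anticonc′ compare)
      expand : ∀ x y → (x ^ n * y ^ e) ^ C ≡ (x ^ C) ^ n * y ^ (e * C)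
      expand x y = trans (^-distribʳ-* C (x ^ n) (y ^ e)) (cong₂ _*_
        (trans (^-*-assoc x n C) (trans (cong (x ^_) (*-comm n C)) (sym (^-*-assoc x C n)))) (^-*-assoc y e C))
      core : s ^ (e * C) * m ^ n ≤ W ^ (e * C)
      core = cancel-≤ ((b ^ C) ^ n) (0<^ n (0<^ C (Ratio.0<b u a b 0<u 0<a ratio))) (begin
        (b ^ C) ^ n * (s ^ (e * C) * m ^ n)    ≡⟨ *-assoc ((b ^ C) ^ n) (s ^ (e * C)) (m ^ n) ⟨
        (b ^ C) ^ n * s ^ (e * C) * m ^ n      ≡⟨ cong (_* m ^ n) (expand b s) ⟨
        (b ^ n * s ^ e) ^ C * m ^ n            ≤⟨ *-monoˡ-≤ (m ^ n) (^-monoˡ-≤ C exponential) ⟩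
        (a ^ n * W ^ e) ^ C * m ^ n            ≡⟨ cong (_* m ^ n) (expand a W) ⟩
        (a ^ C) ^ n * W ^ (e * C) * m ^ n      ≡⟨ rotate ((a ^ C) ^ n) (W ^ (e * C)) (m ^ n) ⟩
        m ^ n * (a ^ C) ^ n * W ^ (e * C)      ≡⟨ cong (_* W ^ (e * C)) (^-distribʳ-* n m (a ^ C)) ⟨
        (m * a ^ C) ^ n * W ^ (e * C)          ≤⟨ *-monoˡ-≤ (W ^ (e * C)) (^-monoˡ-≤ n size) ⟩
        (b ^ C) ^ n * W ^ (e * C)              ∎)
        where
        rotate : ∀ x y z → x * y * z ≡ z * x * y
        rotate = solve-∀

-- The constant c is the rational number p / q; the inequality is the q-th power of the probability
-- bound, multiplied by the q-th power of the number of matrices.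
theorem1p1 : Σ ℕ λ p → Σ ℕ λ q → 0 < p × 0 < q ×
    ((n m : ℕ) → 1 ≤ n → 1 ≤ m →
    singularCount n m ^ q * m ^ (p * n) ≤ (2 * m + 1) ^ (n * n * q))
-- 3240 = 2 · 1620, so that (1 + 1/3240)² ≤ 1620/1619, the weakest gain among the laws. The exponent
-- C is the sum of what the two ranges of m require.
theorem1p1 = conclude 3240 (s≤s z≤n) (16384 * 359 + 256 * 1619)
  (law (16384 * 359 + 256 * 1619) (m≤m+n (16384 * 359) (256 * 1619)) (m≤n+m (256 * 1619) (16384 * 359)))
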